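{- Let $\omega=e^{2\pi i/3}$ and let $$A=\begin{pmatrix}0&0&0&0&0&0\\0&0&1&1&2&2\\0&1&0&2&2&1\\0&1&2&0&1&2\\0&2&2&1&0&1\\0&2&1&2&1&0\end{pmatrix}$$ with entries in $\mathbb{Z}/3\mathbb{Z}$ and rows and columns indexed by $0,\dots,5$. Let $H$ be the $6\times 6$ complex matrix with entries $H_{rs}=\omega^{A_{rs}}$, let $h_0,\dots,h_5\in\mathbb{C}^6$ be its columns, and let $\Phi_{21}$ be the $6\times 6$ array of vectors with $(i,j)$ entry $\frac{1}{\sqrt6}(h_i\odot h_j)\in\mathbb{C}^6$, $0\le i,j\le 5$. Then $\Phi_{21}$ is a quantum Latin square of order $6$ and its cardinality is $21$.
   Context: For $x,y\in\mathbb{C}^n$, $x\odot y=(x_0y_0,\dots,x_{n-1}y_{n-1})^{\mathsf T}$ is the entrywise (Schur) product. A quantum Latin square of order $n$, denoted $\mathrm{QLS}(n)$, is an $n\times n$ array $(\phi_{ij})_{0\le i,j\le n-1}$ of unit vectors in $\mathbb{C}^n$ such that every row and every column forms an orthonormal basis of $\mathbb{C}^n$. Two unit vectors $u,v$ are phase equivalent, $u\sim v$, if $u=e^{i\alpha}v$ for some $\alpha\in\mathbb{R}$. The cardinality of a quantum Latin square is the number of distinct phase-equivalence classes among its $n^2$ entries. -}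

module Defs where

open import Data.Fin.Base using (Fin; toℕ)
open import Data.Fin.Patterns using (0F; 1F; 2F)
open import Data.Integer.Base using (+_; +[1+_]; -[1+_])
import Data.Integer.Base as ℤ
import Data.Integer.Properties as ℤ
open import Data.Nat.Base using (ℕ; zero; suc; z≤n; s≤s)
import Data.Nat.Base as ℕ
import Data.Nat.Properties as ℕ
import Data.Nat.Solver as ℕSolver
open import Data.Nat.Coprimality using (1-coprimeTo) renaming (sym to coprime-sym)
open import Data.Product.Base using (Σ; ∃; _×_; _,_; proj₁; proj₂)
open import Data.Rational.Base using (ℚ; mkℚ; 0ℚ; 1ℚ; ½; 1/_; *≤*; positive; nonNegative)
import Data.Rational.Base as ℚ
import Data.Rational.Properties as ℚ
open import Data.Rational.Solver using (module +-*-Solver)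
open import Data.Sum.Base using (inj₁; inj₂)
import Data.Vec.Base as Vec
open import Data.Vec.Base using (Vec; []; _∷_)
open import Data.Vec.Functional using (Vector; foldr)
open import Function.Definitions using (Congruent; Bijective)
open import Relation.Binary.PropositionalEquality
open import Relation.Nullary using (¬_; contradiction; yes; no)

open ℚ.≤-Reasoning

infix 5 _⊖_

_⊖_ : ℚ → ℚ → ℚ
p ⊖ q = ℚ.∣ p ℚ.- q ∣

⊖-refl : ∀ p → p ⊖ p ≡ 0ℚ
⊖-refl p = cong ℚ.∣_∣ (ℚ.+-inverseʳ p)

⊖-comm : ∀ p q → p ⊖ q ≡ q ⊖ p
⊖-comm p q = trans (sym (ℚ.∣-p∣≡∣p∣ (p ℚ.- q)))
  (cong ℚ.∣_∣ (solve 2 (λ p q → :- (p :- q) := q :- p) refl p q))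
  where open +-*-Solver

⊖-triangle : ∀ p q r {δ ε} → (p ⊖ q) ℚ.≤ δ → (q ⊖ r) ℚ.≤ ε → (p ⊖ r) ℚ.≤ δ ℚ.+ ε
⊖-triangle p q r {δ} {ε} h k = begin
  ℚ.∣ p ℚ.- r ∣                     ≡⟨ cong ℚ.∣_∣ (solve 3 (λ p q r → p :- r := (p :- q) :+ (q :- r)) refl p q r) ⟩
  ℚ.∣ (p ℚ.- q) ℚ.+ (q ℚ.- r) ∣     ≤⟨ ℚ.∣p+q∣≤∣p∣+∣q∣ (p ℚ.- q) (q ℚ.- r) ⟩
  (p ⊖ q) ℚ.+ (q ⊖ r)               ≤⟨ ℚ.+-mono-≤ h k ⟩
  δ ℚ.+ ε                           ∎
  where open +-*-Solver

⊖-+ : ∀ p q r s → ((p ℚ.+ q) ⊖ (r ℚ.+ s)) ℚ.≤ (p ⊖ r) ℚ.+ (q ⊖ s)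
⊖-+ p q r s = begin
  ℚ.∣ (p ℚ.+ q) ℚ.- (r ℚ.+ s) ∣     ≡⟨ cong ℚ.∣_∣ (solve 4 (λ p q r s → (p :+ q) :- (r :+ s) := (p :- r) :+ (q :- s)) refl p q r s) ⟩
  ℚ.∣ (p ℚ.- r) ℚ.+ (q ℚ.- s) ∣     ≤⟨ ℚ.∣p+q∣≤∣p∣+∣q∣ (p ℚ.- r) (q ℚ.- s) ⟩
  (p ⊖ r) ℚ.+ (q ⊖ s)               ∎
  where open +-*-Solver

⊖-neg : ∀ p q → (ℚ.- p) ⊖ (ℚ.- q) ≡ p ⊖ q
⊖-neg p q = trans (cong ℚ.∣_∣ (solve 2 (λ p q → (:- p) :- (:- q) := q :- p) refl p q)) (⊖-comm q p)
  where open +-*-Solver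

*-mono-≤-nonNeg : ∀ {p q r s} → 0ℚ ℚ.≤ p → 0ℚ ℚ.≤ s → p ℚ.≤ q → r ℚ.≤ s → p ℚ.* r ℚ.≤ q ℚ.* s
*-mono-≤-nonNeg {p} {q} {r} {s} 0≤p 0≤s p≤q r≤s = begin
  p ℚ.* r  ≤⟨ ℚ.*-monoˡ-≤-nonNeg p {{nonNegative 0≤p}} r≤s ⟩
  p ℚ.* s  ≤⟨ ℚ.*-monoʳ-≤-nonNeg s {{nonNegative 0≤s}} p≤q ⟩
  q ℚ.* s  ∎

0≤* : ∀ {p q} → 0ℚ ℚ.≤ p → 0ℚ ℚ.≤ q → 0ℚ ℚ.≤ p ℚ.* q
0≤* {p} {q} 0≤p 0≤q = subst (ℚ._≤ p ℚ.* q) (ℚ.*-zeroˡ q) (ℚ.*-monoʳ-≤-nonNeg q {{nonNegative 0≤q}} 0≤p)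

0<* : ∀ {p q} → 0ℚ ℚ.< p → 0ℚ ℚ.< q → 0ℚ ℚ.< p ℚ.* q
0<* {p} {q} 0<p 0<q = subst (ℚ._< p ℚ.* q) (ℚ.*-zeroˡ q) (ℚ.*-monoˡ-<-pos q {{positive 0<q}} 0<p)

⊖-* : ∀ p q r s {B C} → 0ℚ ℚ.≤ B → 0ℚ ℚ.≤ C → ℚ.∣ p ∣ ℚ.≤ B → ℚ.∣ s ∣ ℚ.≤ C →
      ((p ℚ.* q) ⊖ (r ℚ.* s)) ℚ.≤ B ℚ.* (q ⊖ s) ℚ.+ C ℚ.* (p ⊖ r)
⊖-* p q r s {B} {C} 0≤B 0≤C p≤B s≤C = begin
  ℚ.∣ (p ℚ.* q) ℚ.- (r ℚ.* s) ∣                     ≡⟨ cong ℚ.∣_∣ (solve 4 (λ p q r s → (p :* q) :- (r :* s) := (p :* (q :- s)) :+ (s :* (p :- r))) refl p q r s) ⟩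
  ℚ.∣ p ℚ.* (q ℚ.- s) ℚ.+ s ℚ.* (p ℚ.- r) ∣         ≤⟨ ℚ.∣p+q∣≤∣p∣+∣q∣ (p ℚ.* (q ℚ.- s)) (s ℚ.* (p ℚ.- r)) ⟩
  ℚ.∣ p ℚ.* (q ℚ.- s) ∣ ℚ.+ ℚ.∣ s ℚ.* (p ℚ.- r) ∣   ≡⟨ cong₂ ℚ._+_ (ℚ.∣p*q∣≡∣p∣*∣q∣ p (q ℚ.- s)) (ℚ.∣p*q∣≡∣p∣*∣q∣ s (p ℚ.- r)) ⟩
  ℚ.∣ p ∣ ℚ.* (q ⊖ s) ℚ.+ ℚ.∣ s ∣ ℚ.* (p ⊖ r)       ≤⟨ ℚ.+-mono-≤ (ℚ.*-monoʳ-≤-nonNeg (q ⊖ s) {{ℚ.∣-∣-nonNeg (q ℚ.- s)}} p≤B)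
                                                                      (ℚ.*-monoʳ-≤-nonNeg (p ⊖ r) {{ℚ.∣-∣-nonNeg (p ℚ.- r)}} s≤C) ⟩
  B ℚ.* (q ⊖ s) ℚ.+ C ℚ.* (p ⊖ r)                   ∎
  where open +-*-Solver

∣∣≤ : ∀ p {ε} → p ℚ.≤ ε → ℚ.- p ℚ.≤ ε → ℚ.∣ p ∣ ℚ.≤ ε
∣∣≤ p h k with ℚ.∣p∣≡p∨∣p∣≡-p p
... | inj₁ e = subst (ℚ._≤ _) (sym e) h
... | inj₂ e = subst (ℚ._≤ _) (sym e) k

0<½ : 0ℚ ℚ.< ½
0<½ = ℚ.positive⁻¹ ½

0<half : ∀ {ε} → 0ℚ ℚ.< ε → 0ℚ ℚ.< ½ ℚ.* ε
0<half = 0<* 0<½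

half+half : ∀ ε → ½ ℚ.* ε ℚ.+ ½ ℚ.* ε ≡ ε
half+half ε = trans (sym (ℚ.*-distribʳ-+ ε ½ ½)) (ℚ.*-identityˡ ε)

shrink : ∀ {B ε} → 0ℚ ℚ.< B → 0ℚ ℚ.< ε → ∃ λ δ → 0ℚ ℚ.< δ × B ℚ.* δ ≡ ε
shrink {B} {ε} 0<B 0<ε = B⁻¹ ℚ.* ε , 0<* (ℚ.positive⁻¹ B⁻¹ {{ℚ.1/pos⇒pos B}}) 0<ε ,
  trans (sym (ℚ.*-assoc B B⁻¹ ε)) (trans (cong (ℚ._* ε) (ℚ.*-inverseʳ B)) (ℚ.*-identityˡ ε))
  where
  instance
    posB = positive 0<B
    nzB  = ℚ.pos⇒nonZero B
  B⁻¹ = 1/ B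

fromℕ : ℕ → ℚ
fromℕ n = mkℚ (+ n) 0 (coprime-sym (1-coprimeTo n))

unitFraction : ℕ → ℚ
unitFraction k = 1/ fromℕ (suc k)

fromℕ-/1 : ∀ n → + n ℚ./ 1 ≡ fromℕ n
fromℕ-/1 n = ℚ.normalize-coprime (coprime-sym (1-coprimeTo n))

fromℕ-+ : ∀ m n → fromℕ m ℚ.+ fromℕ n ≡ fromℕ (m ℕ.+ n)
fromℕ-+ m n = trans (cong (ℚ._/ 1) (cong₂ ℤ._+_ (ℤ.*-identityʳ (+ m)) (ℤ.*-identityʳ (+ n)))) (fromℕ-/1 (m ℕ.+ n))

fromℕ-* : ∀ m n → fromℕ m ℚ.* fromℕ n ≡ fromℕ (m ℕ.* n)
fromℕ-* m n = trans (cong (ℚ._/ 1) (sym (ℤ.pos-* m n))) (fromℕ-/1 (m ℕ.* n))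

fromℕ-mono : ∀ {m n} → m ℕ.≤ n → fromℕ m ℚ.≤ fromℕ n
fromℕ-mono m≤n = *≤* (ℤ.*-monoʳ-≤-nonNeg (+ 1) (ℤ.+≤+ m≤n))

0≤fromℕ : ∀ n → 0ℚ ℚ.≤ fromℕ n
0≤fromℕ n = fromℕ-mono {0} {n} z≤n

0<fromℕ : ∀ n → 0ℚ ℚ.< fromℕ (suc n)
0<fromℕ n = ℚ.positive⁻¹ (fromℕ (suc n))

0<unitFraction : ∀ n → 0ℚ ℚ.< unitFraction n
0<unitFraction n = ℚ.positive⁻¹ (unitFraction n)

0≤unitFraction : ∀ n → 0ℚ ℚ.≤ unitFraction n
0≤unitFraction n = ℚ.<⇒≤ (0<unitFraction n)

unitFraction-inverse : ∀ n → fromℕ (suc n) ℚ.* unitFraction n ≡ 1ℚ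
unitFraction-inverse n = ℚ.*-inverseʳ (fromℕ (suc n))

archimedean : ∀ q → ∃ λ n → q ℚ.≤ fromℕ n
archimedean (mkℚ (+ n) d _)    = n , *≤* (ℤ.*-monoˡ-≤-nonNeg (+ n) (ℤ.+≤+ (s≤s z≤n)))
archimedean (mkℚ -[1+ n ] d _) = 0 , *≤* ℤ.-≤+

unitFraction-antitone : ∀ {m n} → m ℕ.≤ n → unitFraction n ℚ.≤ unitFraction m
unitFraction-antitone m≤n = *≤* (ℤ.*-monoˡ-≤-nonNeg (+ 1) (ℤ.+≤+ (s≤s m≤n)))

small : ∀ {ε} → 0ℚ ℚ.< ε → ∃ λ k → unitFraction k ℚ.≤ ε
small {ε} 0<ε with shrink 0<ε (ℚ.positive⁻¹ 1ℚ)
... | δ , 0<δ , εδ≡1 with archimedean δ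
... | n , δ≤n = n , (begin
  unitFraction n                            ≡⟨ sym (ℚ.*-identityˡ _) ⟩
  1ℚ ℚ.* unitFraction n                     ≡⟨ cong (ℚ._* unitFraction n) (sym εδ≡1) ⟩
  (ε ℚ.* δ) ℚ.* unitFraction n              ≤⟨ ℚ.*-monoʳ-≤-nonNeg (unitFraction n) (ℚ.*-monoˡ-≤-nonNeg ε {{nonNegative (ℚ.<⇒≤ 0<ε)}}
                                                  (ℚ.≤-trans δ≤n (fromℕ-mono (ℕ.n≤1+n n)))) ⟩
  (ε ℚ.* fromℕ (suc n)) ℚ.* unitFraction n  ≡⟨ ℚ.*-assoc ε (fromℕ (suc n)) (unitFraction n) ⟩
  ε ℚ.* (fromℕ (suc n) ℚ.* unitFraction n)  ≡⟨ cong (ε ℚ.*_) (unitFraction-inverse n) ⟩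
  ε ℚ.* 1ℚ                                  ≡⟨ ℚ.*-identityʳ ε ⟩
  ε                                         ∎)

IsCauchy : (ℕ → ℚ) → Set
IsCauchy x = ∀ ε → 0ℚ ℚ.< ε → ∃ λ N → ∀ m n → N ℕ.≤ m → N ℕ.≤ n → (x m ⊖ x n) ℚ.≤ ε

-- Cauchy sequences of rationals whose modulus of convergence is part of the
-- data; equality is _≈_.
record ℝ : Set where
  constructor mkℝ
  field
    seq    : ℕ → ℚ
    cauchy : IsCauchy seq

open ℝ public

Within : ℚ → ℝ → ℝ → Set
Within ε x y = ∃ λ N → ∀ n → N ℕ.≤ n → (seq x n ⊖ seq y n) ℚ.≤ ε

infix 4 _≈_ _<_ _≤_

_≈_ : ℝ → ℝ → Set
x ≈ y = ∀ ε → 0ℚ ℚ.< ε → Within ε x y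

_<_ : ℝ → ℝ → Set
x < y = ∃ λ ε → 0ℚ ℚ.< ε × ∃ λ N → ∀ n → N ℕ.≤ n → seq x n ℚ.+ ε ℚ.≤ seq y n

_≤_ : ℝ → ℝ → Set
x ≤ y = ¬ y < x

fromℚ : ℚ → ℝ
fromℚ q = mkℝ (λ _ → q) λ ε 0<ε → 0 , λ _ _ _ _ → subst (ℚ._≤ ε) (sym (⊖-refl q)) (ℚ.<⇒≤ 0<ε)

0ℝ 1ℝ : ℝ
0ℝ = fromℚ 0ℚ
1ℝ = fromℚ 1ℚ

infixl 6 _+_
infixl 7 _*_
infix  8 -_

abstract
  +-cauchy : ∀ x y → IsCauchy (λ n → seq x n ℚ.+ seq y n)
  +-cauchy x y ε 0<ε =
    let M , p = cauchy x (½ ℚ.* ε) (0<half 0<ε)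
        N , q = cauchy y (½ ℚ.* ε) (0<half 0<ε)
    in M ℕ.⊔ N , λ m n h k → begin
      (seq x m ℚ.+ seq y m) ⊖ (seq x n ℚ.+ seq y n)  ≤⟨ ⊖-+ (seq x m) (seq y m) (seq x n) (seq y n) ⟩
      (seq x m ⊖ seq x n) ℚ.+ (seq y m ⊖ seq y n)    ≤⟨ ℚ.+-mono-≤ (p m n (ℕ.m⊔n≤o⇒m≤o M N h) (ℕ.m⊔n≤o⇒m≤o M N k))
                                                                   (q m n (ℕ.m⊔n≤o⇒n≤o M N h) (ℕ.m⊔n≤o⇒n≤o M N k)) ⟩
      ½ ℚ.* ε ℚ.+ ½ ℚ.* ε                            ≡⟨ half+half ε ⟩
      ε                                              ∎

_+_ : ℝ → ℝ → ℝ
x + y = mkℝ (λ n → seq x n ℚ.+ seq y n) (+-cauchy x y)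

abstract
  neg-cauchy : ∀ x → IsCauchy (λ n → ℚ.- seq x n)
  neg-cauchy x ε 0<ε =
    let N , p = cauchy x ε 0<ε
    in N , λ m n h k → subst (ℚ._≤ ε) (sym (⊖-neg (seq x m) (seq x n))) (p m n h k)

-_ : ℝ → ℝ
- x = mkℝ (λ n → ℚ.- seq x n) (neg-cauchy x)

initialBound : (x : ℕ → ℚ) → ∀ N → ∃ λ B → 0ℚ ℚ.≤ B × (∀ n → n ℕ.< N → ℚ.∣ x n ∣ ℚ.≤ B)
initialBound x zero    = 0ℚ , ℚ.≤-refl , λ _ ()
initialBound x (suc N) with initialBound x N
... | B , 0≤B , p = B ℚ.+ ℚ.∣ x N ∣ , ℚ.≤-trans 0≤B B≤ , q
  where
  B≤ : B ℚ.≤ B ℚ.+ ℚ.∣ x N ∣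
  B≤ = subst (ℚ._≤ B ℚ.+ ℚ.∣ x N ∣) (ℚ.+-identityʳ B) (ℚ.+-monoʳ-≤ B (ℚ.0≤∣p∣ (x N)))
  q : ∀ n → n ℕ.< suc N → ℚ.∣ x n ∣ ℚ.≤ B ℚ.+ ℚ.∣ x N ∣
  q n (s≤s n≤N) with ℕ.m≤n⇒m<n∨m≡n n≤N
  ... | inj₁ n<N  = ℚ.≤-trans (p n n<N) B≤
  ... | inj₂ refl = subst (ℚ._≤ B ℚ.+ ℚ.∣ x N ∣) (ℚ.+-identityˡ _) (ℚ.+-monoˡ-≤ ℚ.∣ x N ∣ 0≤B)

bounded : (x : ℝ) → ∃ λ B → 0ℚ ℚ.< B × (∀ n → ℚ.∣ seq x n ∣ ℚ.≤ B)
bounded x = B ℚ.+ (1ℚ ℚ.+ ℚ.∣ seq x N ∣) , 0<B′ , bound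
  where
  N = proj₁ (cauchy x 1ℚ (ℚ.positive⁻¹ 1ℚ))
  tail = proj₂ (cauchy x 1ℚ (ℚ.positive⁻¹ 1ℚ))
  B = proj₁ (initialBound (seq x) N)
  0≤B = proj₁ (proj₂ (initialBound (seq x) N))
  head = proj₂ (proj₂ (initialBound (seq x) N))
  0<c : 0ℚ ℚ.< 1ℚ ℚ.+ ℚ.∣ seq x N ∣
  0<c = ℚ.+-mono-<-≤ (ℚ.positive⁻¹ 1ℚ) (ℚ.0≤∣p∣ (seq x N))
  0<B′ : 0ℚ ℚ.< B ℚ.+ (1ℚ ℚ.+ ℚ.∣ seq x N ∣)
  0<B′ = ℚ.+-mono-≤-< 0≤B 0<c
  bound : ∀ n → ℚ.∣ seq x n ∣ ℚ.≤ B ℚ.+ (1ℚ ℚ.+ ℚ.∣ seq x N ∣)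
  bound n with n ℕ.<? N
  ... | yes n<N = begin
    ℚ.∣ seq x n ∣                    ≤⟨ head n n<N ⟩
    B                                ≡⟨ sym (ℚ.+-identityʳ B) ⟩
    B ℚ.+ 0ℚ                         ≤⟨ ℚ.+-monoʳ-≤ B (ℚ.<⇒≤ 0<c) ⟩
    B ℚ.+ (1ℚ ℚ.+ ℚ.∣ seq x N ∣)     ∎
  ... | no n≮N = begin
    ℚ.∣ seq x n ∣                                      ≡⟨ cong ℚ.∣_∣ (solve 2 (λ a b → a := (a :- b) :+ b) refl (seq x n) (seq x N)) ⟩
    ℚ.∣ (seq x n ℚ.- seq x N) ℚ.+ seq x N ∣            ≤⟨ ℚ.∣p+q∣≤∣p∣+∣q∣ (seq x n ℚ.- seq x N) (seq x N) ⟩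
    (seq x n ⊖ seq x N) ℚ.+ ℚ.∣ seq x N ∣              ≤⟨ ℚ.+-monoˡ-≤ ℚ.∣ seq x N ∣ (tail n N (ℕ.≮⇒≥ n≮N) ℕ.≤-refl) ⟩
    1ℚ ℚ.+ ℚ.∣ seq x N ∣                               ≡⟨ sym (ℚ.+-identityˡ _) ⟩
    0ℚ ℚ.+ (1ℚ ℚ.+ ℚ.∣ seq x N ∣)                      ≤⟨ ℚ.+-monoˡ-≤ _ 0≤B ⟩
    B ℚ.+ (1ℚ ℚ.+ ℚ.∣ seq x N ∣)                       ∎
    where open +-*-Solver

abstract
  *-cauchy : ∀ x y → IsCauchy (λ n → seq x n ℚ.* seq y n)
  *-cauchy x y ε 0<ε =
    let B , 0<B , x≤B = bounded x
        C , 0<C , y≤C = bounded y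
        δ , 0<δ , Bδ  = shrink 0<B (0<half 0<ε)
        η , 0<η , Cη  = shrink 0<C (0<half 0<ε)
        M , p         = cauchy x η 0<η
        N , q         = cauchy y δ 0<δ
    in M ℕ.⊔ N , λ m n h k → begin
      (seq x m ℚ.* seq y m) ⊖ (seq x n ℚ.* seq y n)
        ≤⟨ ⊖-* (seq x m) (seq y m) (seq x n) (seq y n) (ℚ.<⇒≤ 0<B) (ℚ.<⇒≤ 0<C) (x≤B m) (y≤C n) ⟩
      B ℚ.* (seq y m ⊖ seq y n) ℚ.+ C ℚ.* (seq x m ⊖ seq x n)
        ≤⟨ ℚ.+-mono-≤ (ℚ.*-monoˡ-≤-nonNeg B {{nonNegative (ℚ.<⇒≤ 0<B)}} (q m n (ℕ.m⊔n≤o⇒n≤o M N h) (ℕ.m⊔n≤o⇒n≤o M N k)))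
                      (ℚ.*-monoˡ-≤-nonNeg C {{nonNegative (ℚ.<⇒≤ 0<C)}} (p m n (ℕ.m⊔n≤o⇒m≤o M N h) (ℕ.m⊔n≤o⇒m≤o M N k))) ⟩
      B ℚ.* δ ℚ.+ C ℚ.* η   ≡⟨ cong₂ ℚ._+_ Bδ Cη ⟩
      ½ ℚ.* ε ℚ.+ ½ ℚ.* ε   ≡⟨ half+half ε ⟩
      ε                     ∎

_*_ : ℝ → ℝ → ℝ
x * y = mkℝ (λ n → seq x n ℚ.* seq y n) (*-cauchy x y)

-- The sequence is shifted to where it stays above a positive rational, so that
-- every entry can be inverted.
recip : (x : ℝ) → 0ℝ < x → ℝ
recip x (δ , 0<δ , N , δ≤x) = mkℝ inv inv-cauchy
  where
  x′ : ℕ → ℚ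
  x′ n = seq x (N ℕ.+ n)

  δ≤x′ : ∀ n → δ ℚ.≤ x′ n
  δ≤x′ n = subst (ℚ._≤ x′ n) (ℚ.+-identityˡ δ) (δ≤x (N ℕ.+ n) (ℕ.m≤m+n N n))

  instance
    pos-δ : ℚ.Positive δ
    pos-δ = positive 0<δ
    nz-δ : ℚ.NonZero δ
    nz-δ = ℚ.pos⇒nonZero δ
    pos-x′ : ∀ {n} → ℚ.Positive (x′ n)
    pos-x′ {n} = positive (ℚ.<-≤-trans 0<δ (δ≤x′ n))
    nz-x′ : ∀ {n} → ℚ.NonZero (x′ n)
    nz-x′ {n} = ℚ.pos⇒nonZero (x′ n)

  inv : ℕ → ℚ
  inv n = 1/ x′ n

  0≤inv : ∀ n → 0ℚ ℚ.≤ inv n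
  0≤inv n = ℚ.<⇒≤ (ℚ.positive⁻¹ (inv n) {{ℚ.1/pos⇒pos (x′ n)}})

  D = 1/ δ

  0≤D : 0ℚ ℚ.≤ D
  0≤D = ℚ.<⇒≤ (ℚ.positive⁻¹ D {{ℚ.1/pos⇒pos δ}})

  inv≤D : ∀ n → inv n ℚ.≤ D
  inv≤D n = begin
    inv n                         ≡⟨ sym (ℚ.*-identityʳ (inv n)) ⟩
    inv n ℚ.* 1ℚ                  ≡⟨ cong (inv n ℚ.*_) (sym (ℚ.*-inverseʳ δ)) ⟩
    inv n ℚ.* (δ ℚ.* D)           ≤⟨ ℚ.*-monoˡ-≤-nonNeg (inv n) {{nonNegative (0≤inv n)}}
                                       (ℚ.*-monoʳ-≤-nonNeg D {{nonNegative 0≤D}} (δ≤x′ n)) ⟩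
    inv n ℚ.* (x′ n ℚ.* D)        ≡⟨ sym (ℚ.*-assoc (inv n) (x′ n) D) ⟩
    (inv n ℚ.* x′ n) ℚ.* D        ≡⟨ cong (ℚ._* D) (ℚ.*-inverseˡ (x′ n)) ⟩
    1ℚ ℚ.* D                      ≡⟨ ℚ.*-identityˡ D ⟩
    D                             ∎

  inv-⊖ : ∀ m n → (inv m ⊖ inv n) ℚ.≤ D ℚ.* (D ℚ.* (x′ m ⊖ x′ n))
  inv-⊖ m n = begin
    inv m ⊖ inv n                                     ≡⟨ cong ℚ.∣_∣ eq ⟩
    ℚ.∣ inv m ℚ.* (inv n ℚ.* (x′ n ℚ.- x′ m)) ∣       ≡⟨ ℚ.∣p*q∣≡∣p∣*∣q∣ (inv m) _ ⟩
    ℚ.∣ inv m ∣ ℚ.* ℚ.∣ inv n ℚ.* (x′ n ℚ.- x′ m) ∣   ≡⟨ cong₂ ℚ._*_ (ℚ.0≤p⇒∣p∣≡p (0≤inv m)) (ℚ.∣p*q∣≡∣p∣*∣q∣ (inv n) _) ⟩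
    inv m ℚ.* (ℚ.∣ inv n ∣ ℚ.* (x′ n ⊖ x′ m))         ≡⟨ cong (inv m ℚ.*_) (cong₂ ℚ._*_ (ℚ.0≤p⇒∣p∣≡p (0≤inv n)) (⊖-comm (x′ n) (x′ m))) ⟩
    inv m ℚ.* (inv n ℚ.* (x′ m ⊖ x′ n))               ≤⟨ *-mono-≤-nonNeg (0≤inv m) (0≤* 0≤D (ℚ.0≤∣p∣ _)) (inv≤D m)
                                                          (ℚ.*-monoʳ-≤-nonNeg (x′ m ⊖ x′ n) {{ℚ.∣-∣-nonNeg (x′ m ℚ.- x′ n)}} (inv≤D n)) ⟩
    D ℚ.* (D ℚ.* (x′ m ⊖ x′ n))                       ∎
    where
    eq : inv m ℚ.- inv n ≡ inv m ℚ.* (inv n ℚ.* (x′ n ℚ.- x′ m))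
    eq = sym (trans
      (solve 4 (λ a b p q → a :* (b :* (q :- p)) := a :* (b :* q) :- b :* (a :* p)) refl (inv m) (inv n) (x′ m) (x′ n))
      (cong₂ ℚ._-_ (trans (cong (inv m ℚ.*_) (ℚ.*-inverseˡ (x′ n))) (ℚ.*-identityʳ (inv m)))
                   (trans (cong (inv n ℚ.*_) (ℚ.*-inverseˡ (x′ m))) (ℚ.*-identityʳ (inv n)))))
      where open +-*-Solver

  abstract
    inv-cauchy : IsCauchy inv
    inv-cauchy ε 0<ε =
      let 0<D = ℚ.positive⁻¹ D {{ℚ.1/pos⇒pos δ}}
          η , 0<η , Dη = shrink 0<D 0<ε
          θ , 0<θ , Dθ = shrink 0<D 0<η
          K , p = cauchy x θ 0<θ
      in K , λ m n h k → begin
        inv m ⊖ inv n                  ≤⟨ inv-⊖ m n ⟩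
        D ℚ.* (D ℚ.* (x′ m ⊖ x′ n))    ≤⟨ ℚ.*-monoˡ-≤-nonNeg D {{nonNegative 0≤D}} (ℚ.*-monoˡ-≤-nonNeg D {{nonNegative 0≤D}}
                                            (p (N ℕ.+ m) (N ℕ.+ n) (ℕ.≤-trans h (ℕ.m≤n+m m N)) (ℕ.≤-trans k (ℕ.m≤n+m n N)))) ⟩
        D ℚ.* (D ℚ.* θ)                ≡⟨ trans (cong (D ℚ.*_) Dθ) Dη ⟩
        ε                              ∎

isqrt : ℕ → ℕ
isqrt zero    = 0
isqrt (suc n) with suc (isqrt n) ℕ.* suc (isqrt n) ℕ.≤? suc n
... | yes _ = suc (isqrt n)
... | no  _ = isqrt n

isqrt-lower : ∀ n → isqrt n ℕ.* isqrt n ℕ.≤ n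
isqrt-lower zero = z≤n
isqrt-lower (suc n) with suc (isqrt n) ℕ.* suc (isqrt n) ℕ.≤? suc n
... | yes p = p
... | no  _ = ℕ.≤-trans (isqrt-lower n) (ℕ.n≤1+n n)

isqrt-upper : ∀ n → n ℕ.< suc (isqrt n) ℕ.* suc (isqrt n)
isqrt-upper zero = s≤s z≤n
isqrt-upper (suc n) with suc (isqrt n) ℕ.* suc (isqrt n) ℕ.≤? suc n
... | yes p = ℕ.<-≤-trans (s≤s (isqrt-upper n)) (ℕ.*-mono-< {suc (isqrt n)} {suc (suc (isqrt n))} ℕ.≤-refl ℕ.≤-refl)
... | no ¬p = ℕ.≰⇒> ¬p

sq-cancel-< : ∀ {m n} → m ℕ.* m ℕ.< n ℕ.* n → m ℕ.< n
sq-cancel-< {m} {n} h with m ℕ.<? n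
... | yes m<n = m<n
... | no  m≮n = contradiction (ℕ.*-mono-≤ (ℕ.≮⇒≥ m≮n) (ℕ.≮⇒≥ m≮n)) (ℕ.<⇒≱ h)

-- k ↦ ⌊ √n (k + 1) ⌋ / (k + 1)
√-seq : ℕ → ℕ → ℚ
√-seq n k = fromℕ (isqrt (n ℕ.* (suc k ℕ.* suc k))) ℚ.* unitFraction k

√-seq-≤ : ∀ n k l → √-seq n k ℚ.- √-seq n l ℚ.≤ unitFraction l
√-seq-≤ n k l = begin
  fromℕ a ℚ.* u ℚ.- fromℕ b ℚ.* v              ≡⟨ cong₂ ℚ._-_ lhs refl ⟩
  (fromℕ a ℚ.* fromℕ q) ℚ.* (u ℚ.* v) ℚ.- fromℕ b ℚ.* v
                                               ≤⟨ ℚ.+-monoˡ-≤ _ (ℚ.*-monoʳ-≤-nonNeg (u ℚ.* v) {{nonNegative (0≤* (0≤unitFraction k) (0≤unitFraction l))}}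
                                                    (subst₂ ℚ._≤_ (sym (fromℕ-* a q)) (sym (fromℕ-* (suc b) p)) (fromℕ-mono aq≤))) ⟩
  (fromℕ (suc b) ℚ.* fromℕ p) ℚ.* (u ℚ.* v) ℚ.- fromℕ b ℚ.* v
                                               ≡⟨ cong₂ ℚ._-_ rhs refl ⟩
  (1ℚ ℚ.+ fromℕ b) ℚ.* v ℚ.- fromℕ b ℚ.* v     ≡⟨ solve 2 (λ b v → (con 1ℚ :+ b) :* v :- b :* v := v) refl (fromℕ b) v ⟩
  v                                            ∎
  where
  open +-*-Solver
  p = suc k
  q = suc l
  u = unitFraction k
  v = unitFraction l
  a = isqrt (n ℕ.* (p ℕ.* p))
  b = isqrt (n ℕ.* (q ℕ.* q))
  aq≤ : a ℕ.* q ℕ.≤ suc b ℕ.* p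
  aq≤ = ℕ.<⇒≤ (sq-cancel-< (ℕ.≤-<-trans
    (ℕ.≤-trans (ℕ.≤-reflexive (ns.solve 2 (λ a q → (a ns.:* q) ns.:* (a ns.:* q) ns.:= (a ns.:* a) ns.:* (q ns.:* q)) refl a q))
      (ℕ.≤-trans (ℕ.*-monoˡ-≤ (q ℕ.* q) (isqrt-lower (n ℕ.* (p ℕ.* p))))
        (ℕ.≤-reflexive (ns.solve 3 (λ n p q → (n ns.:* (p ns.:* p)) ns.:* (q ns.:* q) ns.:= (n ns.:* (q ns.:* q)) ns.:* (p ns.:* p)) refl n p q))))
    (ℕ.<-≤-trans (ℕ.*-monoˡ-< (p ℕ.* p) (isqrt-upper (n ℕ.* (q ℕ.* q))))
      (ℕ.≤-reflexive (ns.solve 2 (λ b p → (b ns.:* b) ns.:* (p ns.:* p) ns.:= (b ns.:* p) ns.:* (b ns.:* p)) refl (suc b) p)))))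
    where module ns = ℕSolver.+-*-Solver
  lhs : fromℕ a ℚ.* u ≡ (fromℕ a ℚ.* fromℕ q) ℚ.* (u ℚ.* v)
  lhs = sym (trans (solve 4 (λ a q u v → (a :* q) :* (u :* v) := (a :* u) :* (q :* v)) refl (fromℕ a) (fromℕ q) u v)
                   (trans (cong (fromℕ a ℚ.* u ℚ.*_) (unitFraction-inverse l)) (ℚ.*-identityʳ _)))
  rhs : (fromℕ (suc b) ℚ.* fromℕ p) ℚ.* (u ℚ.* v) ≡ (1ℚ ℚ.+ fromℕ b) ℚ.* v
  rhs = trans (solve 4 (λ b p u v → (b :* p) :* (u :* v) := (b :* v) :* (p :* u)) refl (fromℕ (suc b)) (fromℕ p) u v)
              (trans (cong (fromℕ (suc b) ℚ.* v ℚ.*_) (unitFraction-inverse k))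
                     (trans (ℚ.*-identityʳ _) (cong (ℚ._* v) (sym (fromℕ-+ 1 b)))))

abstract
  √-cauchy : ∀ n → IsCauchy (√-seq n)
  √-cauchy n ε 0<ε =
    let K , u≤ε = small 0<ε
        le : ∀ k l → K ℕ.≤ l → √-seq n k ℚ.- √-seq n l ℚ.≤ ε
        le k l K≤l = ℚ.≤-trans (√-seq-≤ n k l) (ℚ.≤-trans (unitFraction-antitone K≤l) u≤ε)
    in K , λ k l h h′ → ∣∣≤ _ (le k l h′)
         (subst (ℚ._≤ ε) (solve 2 (λ a b → b :- a := :- (a :- b)) refl (√-seq n k) (√-seq n l)) (le l k h))
    where open +-*-Solver

√_ : ℕ → ℝ
√ n = mkℝ (√-seq n) (√-cauchy n)

√-pos : ∀ n → 0ℝ < √ suc n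
√-pos n = 1ℚ , ℚ.positive⁻¹ 1ℚ , 0 , λ k _ → begin
  0ℚ ℚ.+ 1ℚ                            ≡⟨ sym (unitFraction-inverse k) ⟩
  fromℕ (suc k) ℚ.* unitFraction k     ≤⟨ ℚ.*-monoʳ-≤-nonNeg (unitFraction k) (fromℕ-mono (k≤ k)) ⟩
  √-seq (suc n) k                      ∎
  where
  k≤ : ∀ k → suc k ℕ.≤ isqrt (suc n ℕ.* (suc k ℕ.* suc k))
  k≤ k with s≤s p ← sq-cancel-< {suc k} (ℕ.≤-<-trans (ℕ.m≤m+n (suc k ℕ.* suc k) _) (isqrt-upper (suc n ℕ.* (suc k ℕ.* suc k)))) = p

IsCauchyℝ : (ℕ → ℝ) → Set
IsCauchyℝ s = ∀ ε → 0ℚ ℚ.< ε → ∃ λ N → ∀ m n → N ℕ.≤ m → N ℕ.≤ n → Within ε (s m) (s n)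

-- Entry n of the limit is a rational within 1/(n+1) of s N, where the s m
-- with m ≥ N all lie within 1/(n+1) of each other.
lim : (s : ℕ → ℝ) → IsCauchyℝ s → ℝ
lim s c = mkℝ (λ n → seq (s (N n)) (K n)) lim-cauchy
  where
  N : ℕ → ℕ
  N n = proj₁ (c (unitFraction n) (0<unitFraction n))

  s-close : ∀ n p q → N n ℕ.≤ p → N n ℕ.≤ q → Within (unitFraction n) (s p) (s q)
  s-close n = proj₂ (c (unitFraction n) (0<unitFraction n))

  K : ℕ → ℕ
  K n = proj₁ (cauchy (s (N n)) (unitFraction n) (0<unitFraction n))

  K-close : ∀ n k → K n ℕ.≤ k → (seq (s (N n)) (K n) ⊖ seq (s (N n)) k) ℚ.≤ unitFraction n
  K-close n k h = proj₂ (cauchy (s (N n)) (unitFraction n) (0<unitFraction n)) (K n) k ℕ.≤-refl h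

  close : ∀ ε m n → unitFraction m ℚ.≤ ½ ℚ.* (½ ℚ.* ε) → unitFraction n ℚ.≤ ½ ℚ.* (½ ℚ.* ε) →
          (seq (s (N m)) (K m) ⊖ seq (s (N n)) (K n)) ℚ.≤ ε
  close ε m n hm hn = begin
    a ⊖ e                                    ≤⟨ ⊖-triangle a p e (⊖-triangle a b p ab bp) (⊖-triangle p d e pd de) ⟩
    (θ ℚ.+ θ) ℚ.+ (θ ℚ.+ θ)                  ≡⟨ cong₂ ℚ._+_ (half+half (½ ℚ.* ε)) (half+half (½ ℚ.* ε)) ⟩
    ½ ℚ.* ε ℚ.+ ½ ℚ.* ε                      ≡⟨ half+half ε ⟩
    ε                                        ∎
    where
    θ = ½ ℚ.* (½ ℚ.* ε)
    P = N m ℕ.⊔ N n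
    m-close = s-close m (N m) P ℕ.≤-refl (ℕ.m≤m⊔n (N m) (N n))
    n-close = s-close n P (N n) (ℕ.m≤n⊔m (N m) (N n)) ℕ.≤-refl
    k = (K m ℕ.⊔ K n) ℕ.⊔ (proj₁ m-close ℕ.⊔ proj₁ n-close)
    Km≤k = ℕ.≤-trans (ℕ.m≤m⊔n (K m) (K n)) (ℕ.m≤m⊔n (K m ℕ.⊔ K n) _)
    Kn≤k = ℕ.≤-trans (ℕ.m≤n⊔m (K m) (K n)) (ℕ.m≤m⊔n (K m ℕ.⊔ K n) _)
    m≤k  = ℕ.≤-trans (ℕ.m≤m⊔n (proj₁ m-close) (proj₁ n-close)) (ℕ.m≤n⊔m (K m ℕ.⊔ K n) _)
    n≤k  = ℕ.≤-trans (ℕ.m≤n⊔m (proj₁ m-close) (proj₁ n-close)) (ℕ.m≤n⊔m (K m ℕ.⊔ K n) _)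
    a = seq (s (N m)) (K m)
    b = seq (s (N m)) k
    p = seq (s P) k
    d = seq (s (N n)) k
    e = seq (s (N n)) (K n)
    ab : (a ⊖ b) ℚ.≤ θ
    ab = ℚ.≤-trans (K-close m k Km≤k) hm
    bp : (b ⊖ p) ℚ.≤ θ
    bp = ℚ.≤-trans (proj₂ m-close k m≤k) hm
    pd : (p ⊖ d) ℚ.≤ θ
    pd = ℚ.≤-trans (proj₂ n-close k n≤k) hn
    de : (d ⊖ e) ℚ.≤ θ
    de = subst (ℚ._≤ θ) (⊖-comm e d) (ℚ.≤-trans (K-close n k Kn≤k) hn)

  abstract
    lim-cauchy : IsCauchy (λ n → seq (s (N n)) (K n))
    lim-cauchy ε 0<ε =
      let M , u≤ = small (0<half (0<half 0<ε))
      in M , λ m n M≤m M≤n → close ε m n (ℚ.≤-trans (unitFraction-antitone M≤m) u≤) (ℚ.≤-trans (unitFraction-antitone M≤n) u≤)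

-- x ^ k / k !
expTerm : ℝ → ℕ → ℝ
expTerm x zero    = 1ℝ
expTerm x (suc k) = expTerm x k * (x * fromℚ (unitFraction k))

-- Σ (k < n) a k · x ^ k / k !
partialSum : (ℕ → ℚ) → ℝ → ℕ → ℝ
partialSum a x zero    = 0ℝ
partialSum a x (suc n) = partialSum a x n + fromℚ (a n) * expTerm x n

module SeriesBound (a : ℕ → ℚ) (∣a∣≤1 : ∀ k → ℚ.∣ a k ∣ ℚ.≤ 1ℚ) (x : ℝ)
                   (B : ℚ) (0<B : 0ℚ ℚ.< B) (∣x∣≤B : ∀ n → ℚ.∣ seq x n ∣ ℚ.≤ B) where

  u : ℕ → ℚ
  u zero    = 1ℚ
  u (suc k) = u k ℚ.* (B ℚ.* unitFraction k)

  0≤u : ∀ k → 0ℚ ℚ.≤ u k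
  0≤u zero    = ℚ.<⇒≤ (ℚ.positive⁻¹ 1ℚ)
  0≤u (suc k) = 0≤* (0≤u k) (0≤* (ℚ.<⇒≤ 0<B) (0≤unitFraction k))

  ∣term∣≤u : ∀ k n → ℚ.∣ seq (expTerm x k) n ∣ ℚ.≤ u k
  ∣term∣≤u zero    n = ℚ.≤-refl
  ∣term∣≤u (suc k) n = begin
    ℚ.∣ seq (expTerm x k) n ℚ.* (seq x n ℚ.* f) ∣            ≡⟨ ℚ.∣p*q∣≡∣p∣*∣q∣ (seq (expTerm x k) n) _ ⟩
    ℚ.∣ seq (expTerm x k) n ∣ ℚ.* ℚ.∣ seq x n ℚ.* f ∣        ≡⟨ cong (ℚ.∣ seq (expTerm x k) n ∣ ℚ.*_) (ℚ.∣p*q∣≡∣p∣*∣q∣ (seq x n) f) ⟩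
    ℚ.∣ seq (expTerm x k) n ∣ ℚ.* (ℚ.∣ seq x n ∣ ℚ.* f)      ≤⟨ *-mono-≤-nonNeg (ℚ.0≤∣p∣ _) (0≤* (ℚ.<⇒≤ 0<B) (0≤unitFraction k)) (∣term∣≤u k n)
                                                                 (ℚ.*-monoʳ-≤-nonNeg f (∣x∣≤B n)) ⟩
    u k ℚ.* (B ℚ.* f)                                        ∎
    where f = unitFraction k

  U : ℕ → ℚ
  U zero    = 0ℚ
  U (suc k) = U k ℚ.+ u k

  s : ℕ → ℕ → ℚ
  s n = seq (partialSum a x n)

  s-⊖ : ∀ m d k → (s (d ℕ.+ m) k ⊖ s m k) ℚ.≤ U (d ℕ.+ m) ℚ.- U m
  s-⊖ m zero    k = ℚ.≤-reflexive (trans (⊖-refl (s m k)) (sym (ℚ.+-inverseʳ (U m))))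
  s-⊖ m (suc d) k = begin
    (s (d ℕ.+ m) k ℚ.+ t) ⊖ s m k                         ≡⟨ cong ℚ.∣_∣ (solve 3 (λ p t q → (p :+ t) :- q := (p :- q) :+ t) refl (s (d ℕ.+ m) k) t (s m k)) ⟩
    ℚ.∣ (s (d ℕ.+ m) k ℚ.- s m k) ℚ.+ t ∣                 ≤⟨ ℚ.∣p+q∣≤∣p∣+∣q∣ (s (d ℕ.+ m) k ℚ.- s m k) t ⟩
    (s (d ℕ.+ m) k ⊖ s m k) ℚ.+ ℚ.∣ t ∣                   ≤⟨ ℚ.+-mono-≤ (s-⊖ m d k) ∣t∣≤ ⟩
    (U (d ℕ.+ m) ℚ.- U m) ℚ.+ u (d ℕ.+ m)                 ≡⟨ solve 3 (λ p q t → (p :- q) :+ t := (p :+ t) :- q) refl (U (d ℕ.+ m)) (U m) (u (d ℕ.+ m)) ⟩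
    (U (d ℕ.+ m) ℚ.+ u (d ℕ.+ m)) ℚ.- U m                 ∎
    where
    open +-*-Solver
    t = a (d ℕ.+ m) ℚ.* seq (expTerm x (d ℕ.+ m)) k
    ∣t∣≤ : ℚ.∣ t ∣ ℚ.≤ u (d ℕ.+ m)
    ∣t∣≤ = begin
      ℚ.∣ t ∣                                                        ≡⟨ ℚ.∣p*q∣≡∣p∣*∣q∣ (a (d ℕ.+ m)) _ ⟩
      ℚ.∣ a (d ℕ.+ m) ∣ ℚ.* ℚ.∣ seq (expTerm x (d ℕ.+ m)) k ∣        ≤⟨ *-mono-≤-nonNeg (ℚ.0≤∣p∣ (a (d ℕ.+ m))) (0≤u (d ℕ.+ m)) (∣a∣≤1 (d ℕ.+ m)) (∣term∣≤u (d ℕ.+ m) k) ⟩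
      1ℚ ℚ.* u (d ℕ.+ m)                                             ≡⟨ ℚ.*-identityˡ _ ⟩
      u (d ℕ.+ m)                                                    ∎

  K₀ : ℕ
  K₀ = proj₁ (archimedean (B ℚ.+ B))

  ratio≤½ : ∀ k → K₀ ℕ.≤ k → B ℚ.* unitFraction k ℚ.≤ ½
  ratio≤½ k h = begin
    B ℚ.* f                         ≡⟨ cong (ℚ._* f) (sym (trans (ℚ.*-distribˡ-+ ½ B B) (half+half B))) ⟩
    (½ ℚ.* (B ℚ.+ B)) ℚ.* f         ≤⟨ ℚ.*-monoʳ-≤-nonNeg f (ℚ.*-monoˡ-≤-nonNeg ½ (ℚ.≤-trans (proj₂ (archimedean (B ℚ.+ B))) (fromℕ-mono (ℕ.m≤n⇒m≤1+n h)))) ⟩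
    (½ ℚ.* fromℕ (suc k)) ℚ.* f     ≡⟨ ℚ.*-assoc ½ (fromℕ (suc k)) f ⟩
    ½ ℚ.* (fromℕ (suc k) ℚ.* f)     ≡⟨ cong (½ ℚ.*_) (unitFraction-inverse k) ⟩
    ½ ℚ.* 1ℚ                        ≡⟨ ℚ.*-identityʳ ½ ⟩
    ½                               ∎
    where f = unitFraction k

  u-step : ∀ k → K₀ ℕ.≤ k → u (suc k) ℚ.≤ u k ℚ.* ½
  u-step k h = ℚ.*-monoˡ-≤-nonNeg (u k) {{nonNegative (0≤u k)}} (ratio≤½ k h)

  U-tail : ∀ m d → K₀ ℕ.≤ m → U (d ℕ.+ m) ℚ.+ (u (d ℕ.+ m) ℚ.+ u (d ℕ.+ m)) ℚ.≤ U m ℚ.+ (u m ℚ.+ u m)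
  U-tail m zero    h = ℚ.≤-refl
  U-tail m (suc d) h = begin
    (U n ℚ.+ u n) ℚ.+ (u (suc n) ℚ.+ u (suc n))      ≤⟨ ℚ.+-monoʳ-≤ (U n ℚ.+ u n) (ℚ.+-mono-≤ step step) ⟩
    (U n ℚ.+ u n) ℚ.+ (u n ℚ.* ½ ℚ.+ u n ℚ.* ½)      ≡⟨ solve 2 (λ p q → (p :+ q) :+ (q :* con ½ :+ q :* con ½) := p :+ (q :+ q)) refl (U n) (u n) ⟩
    U n ℚ.+ (u n ℚ.+ u n)                            ≤⟨ U-tail m d h ⟩
    U m ℚ.+ (u m ℚ.+ u m)                            ∎
    where
    open +-*-Solver
    n = d ℕ.+ m
    step = u-step n (ℕ.≤-trans h (ℕ.m≤n+m m d))

  s-tail : ∀ m d k → K₀ ℕ.≤ m → (s (d ℕ.+ m) k ⊖ s m k) ℚ.≤ u m ℚ.+ u m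
  s-tail m d k h = begin
    s (d ℕ.+ m) k ⊖ s m k                                          ≤⟨ s-⊖ m d k ⟩
    U n ℚ.- U m                                                    ≡⟨ sym (ℚ.+-identityʳ _) ⟩
    (U n ℚ.- U m) ℚ.+ 0ℚ                                           ≤⟨ ℚ.+-monoʳ-≤ (U n ℚ.- U m) (ℚ.+-mono-≤ (0≤u n) (0≤u n)) ⟩
    (U n ℚ.- U m) ℚ.+ (u n ℚ.+ u n)                                ≡⟨ solve 3 (λ p q r → (p :- q) :+ r := (p :+ r) :- q) refl (U n) (U m) (u n ℚ.+ u n) ⟩
    (U n ℚ.+ (u n ℚ.+ u n)) ℚ.- U m                                ≤⟨ ℚ.+-monoˡ-≤ (ℚ.- U m) (U-tail m d h) ⟩
    (U m ℚ.+ (u m ℚ.+ u m)) ℚ.- U m                                ≡⟨ solve 2 (λ p q → (p :+ q) :- p := q) refl (U m) (u m ℚ.+ u m) ⟩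
    u m ℚ.+ u m                                                    ∎
    where
    open +-*-Solver
    n = d ℕ.+ m

  u-decay : ∀ j → u (j ℕ.+ K₀) ℚ.* fromℕ (suc j) ℚ.≤ u K₀
  u-decay zero    = ℚ.≤-reflexive (ℚ.*-identityʳ (u K₀))
  u-decay (suc j) = begin
    u (suc (j ℕ.+ K₀)) ℚ.* fromℕ (suc (suc j))      ≤⟨ ℚ.*-monoʳ-≤-nonNeg (fromℕ (suc (suc j))) (u-step (j ℕ.+ K₀) (ℕ.m≤n+m K₀ j)) ⟩
    (u (j ℕ.+ K₀) ℚ.* ½) ℚ.* fromℕ (suc (suc j))    ≡⟨ ℚ.*-assoc (u (j ℕ.+ K₀)) ½ (fromℕ (suc (suc j))) ⟩
    u (j ℕ.+ K₀) ℚ.* (½ ℚ.* fromℕ (suc (suc j)))    ≤⟨ ℚ.*-monoˡ-≤-nonNeg (u (j ℕ.+ K₀)) {{nonNegative (0≤u (j ℕ.+ K₀))}} half≤ ⟩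
    u (j ℕ.+ K₀) ℚ.* fromℕ (suc j)                  ≤⟨ u-decay j ⟩
    u K₀                                            ∎
    where
    half≤ : ½ ℚ.* fromℕ (suc (suc j)) ℚ.≤ fromℕ (suc j)
    half≤ = begin
      ½ ℚ.* fromℕ (suc (suc j))                   ≤⟨ ℚ.*-monoˡ-≤-nonNeg ½ (fromℕ-mono (s≤s (ℕ.m≤n+m (suc j) j))) ⟩
      ½ ℚ.* fromℕ (suc j ℕ.+ suc j)               ≡⟨ cong (½ ℚ.*_) (sym (fromℕ-+ (suc j) (suc j))) ⟩
      ½ ℚ.* (fromℕ (suc j) ℚ.+ fromℕ (suc j))     ≡⟨ trans (ℚ.*-distribˡ-+ ½ (fromℕ (suc j)) (fromℕ (suc j))) (half+half (fromℕ (suc j))) ⟩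
      fromℕ (suc j)                               ∎

  u-small : ∀ {ε} → 0ℚ ℚ.< ε → ∃ λ m → K₀ ℕ.≤ m × u m ℚ.≤ ε
  u-small {ε} 0<ε =
    let δ , _ , εδ≡1 = shrink 0<ε (ℚ.positive⁻¹ 1ℚ)
        j , uδ≤ = archimedean (u K₀ ℚ.* δ)
    in j ℕ.+ K₀ , ℕ.m≤n+m K₀ j , ℚ.*-cancelʳ-≤-pos (fromℕ (suc j)) (begin
      u (j ℕ.+ K₀) ℚ.* fromℕ (suc j)   ≤⟨ u-decay j ⟩
      u K₀                             ≡⟨ sym (ℚ.*-identityʳ (u K₀)) ⟩
      u K₀ ℚ.* 1ℚ                      ≡⟨ cong (u K₀ ℚ.*_) (sym εδ≡1) ⟩
      u K₀ ℚ.* (ε ℚ.* δ)               ≡⟨ solve 3 (λ a b c → a :* (b :* c) := b :* (a :* c)) refl (u K₀) ε δ ⟩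
      ε ℚ.* (u K₀ ℚ.* δ)               ≤⟨ ℚ.*-monoˡ-≤-nonNeg ε {{nonNegative (ℚ.<⇒≤ 0<ε)}} (ℚ.≤-trans uδ≤ (fromℕ-mono (ℕ.n≤1+n j))) ⟩
      ε ℚ.* fromℕ (suc j)              ∎)
    where open +-*-Solver

  cauchy-bounded : IsCauchyℝ (partialSum a x)
  cauchy-bounded ε 0<ε =
    let M , K₀≤M , u≤ = u-small (0<half (0<half 0<ε))
        near : ∀ n k → M ℕ.≤ n → (s n k ⊖ s M k) ℚ.≤ ½ ℚ.* ε
        near n k M≤n = begin
          s n k ⊖ s M k                                ≡⟨ cong (λ i → s i k ⊖ s M k) (sym (ℕ.m∸n+n≡m M≤n)) ⟩
          s (n ℕ.∸ M ℕ.+ M) k ⊖ s M k                  ≤⟨ s-tail M (n ℕ.∸ M) k K₀≤M ⟩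
          u M ℚ.+ u M                                  ≤⟨ ℚ.+-mono-≤ u≤ u≤ ⟩
          ½ ℚ.* (½ ℚ.* ε) ℚ.+ ½ ℚ.* (½ ℚ.* ε)          ≡⟨ half+half (½ ℚ.* ε) ⟩
          ½ ℚ.* ε                                      ∎
    in M , λ m n h h′ → 0 , λ k _ → begin
      s m k ⊖ s n k            ≤⟨ ⊖-triangle (s m k) (s M k) (s n k) (near m k h)
                                    (subst (ℚ._≤ ½ ℚ.* ε) (⊖-comm (s n k) (s M k)) (near n k h′)) ⟩
      ½ ℚ.* ε ℚ.+ ½ ℚ.* ε      ≡⟨ half+half ε ⟩
      ε                        ∎

abstract
  partialSum-cauchy : ∀ a → (∀ k → ℚ.∣ a k ∣ ℚ.≤ 1ℚ) → ∀ x → IsCauchyℝ (partialSum a x)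
  partialSum-cauchy a ∣a∣≤1 x =
    let B , 0<B , ∣x∣≤B = bounded x
    in SeriesBound.cauchy-bounded a ∣a∣≤1 x B 0<B ∣x∣≤B

-- Σ (k ≥ 0) a k · x ^ k / k !
series : (a : ℕ → ℚ) → (∀ k → ℚ.∣ a k ∣ ℚ.≤ 1ℚ) → ℝ → ℝ
series a ∣a∣≤1 x = lim (partialSum a x) (partialSum-cauchy a ∣a∣≤1 x)

cosCoefficient sinCoefficient : ℕ → ℚ
cosCoefficient 0             = 1ℚ
cosCoefficient 1             = 0ℚ
cosCoefficient (suc (suc k)) = ℚ.- cosCoefficient k
sinCoefficient 0             = 0ℚ
sinCoefficient 1             = 1ℚ
sinCoefficient (suc (suc k)) = ℚ.- sinCoefficient k

∣cosCoefficient∣≤1 : ∀ k → ℚ.∣ cosCoefficient k ∣ ℚ.≤ 1ℚ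
∣cosCoefficient∣≤1 0             = ℚ.≤-refl
∣cosCoefficient∣≤1 1             = ℚ.<⇒≤ (ℚ.positive⁻¹ 1ℚ)
∣cosCoefficient∣≤1 (suc (suc k)) = subst (ℚ._≤ 1ℚ) (sym (ℚ.∣-p∣≡∣p∣ (cosCoefficient k))) (∣cosCoefficient∣≤1 k)

∣sinCoefficient∣≤1 : ∀ k → ℚ.∣ sinCoefficient k ∣ ℚ.≤ 1ℚ
∣sinCoefficient∣≤1 0             = ℚ.<⇒≤ (ℚ.positive⁻¹ 1ℚ)
∣sinCoefficient∣≤1 1             = ℚ.≤-refl
∣sinCoefficient∣≤1 (suc (suc k)) = subst (ℚ._≤ 1ℚ) (sym (ℚ.∣-p∣≡∣p∣ (sinCoefficient k))) (∣sinCoefficient∣≤1 k)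

cos sin : ℝ → ℝ
cos = series cosCoefficient ∣cosCoefficient∣≤1
sin = series sinCoefficient ∣sinCoefficient∣≤1

-- The least positive zero of the sine, which determines π up to _≈_.
record IsPi (π : ℝ) : Set where
  field
    0<π      : 0ℝ < π
    sin[π]≈0 : sin π ≈ 0ℝ
    least    : ∀ x → 0ℝ < x → sin x ≈ 0ℝ → π ≤ x

record ℂ : Set where
  constructor _+i_
  field
    re im : ℝ

open ℂ public

infix 4 _≈ᶜ_
infixl 6 _+ᶜ_
infixl 7 _*ᶜ_
infixr 8 _^ᶜ_
infix 5 _+i_

_≈ᶜ_ : ℂ → ℂ → Set
z ≈ᶜ w = re z ≈ re w × im z ≈ im w

fromℝ : ℝ → ℂ
fromℝ x = x +i 0ℝ

0ᶜ 1ᶜ : ℂ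
0ᶜ = fromℝ 0ℝ
1ᶜ = fromℝ 1ℝ

_+ᶜ_ _*ᶜ_ : ℂ → ℂ → ℂ
z +ᶜ w = (re z + re w) +i (im z + im w)
z *ᶜ w = (re z * re w + - (im z * im w)) +i (re z * im w + im z * re w)

conj : ℂ → ℂ
conj z = re z +i - im z

_^ᶜ_ : ℂ → ℕ → ℂ
z ^ᶜ zero  = 1ᶜ
z ^ᶜ suc k = z *ᶜ z ^ᶜ k

-- e^{iα}, by Euler's formula.
expi : ℝ → ℂ
expi α = cos α +i sin α

∑ : ∀ {n} → (Fin n → ℂ) → ℂ
∑ = foldr _+ᶜ_ 0ᶜ

ℂ^_ : ℕ → Set
ℂ^ n = Vector ℂ n

infix 4 _≈ᵛ_ _∼_
infixl 7 _⊙_ _·_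

_≈ᵛ_ : ∀ {n} → ℂ^ n → ℂ^ n → Set
u ≈ᵛ v = ∀ r → u r ≈ᶜ v r

_·_ : ∀ {n} → ℂ → ℂ^ n → ℂ^ n
(c · v) r = c *ᶜ v r

_⊙_ : ∀ {n} → ℂ^ n → ℂ^ n → ℂ^ n
(u ⊙ v) r = u r *ᶜ v r

⟨_,_⟩ : ∀ {n} → ℂ^ n → ℂ^ n → ℂ
⟨ u , v ⟩ = ∑ λ r → conj (u r) *ᶜ v r

combination : ∀ {m n} → (Fin m → ℂ) → (Fin m → ℂ^ n) → ℂ^ n
combination c f r = ∑ λ i → c i *ᶜ f i r

IsUnit : ∀ {n} → ℂ^ n → Set
IsUnit u = ⟨ u , u ⟩ ≈ᶜ 1ᶜ

record IsOrthonormalBasis {n} (f : Fin n → ℂ^ n) : Set where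
  field
    unit        : ∀ i → IsUnit (f i)
    orthogonal  : ∀ i j → i ≢ j → ⟨ f i , f j ⟩ ≈ᶜ 0ᶜ
    independent : ∀ c → combination c f ≈ᵛ (λ _ → 0ᶜ) → ∀ i → c i ≈ᶜ 0ᶜ
    spanning    : ∀ v → ∃ λ c → combination c f ≈ᵛ v

_∼_ : ∀ {n} → ℂ^ n → ℂ^ n → Set
u ∼ v = ∃ λ α → u ≈ᵛ expi α · v

SquareArray : ℕ → Set
SquareArray n = Fin n → Fin n → ℂ^ n

record IsQLS {n} (Φ : SquareArray n) : Set where
  field
    unit    : ∀ i j → IsUnit (Φ i j)
    rows    : ∀ i → IsOrthonormalBasis (λ j → Φ i j)
    columns : ∀ j → IsOrthonormalBasis (λ i → Φ i j)

-- The quotient of the n² positions by phase equivalence of their entries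
-- is in bijection with Fin c.
HasCardinality : ∀ {n} → SquareArray n → ℕ → Set
HasCardinality {n} Φ c =
  Σ (Fin n × Fin n → Fin c) λ class →
    Congruent _∼ᵖ_ _≡_ class × Bijective _∼ᵖ_ _≡_ class
  where
  _∼ᵖ_ : Fin n × Fin n → Fin n × Fin n → Set
  (i , j) ∼ᵖ (k , l) = Φ i j ∼ Φ k l

A : Vec (Vec (Fin 3) 6) 6
A = (0F ∷ 0F ∷ 0F ∷ 0F ∷ 0F ∷ 0F ∷ [])
  ∷ (0F ∷ 0F ∷ 1F ∷ 1F ∷ 2F ∷ 2F ∷ [])
  ∷ (0F ∷ 1F ∷ 0F ∷ 2F ∷ 2F ∷ 1F ∷ [])
  ∷ (0F ∷ 1F ∷ 2F ∷ 0F ∷ 1F ∷ 2F ∷ [])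
  ∷ (0F ∷ 2F ∷ 2F ∷ 1F ∷ 0F ∷ 1F ∷ [])
  ∷ (0F ∷ 2F ∷ 1F ∷ 2F ∷ 1F ∷ 0F ∷ [])
  ∷ []

1/√6 : ℝ
1/√6 = recip (√ 6) (√-pos 5)

module Construction (π : ℝ) where

  -- e^{2πi/3}
  ω : ℂ
  ω = expi (fromℚ (+ 2 ℚ./ 3) * π)

  H : Fin 6 → Fin 6 → ℂ
  H r s = ω ^ᶜ toℕ (Vec.lookup (Vec.lookup A r) s)

  h : Fin 6 → ℂ^ 6
  h s r = H r s

  Φ₂₁ : SquareArray 6
  Φ₂₁ i j = fromℝ 1/√6 · (h i ⊙ h j)

{-# OPTIONS --safe #-}

-- Let θ = 2π/3 and ω = c + is with c = cos θ and s = sin θ. The Cauchy product of the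
-- exponential series gives the addition formulas, hence ω³ = e^{2πi} = 1, that is
-- c (4c² − 3) = 1 and s (4c² − 1) = 0. By minimality of π, s is not 0, so 4c² = 1 and
-- c = −1/2; therefore 1 + ω + ω² = 0 and ω̄ = ω². For j ≠ k the differences of columns j
-- and k of the symmetric matrix A take every residue twice, so H is a complex Hadamard
-- matrix and every line of the array is an orthonormal basis. Row 0 of H consists of
-- ones, so phase equivalent entries of the array coincide, and the exponents of
-- h i ⊙ h j determine the unordered pair {i, j}: there are 21 such pairs.
module Submission where

open import Algebra.Bundles using (CommutativeRing)
import Algebra.Properties.CommutativeMonoid.Mult as Mult
import Algebra.Properties.CommutativeSemigroup as CommutativeSemigroup
import Algebra.Properties.Semiring.Sum as Sum
import Algebra.Solver.Ring as Solver
import Algebra.Solver.Ring.NaturalCoefficients.Default as NaturalSolver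
open import Algebra.Solver.Ring.AlmostCommutativeRing using (_-Raw-AlmostCommutative⟶_; fromCommutativeRing)
open import Data.Bool.Base using (if_then_else_)
open import Data.Fin.Base using (Fin; zero; suc; toℕ)
open import Data.Fin.Patterns using (0F; 1F; 2F)
open import Data.Fin.Properties using (_≟_; all?; any?)
open import Data.Integer.Base using (+_)
import Data.Integer.Base as ℤ
open import Data.Maybe.Base as Maybe using (Maybe)
open import Data.Nat.Base using (ℕ; zero; suc; z≤n; s≤s)
import Data.Nat.Base as ℕ
open import Data.Nat.DivMod using (_mod_)
import Data.Nat.Properties as ℕ
open import Data.Product.Base using (∃; _×_; _,_; proj₁; proj₂)
open import Data.Rational.Base using (ℚ; 0ℚ; 1ℚ; ½; nonNegative; positive)
import Data.Rational.Base as ℚ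
import Data.Rational.Properties as ℚ
open import Data.Rational.Solver using (module +-*-Solver)
open import Data.Sum.Base using (_⊎_; inj₁; inj₂)
import Data.Vec.Base as Vec
open import Function.Base using (_∘_)
open import Level using (0ℓ)
open import Relation.Binary.PropositionalEquality
import Relation.Binary.Reasoning.Setoid as SetoidReasoning
open import Relation.Nullary using (¬_; contradiction; yes; no; does; Dec)
open import Relation.Nullary.Decidable using (dec⇒maybe; from-yes; _×-dec_; _⊎-dec_; _→-dec_; ¬?)
open import Defs

-- Equality of reals is undecidable, so minimality of π, together with 0 < 2π/3 < π, only refutes s
-- = 0; it gives no positive lower bound for |s| and hence no inverse. The factor s in s (4c² - 1) =
-- 0 is therefore removed through the stability of equality, not by division. The sign of s is never
-- determined: ω is known to be one of the two primitive cube roots of unity, and the array argument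
-- is symmetric in them.
--
-- The addition formulas are proved inside ℚ. A partial sum acts on each rational entry separately,
-- so the Cauchy product is estimated for rational arguments, with an error bound that is the same
-- for all entries.
--
-- Spanning is part of the definition of a basis and is not deduced from independence by counting
-- dimensions. It comes from a second Gram identity, for the rows of H, which the symmetry of A
-- reduces to the first. All statements about A are finite checks, kept apart from the analysis.

module _ where

  open ℚ.≤-Reasoning

  -- Eventual bounds and the commutative ring of reals

  Eventually : (ℕ → Set) → Set
  Eventually P = ∃ λ N → ∀ n → N ℕ.≤ n → P n

  always : ∀ {P} → (∀ n → P n) → Eventually P
  always p = 0 , λ n _ → p n

  eventually-map : ∀ {P Q} → (∀ n → P n → Q n) → Eventually P → Eventually Q
  eventually-map f (N , p) = N , λ n h → f n (p n h)

  eventually-zip : ∀ {P Q R} → (∀ n → P n → Q n → R n) → Eventually P → Eventually Q → Eventually R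
  eventually-zip f (M , p) (N , q) =
    M ℕ.⊔ N , λ n h → f n (p n (ℕ.m⊔n≤o⇒m≤o M N h)) (q n (ℕ.m⊔n≤o⇒n≤o M N h))

  infix 4 _≗ʳ_

  _≗ʳ_ : ℝ → ℝ → Set
  x ≗ʳ y = ∀ n → seq x n ≡ seq y n

  within-sym : ∀ {ε} x y → Within ε x y → Within ε y x
  within-sym {ε} x y = eventually-map λ n → subst (ℚ._≤ ε) (⊖-comm (seq x n) (seq y n))

  within-trans : ∀ {δ ε} x y z → Within δ x y → Within ε y z → Within (δ ℚ.+ ε) x z
  within-trans x y z = eventually-zip λ n → ⊖-triangle (seq x n) (seq y n) (seq z n)

  within-half : ∀ {ε} x y z → Within (½ ℚ.* ε) x y → Within (½ ℚ.* ε) y z → Within ε x z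
  within-half {ε} x y z p q = subst (λ θ → Within θ x z) (half+half ε) (within-trans x y z p q)

  ≗⇒≈ : ∀ {x y} → x ≗ʳ y → x ≈ y
  ≗⇒≈ {x} {y} p ε 0<ε = always λ n →
    ℚ.≤-trans (ℚ.≤-reflexive (trans (cong (_⊖ seq y n) (p n)) (⊖-refl (seq y n)))) (ℚ.<⇒≤ 0<ε)

  ≈-refl : ∀ {x} → x ≈ x
  ≈-refl {x} = ≗⇒≈ {x} {x} λ _ → refl

  ≈-sym : ∀ {x y} → x ≈ y → y ≈ x
  ≈-sym {x} {y} p ε 0<ε = within-sym x y (p ε 0<ε)

  ≈-trans : ∀ {x y z} → x ≈ y → y ≈ z → x ≈ z
  ≈-trans {x} {y} {z} p q ε 0<ε = within-half x y z (p _ (0<half 0<ε)) (q _ (0<half 0<ε))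

  -- Pointwise continuity of a binary operation; both the congruence of the operation
  -- and its compatibility with limits follow from it.
  Continuous₂ : (ℝ → ℝ → ℝ) → Set
  Continuous₂ _∙_ = ∀ x y ε → 0ℚ ℚ.< ε → ∃ λ δ → 0ℚ ℚ.< δ ×
    (∀ x′ y′ → Within δ x x′ → Within δ y y′ → Within ε (x ∙ y) (x′ ∙ y′))

  +-continuous : Continuous₂ _+_
  +-continuous x y ε 0<ε = ½ ℚ.* ε , 0<half 0<ε , λ x′ y′ → eventually-zip λ n p q → begin
    (seq x n ℚ.+ seq y n) ⊖ (seq x′ n ℚ.+ seq y′ n)  ≤⟨ ⊖-+ (seq x n) (seq y n) (seq x′ n) (seq y′ n) ⟩
    (seq x n ⊖ seq x′ n) ℚ.+ (seq y n ⊖ seq y′ n)    ≤⟨ ℚ.+-mono-≤ p q ⟩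
    ½ ℚ.* ε ℚ.+ ½ ℚ.* ε                              ≡⟨ half+half ε ⟩
    ε                                                ∎

  0<min : ∀ {p q} → 0ℚ ℚ.< p → 0ℚ ℚ.< q → 0ℚ ℚ.< p ℚ.⊓ q
  0<min {p} {q} 0<p 0<q with ℚ.⊓-sel p q
  ... | inj₁ e = subst (0ℚ ℚ.<_) (sym e) 0<p
  ... | inj₂ e = subst (0ℚ ℚ.<_) (sym e) 0<q

  0<1 : 0ℚ ℚ.< 1ℚ
  0<1 = ℚ.positive⁻¹ 1ℚ

  *-continuous : Continuous₂ _*_
  *-continuous x y ε 0<ε =
    let B , 0<B , x≤B = bounded x
        C , 0<C , y≤C = bounded y
        D             = B ℚ.+ (C ℚ.+ 1ℚ)
        0<C+1         = ℚ.+-mono-< 0<C 0<1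
        δ , 0<δ , Dδ  = shrink {D} (ℚ.+-mono-< 0<B 0<C+1) 0<ε
    -- The cap at 1 keeps every admissible `y′` bounded by `C + 1`, which is why `D` contains
    -- `C + 1` instead of `C`.
    in δ ℚ.⊓ 1ℚ , 0<min 0<δ 0<1 , λ x′ y′ → eventually-zip λ n p q → begin
      (seq x n ℚ.* seq y n) ⊖ (seq x′ n ℚ.* seq y′ n)
        ≤⟨ ⊖-* (seq x n) (seq y n) (seq x′ n) (seq y′ n) (ℚ.<⇒≤ 0<B) (ℚ.<⇒≤ 0<C+1) (x≤B n)
             (near-bound (seq y n) (seq y′ n) (y≤C n) (ℚ.≤-trans q (ℚ.p⊓q≤q δ 1ℚ))) ⟩
      B ℚ.* (seq y n ⊖ seq y′ n) ℚ.+ (C ℚ.+ 1ℚ) ℚ.* (seq x n ⊖ seq x′ n)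
        ≤⟨ ℚ.+-mono-≤ (ℚ.*-monoˡ-≤-nonNeg B {{nonNegative (ℚ.<⇒≤ 0<B)}} (ℚ.≤-trans q (ℚ.p⊓q≤p δ 1ℚ)))
                      (ℚ.*-monoˡ-≤-nonNeg (C ℚ.+ 1ℚ) {{nonNegative (ℚ.<⇒≤ 0<C+1)}} (ℚ.≤-trans p (ℚ.p⊓q≤p δ 1ℚ))) ⟩
      B ℚ.* δ ℚ.+ (C ℚ.+ 1ℚ) ℚ.* δ   ≡⟨ sym (ℚ.*-distribʳ-+ δ B (C ℚ.+ 1ℚ)) ⟩
      D ℚ.* δ                        ≡⟨ Dδ ⟩
      ε                              ∎
    where
    near-bound : ∀ p q {C} → ℚ.∣ p ∣ ℚ.≤ C → (p ⊖ q) ℚ.≤ 1ℚ → ℚ.∣ q ∣ ℚ.≤ C ℚ.+ 1ℚ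
    near-bound p q {C} p≤C p⊖q≤1 = begin
      ℚ.∣ q ∣                       ≡⟨ cong ℚ.∣_∣ (solve 2 (λ p q → q := p :+ (q :- p)) refl p q) ⟩
      ℚ.∣ p ℚ.+ (q ℚ.- p) ∣         ≤⟨ ℚ.∣p+q∣≤∣p∣+∣q∣ p (q ℚ.- p) ⟩
      ℚ.∣ p ∣ ℚ.+ (q ⊖ p)           ≤⟨ ℚ.+-mono-≤ p≤C (subst (ℚ._≤ 1ℚ) (⊖-comm p q) p⊖q≤1) ⟩
      C ℚ.+ 1ℚ                      ∎
      where open +-*-Solver

  continuous⇒cong : ∀ {_∙_} → Continuous₂ _∙_ → ∀ {x x′ y y′} → x ≈ x′ → y ≈ y′ → (x ∙ y) ≈ (x′ ∙ y′)
  continuous⇒cong cont {x} {x′} {y} {y′} p q ε 0<ε =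
    let δ , 0<δ , near = cont x y ε 0<ε in near x′ y′ (p δ 0<δ) (q δ 0<δ)

  +-cong : ∀ {x x′ y y′} → x ≈ x′ → y ≈ y′ → x + y ≈ x′ + y′
  +-cong {x} {x′} {y} {y′} = continuous⇒cong {_+_} +-continuous {x} {x′} {y} {y′}

  *-cong : ∀ {x x′ y y′} → x ≈ x′ → y ≈ y′ → x * y ≈ x′ * y′
  *-cong {x} {x′} {y} {y′} = continuous⇒cong {_*_} *-continuous {x} {x′} {y} {y′}

  neg-cong : ∀ {x y} → x ≈ y → - x ≈ - y
  neg-cong {x} {y} p ε 0<ε = eventually-map (λ n → subst (ℚ._≤ ε) (sym (⊖-neg (seq x n) (seq y n)))) (p ε 0<ε)

  -- x ≈ y unfolds to a statement about sequences from which Agda cannot recover x and y;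
  -- the record makes them inferable.
  infix 4 _≃_

  record _≃_ (x y : ℝ) : Set where
    constructor wrap
    field
      unwrap : x ≈ y

  open _≃_ public

  ≗⇒≃ : ∀ {x y} → x ≗ʳ y → x ≃ y
  ≗⇒≃ {x} {y} p = wrap (≗⇒≈ {x} {y} p)

  ℝ-commutativeRing : CommutativeRing 0ℓ 0ℓ
  ℝ-commutativeRing = record
    { Carrier = ℝ ; _≈_ = _≃_ ; _+_ = _+_ ; _*_ = _*_ ; -_ = -_ ; 0# = 0ℝ ; 1# = 1ℝ
    ; isCommutativeRing = record
      { isRing = record
        { +-isAbelianGroup = record
          { isGroup = record
            { isMonoid = record
              { isSemigroup = record
                { isMagma = record
                  { isEquivalence = record
                    { refl  = λ {x} → wrap (≈-refl {x})
                    ; sym   = λ {x} {y} p → wrap (≈-sym {x} {y} (unwrap p))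
                    ; trans = λ {x} {y} {z} p q → wrap (≈-trans {x} {y} {z} (unwrap p) (unwrap q))
                    }
                  ; ∙-cong = λ {x} {x′} {y} {y′} p q → wrap (+-cong {x} {x′} {y} {y′} (unwrap p) (unwrap q))
                  }
                ; assoc = λ x y z → ≗⇒≃ λ n → ℚ.+-assoc (seq x n) (seq y n) (seq z n)
                }
              ; identity = (λ x → ≗⇒≃ λ n → ℚ.+-identityˡ (seq x n)) , (λ x → ≗⇒≃ λ n → ℚ.+-identityʳ (seq x n))
              }
            ; inverse = (λ x → ≗⇒≃ λ n → ℚ.+-inverseˡ (seq x n)) , (λ x → ≗⇒≃ λ n → ℚ.+-inverseʳ (seq x n))
            ; ⁻¹-cong = λ {x} {y} p → wrap (neg-cong {x} {y} (unwrap p))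
            }
          ; comm = λ x y → ≗⇒≃ λ n → ℚ.+-comm (seq x n) (seq y n)
          }
        ; *-cong = λ {x} {x′} {y} {y′} p q → wrap (*-cong {x} {x′} {y} {y′} (unwrap p) (unwrap q))
        ; *-assoc = λ x y z → ≗⇒≃ λ n → ℚ.*-assoc (seq x n) (seq y n) (seq z n)
        ; *-identity = (λ x → ≗⇒≃ λ n → ℚ.*-identityˡ (seq x n)) , (λ x → ≗⇒≃ λ n → ℚ.*-identityʳ (seq x n))
        ; distrib = (λ x y z → ≗⇒≃ λ n → ℚ.*-distribˡ-+ (seq x n) (seq y n) (seq z n))
                  , (λ x y z → ≗⇒≃ λ n → ℚ.*-distribʳ-+ (seq x n) (seq y n) (seq z n))
        }
      ; *-comm = λ x y → ≗⇒≃ λ n → ℚ.*-comm (seq x n) (seq y n)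
      }
    }

  module ℝ-ring = CommutativeRing ℝ-commutativeRing

  -- Makes ℚ the coefficient ring of the solver for ℝ, so that it normalises constants such as -½ in
  -- the trigonometric identities.
  fromℚ-morphism : CommutativeRing.rawRing ℚ.+-*-commutativeRing -Raw-AlmostCommutative⟶ fromCommutativeRing ℝ-commutativeRing
  fromℚ-morphism = record
    { ⟦_⟧    = fromℚ
    ; +-homo = λ _ _ → ≗⇒≃ λ _ → refl
    ; *-homo = λ _ _ → ≗⇒≃ λ _ → refl
    ; -‿homo = λ _ → ≗⇒≃ λ _ → refl
    ; 0-homo = ℝ-ring.refl
    ; 1-homo = ℝ-ring.refl
    }

  fromℚ-≟ : ∀ p q → Maybe (fromℚ p ≃ fromℚ q)
  fromℚ-≟ p q = Maybe.map (λ { refl → ℝ-ring.refl }) (dec⇒maybe (p ℚ.≟ q))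

  module ℝ-Solver = Solver (CommutativeRing.rawRing ℚ.+-*-commutativeRing) (fromCommutativeRing ℝ-commutativeRing)
    fromℚ-morphism fromℚ-≟

  +-cancelˡ-≤ : ∀ r {p q} → r ℚ.+ p ℚ.≤ r ℚ.+ q → p ℚ.≤ q
  +-cancelˡ-≤ r {p} {q} h = subst₂ ℚ._≤_ (cancel p) (cancel q) (ℚ.+-monoʳ-≤ (ℚ.- r) h)
    where
    open +-*-Solver
    cancel : ∀ p → ℚ.- r ℚ.+ (r ℚ.+ p) ≡ p
    cancel = solve 2 (λ r p → :- r :+ (r :+ p) := p) refl r

  -- ≈ is stable: a Cauchy real y either lies within ε of 0 or is bounded away from 0,
  -- and in the second case x ≈ 0 can be read off x * y ≈ 0.
  *≈0⇒≈0 : ∀ x y → x * y ≈ 0ℝ → ¬ x ≈ 0ℝ → y ≈ 0ℝ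
  *≈0⇒≈0 x y xy≈0 x≉0 ε 0<ε with cauchy y (½ ℚ.* η) (0<half 0<η)
    where
    η   = ½ ℚ.* ε
    0<η = 0<half 0<ε
  ... | N , c with ℚ.∣ seq y N ∣ ℚ.≤? ½ ℚ.* ε
  ... | yes small-y = N , λ n N≤n → begin
      seq y n ⊖ 0ℚ                       ≤⟨ ⊖-triangle (seq y n) (seq y N) 0ℚ (c n N N≤n ℕ.≤-refl) ℚ.≤-refl ⟩
      ½ ℚ.* η ℚ.+ (seq y N ⊖ 0ℚ)         ≤⟨ ℚ.+-mono-≤ half≤ (ℚ.≤-trans (ℚ.≤-reflexive (cong ℚ.∣_∣ (ℚ.+-identityʳ (seq y N)))) small-y) ⟩
      η ℚ.+ ½ ℚ.* ε                      ≡⟨ half+half ε ⟩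
      ε                                  ∎
    where
    η   = ½ ℚ.* ε
    0<η = 0<half 0<ε
    half≤ : ½ ℚ.* η ℚ.≤ η
    half≤ = begin
      ½ ℚ.* η               ≡⟨ sym (ℚ.+-identityʳ _) ⟩
      ½ ℚ.* η ℚ.+ 0ℚ        ≤⟨ ℚ.+-monoʳ-≤ (½ ℚ.* η) (ℚ.<⇒≤ (0<half 0<η)) ⟩
      ½ ℚ.* η ℚ.+ ½ ℚ.* η   ≡⟨ half+half η ⟩
      η                     ∎
  ... | no large-y = contradiction x≈0 x≉0
    where
    η   = ½ ℚ.* ε
    θ   = ½ ℚ.* η
    0<θ = 0<half (0<half 0<ε)
    θ≤∣y∣ : ∀ n → N ℕ.≤ n → θ ℚ.≤ ℚ.∣ seq y n ∣
    θ≤∣y∣ n N≤n = +-cancelˡ-≤ θ (begin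
      θ ℚ.+ θ                                  ≡⟨ half+half η ⟩
      η                                        ≤⟨ ℚ.<⇒≤ (ℚ.≰⇒> large-y) ⟩
      ℚ.∣ seq y N ∣                            ≡⟨ cong ℚ.∣_∣ (solve 2 (λ a b → a := (a :- b) :+ b) refl (seq y N) (seq y n)) ⟩
      ℚ.∣ (seq y N ℚ.- seq y n) ℚ.+ seq y n ∣  ≤⟨ ℚ.∣p+q∣≤∣p∣+∣q∣ (seq y N ℚ.- seq y n) (seq y n) ⟩
      (seq y N ⊖ seq y n) ℚ.+ ℚ.∣ seq y n ∣    ≤⟨ ℚ.+-monoˡ-≤ ℚ.∣ seq y n ∣ (c N n ℕ.≤-refl N≤n) ⟩
      θ ℚ.+ ℚ.∣ seq y n ∣                      ∎)
      where open +-*-Solver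
    x≈0 : x ≈ 0ℝ
    x≈0 δ 0<δ = eventually-zip
      (λ n xy≤ θ≤ → ℚ.*-cancelʳ-≤-pos θ {{positive 0<θ}} (begin
        (seq x n ⊖ 0ℚ) ℚ.* θ               ≡⟨ cong (λ p → ℚ.∣ p ∣ ℚ.* θ) (ℚ.+-identityʳ (seq x n)) ⟩
        ℚ.∣ seq x n ∣ ℚ.* θ                ≤⟨ ℚ.*-monoˡ-≤-nonNeg ℚ.∣ seq x n ∣ {{ℚ.∣-∣-nonNeg (seq x n)}} θ≤ ⟩
        ℚ.∣ seq x n ∣ ℚ.* ℚ.∣ seq y n ∣    ≡⟨ sym (ℚ.∣p*q∣≡∣p∣*∣q∣ (seq x n) (seq y n)) ⟩
        ℚ.∣ seq x n ℚ.* seq y n ∣          ≡⟨ cong ℚ.∣_∣ (sym (ℚ.+-identityʳ (seq x n ℚ.* seq y n))) ⟩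
        (seq x n ℚ.* seq y n) ⊖ 0ℚ         ≤⟨ xy≤ ⟩
        δ ℚ.* θ                            ∎))
      (xy≈0 (δ ℚ.* θ) (0<* 0<δ 0<θ)) (N , θ≤∣y∣)

  -- Limits of sequences of reals

  infix 4 _⟶_

  record _⟶_ (s : ℕ → ℝ) (x : ℝ) : Set where
    constructor converges
    field
      near : ∀ ε → 0ℚ ℚ.< ε → Eventually λ n → Within ε x (s n)

  open _⟶_

  ⟶-const : ∀ x → (λ _ → x) ⟶ x
  ⟶-const x = converges λ ε 0<ε → always λ _ → ≈-refl {x} ε 0<ε

  ⟶-continuous : ∀ {_∙_} → Continuous₂ _∙_ → ∀ {s t x y} → s ⟶ x → t ⟶ y → (λ n → s n ∙ t n) ⟶ (x ∙ y)
  ⟶-continuous cont {s} {t} {x} {y} p q = converges λ ε 0<ε →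
    let δ , 0<δ , ∙-near = cont x y ε 0<ε
    in eventually-zip (λ n → ∙-near (s n) (t n)) (near p δ 0<δ) (near q δ 0<δ)

  ⟶-+ : ∀ {s t x y} → s ⟶ x → t ⟶ y → (λ n → s n + t n) ⟶ (x + y)
  ⟶-+ = ⟶-continuous {_+_} +-continuous

  ⟶-* : ∀ {s t x y} → s ⟶ x → t ⟶ y → (λ n → s n * t n) ⟶ (x * y)
  ⟶-* = ⟶-continuous {_*_} *-continuous

  -- Reduces each identity between series values to comparing partial sums of equal length. The two
  -- sequences need only approach each other, since a product of partial sums is not a partial sum.
  ⟶-unique : ∀ {s t x y} → s ⟶ x → t ⟶ y →
             (∀ ε → 0ℚ ℚ.< ε → Eventually λ n → Within ε (s n) (t n)) → x ≈ y
  ⟶-unique {s} {t} {x} {y} s⟶x t⟶y s~t ε 0<ε =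
    let N , p = eventually-zip (λ _ → _,_)
          (eventually-zip (λ n → within-half {½ ℚ.* ε} x (s n) (t n))
            (near s⟶x _ (0<half (0<half 0<ε))) (s~t _ (0<half (0<half 0<ε))))
          (near t⟶y _ (0<half 0<ε))
        xt , yt = p N ℕ.≤-refl
    in within-half x (t N) y xt (within-sym y (t N) yt)

  lim-⟶ : ∀ s c → s ⟶ lim s c
  lim-⟶ s c = converges λ ε 0<ε →
    let l         = lim s c
        0<η       = 0<half 0<ε
        C , l-c   = cauchy l _ 0<η
        M , u≤    = small (0<half 0<η)
        -- A single entry k of the limit serves as a bridge. Beyond `C` the entries of the limit
        -- agree within ε/2; beyond `M` the tolerance 1/(k+1), with which entry k was picked from
        -- `s N`, is at most ε/4 and is spent twice.
        k         = C ℕ.⊔ M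
        u≤θ       = ℚ.≤-trans (unitFraction-antitone (ℕ.m≤n⊔m C M)) u≤
        N , s-c   = c (unitFraction k) (0<unitFraction k)
        K , sN-c  = cauchy (s N) (unitFraction k) (0<unitFraction k)
    in N , λ n N≤n → eventually-zip
      (λ m C≤,K≤ s~ → subst ((seq l m ⊖ seq (s n) m) ℚ.≤_)
        (trans (cong (½ ℚ.* ε ℚ.+_) (half+half (½ ℚ.* ε))) (half+half ε))
        (⊖-triangle (seq l m) (seq l k) (seq (s n) m) (l-c m k (proj₁ C≤,K≤) (ℕ.m≤m⊔n C M))
          (⊖-triangle (seq l k) (seq (s N) m) (seq (s n) m)
            (ℚ.≤-trans (sN-c K m ℕ.≤-refl (proj₂ C≤,K≤)) u≤θ) (ℚ.≤-trans s~ u≤θ))))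
      (eventually-zip (λ _ → _,_) (C , λ _ h → h) (K , λ _ h → h)) (s-c N n ℕ.≤-refl N≤n)

  -- Power series

  infixl 7 _*̇_

  _*̇_ : (ℕ → ℚ) → (ℕ → ℚ) → ℕ → ℚ
  (f *̇ g) n = f n ℚ.* g n

  Σ< : (ℕ → ℚ) → ℕ → ℚ
  Σ< f zero    = 0ℚ
  Σ< f (suc n) = Σ< f n ℚ.+ f n

  -- Σ (j + k = n) f j · g k
  conv : (ℕ → ℚ) → (ℕ → ℚ) → ℕ → ℚ
  conv f g zero    = f 0 ℚ.* g 0
  conv f g (suc n) = f 0 ℚ.* g (suc n) ℚ.+ conv (f ∘ suc) g n

  Σ<-cong : ∀ {f g} → (∀ n → f n ≡ g n) → ∀ n → Σ< f n ≡ Σ< g n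
  Σ<-cong p zero    = refl
  Σ<-cong p (suc n) = cong₂ ℚ._+_ (Σ<-cong p n) (p n)

  Σ<-linear : ∀ σ f g n → Σ< (λ m → f m ℚ.+ σ ℚ.* g m) n ≡ Σ< f n ℚ.+ σ ℚ.* Σ< g n
  Σ<-linear σ f g zero    = sym (trans (ℚ.+-identityˡ _) (ℚ.*-zeroʳ σ))
  Σ<-linear σ f g (suc n) = trans (cong (ℚ._+ (f n ℚ.+ σ ℚ.* g n)) (Σ<-linear σ f g n))
    (solve 5 (λ σ a b p q → (a :+ σ :* b) :+ (p :+ σ :* q) := (a :+ p) :+ σ :* (b :+ q)) refl σ (Σ< f n) (Σ< g n) (f n) (g n))
    where open +-*-Solver

  Σ<-head : ∀ f n → Σ< f (suc n) ≡ f 0 ℚ.+ Σ< (f ∘ suc) n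
  Σ<-head f zero    = trans (ℚ.+-identityˡ (f 0)) (sym (ℚ.+-identityʳ (f 0)))
  Σ<-head f (suc n) = trans (cong (ℚ._+ f (suc n)) (Σ<-head f n)) (ℚ.+-assoc (f 0) (Σ< (f ∘ suc) n) (f (suc n)))

  Σ<-nonNeg : ∀ {u} → (∀ n → 0ℚ ℚ.≤ u n) → ∀ n → 0ℚ ℚ.≤ Σ< u n
  Σ<-nonNeg 0≤u zero    = ℚ.≤-refl
  Σ<-nonNeg 0≤u (suc n) = ℚ.+-mono-≤ (Σ<-nonNeg 0≤u n) (0≤u n)

  Σ<-mono : ∀ {u} → (∀ n → 0ℚ ℚ.≤ u n) → ∀ {m n} → m ℕ.≤ n → Σ< u m ℚ.≤ Σ< u n
  Σ<-mono {u} 0≤u {m} {n} m≤n = subst (λ k → Σ< u m ℚ.≤ Σ< u k) (ℕ.m∸n+n≡m m≤n) (go (n ℕ.∸ m))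
    where
    go : ∀ d → Σ< u m ℚ.≤ Σ< u (d ℕ.+ m)
    go zero    = ℚ.≤-refl
    go (suc d) = subst (ℚ._≤ Σ< u (suc d ℕ.+ m)) (ℚ.+-identityʳ _) (ℚ.+-mono-≤ (go d) (0≤u (d ℕ.+ m)))

  Σ<-tail : ∀ {g v} → (∀ n → ℚ.∣ g n ∣ ℚ.≤ v n) → ∀ d n →
            ℚ.∣ Σ< g (d ℕ.+ n) ℚ.- Σ< g n ∣ ℚ.≤ Σ< v (d ℕ.+ n) ℚ.- Σ< v n
  Σ<-tail {g} {v} g≤v zero    n = ℚ.≤-reflexive (trans (⊖-refl (Σ< g n)) (sym (ℚ.+-inverseʳ (Σ< v n))))
  Σ<-tail {g} {v} g≤v (suc d) n = begin
    ℚ.∣ (Σ< g m ℚ.+ g m) ℚ.- Σ< g n ∣            ≡⟨ cong ℚ.∣_∣ (swap (Σ< g m) (g m) (Σ< g n)) ⟩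
    ℚ.∣ (Σ< g m ℚ.- Σ< g n) ℚ.+ g m ∣            ≤⟨ ℚ.∣p+q∣≤∣p∣+∣q∣ (Σ< g m ℚ.- Σ< g n) (g m) ⟩
    ℚ.∣ Σ< g m ℚ.- Σ< g n ∣ ℚ.+ ℚ.∣ g m ∣        ≤⟨ ℚ.+-mono-≤ (Σ<-tail g≤v d n) (g≤v m) ⟩
    (Σ< v m ℚ.- Σ< v n) ℚ.+ v m                  ≡⟨ sym (swap (Σ< v m) (v m) (Σ< v n)) ⟩
    (Σ< v m ℚ.+ v m) ℚ.- Σ< v n                  ∎
    where
    open +-*-Solver
    m = d ℕ.+ n
    swap : ∀ a b c → (a ℚ.+ b) ℚ.- c ≡ (a ℚ.- c) ℚ.+ b
    swap = solve 3 (λ a b c → (a :+ b) :- c := (a :- c) :+ b) refl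

  -- The triangle j + k ≤ n is cut into its line j = 0 and the smaller triangle j ≥ 1; this is the
  -- induction step of the estimates that follow.
  Σ<-conv-head : ∀ f g n → Σ< (conv f g) (suc n) ≡ f 0 ℚ.* Σ< g (suc n) ℚ.+ Σ< (conv (f ∘ suc) g) n
  Σ<-conv-head f g zero    =
    solve 2 (λ a b → con 0ℚ :+ a :* b := a :* (con 0ℚ :+ b) :+ con 0ℚ) refl (f 0) (g 0)
    where open +-*-Solver
  Σ<-conv-head f g (suc n) = trans (cong (ℚ._+ conv f g (suc n)) (Σ<-conv-head f g n))
    (solve 5 (λ a s p q r → (a :* s :+ p) :+ (a :* q :+ r) := a :* (s :+ q) :+ (p :+ r)) refl
      (f 0) (Σ< g (suc n)) (Σ< (conv (f ∘ suc) g) n) (g (suc n)) (conv (f ∘ suc) g n))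
    where open +-*-Solver

  -- Σ (j < n) f j · (Σ (n − j ≤ k < n + d) g k) and its termwise majorant.
  cauchyProduct-error : ∀ {f g u v} → (∀ n → ℚ.∣ f n ∣ ℚ.≤ u n) → (∀ n → ℚ.∣ g n ∣ ℚ.≤ v n) → ∀ n d →
    ((Σ< f n ℚ.* Σ< g (d ℕ.+ n)) ⊖ Σ< (conv f g) n) ℚ.≤ Σ< u n ℚ.* Σ< v (d ℕ.+ n) ℚ.- Σ< (conv u v) n
  cauchyProduct-error {f} {g} {u} {v} f≤u g≤v zero    d = ℚ.≤-reflexive (trans
    (cong ℚ.∣_∣ (solve 1 (λ x → con 0ℚ :* x :- con 0ℚ := con 0ℚ) refl (Σ< g (d ℕ.+ 0))))
    (solve 1 (λ x → con 0ℚ := con 0ℚ :* x :- con 0ℚ) refl (Σ< v (d ℕ.+ 0))))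
    where open +-*-Solver
  cauchyProduct-error {f} {g} {u} {v} f≤u g≤v (suc n) d = begin
    ℚ.∣ Σ< f (suc n) ℚ.* Σ< g (d ℕ.+ suc n) ℚ.- Σ< (conv f g) (suc n) ∣
      ≡⟨ cong ℚ.∣_∣ (split f g) ⟩
    ℚ.∣ f 0 ℚ.* (Σ< g (d ℕ.+ suc n) ℚ.- Σ< g (suc n)) ℚ.+ rest f g ∣
      ≤⟨ ℚ.∣p+q∣≤∣p∣+∣q∣ (f 0 ℚ.* (Σ< g (d ℕ.+ suc n) ℚ.- Σ< g (suc n))) (rest f g) ⟩
    ℚ.∣ f 0 ℚ.* (Σ< g (d ℕ.+ suc n) ℚ.- Σ< g (suc n)) ∣ ℚ.+ ℚ.∣ rest f g ∣
      ≤⟨ ℚ.+-mono-≤ head≤ (cauchyProduct-error (f≤u ∘ suc) g≤v n (suc d)) ⟩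
    u 0 ℚ.* (Σ< v (d ℕ.+ suc n) ℚ.- Σ< v (suc n)) ℚ.+ rest u v
      ≡⟨ sym (split u v) ⟩
    Σ< u (suc n) ℚ.* Σ< v (d ℕ.+ suc n) ℚ.- Σ< (conv u v) (suc n) ∎
    where
    rest : (ℕ → ℚ) → (ℕ → ℚ) → ℚ
    rest f g = Σ< (f ∘ suc) n ℚ.* Σ< g (suc d ℕ.+ n) ℚ.- Σ< (conv (f ∘ suc) g) n
    split : ∀ f g → Σ< f (suc n) ℚ.* Σ< g (d ℕ.+ suc n) ℚ.- Σ< (conv f g) (suc n) ≡
                    f 0 ℚ.* (Σ< g (d ℕ.+ suc n) ℚ.- Σ< g (suc n)) ℚ.+ rest f g
    split f g = trans
      (cong₂ (λ a b → a ℚ.* Σ< g (d ℕ.+ suc n) ℚ.- b) (Σ<-head f n) (Σ<-conv-head f g n))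
      (trans (solve 5 (λ a s G H c → (a :+ s) :* G :- (a :* H :+ c) := a :* (G :- H) :+ (s :* G :- c)) refl
          (f 0) (Σ< (f ∘ suc) n) (Σ< g (d ℕ.+ suc n)) (Σ< g (suc n)) (Σ< (conv (f ∘ suc) g) n))
        (cong (λ m → f 0 ℚ.* (Σ< g (d ℕ.+ suc n) ℚ.- Σ< g (suc n)) ℚ.+
                     (Σ< (f ∘ suc) n ℚ.* Σ< g m ℚ.- Σ< (conv (f ∘ suc) g) n)) (ℕ.+-suc d n)))
      where open +-*-Solver
    head≤ : ℚ.∣ f 0 ℚ.* (Σ< g (d ℕ.+ suc n) ℚ.- Σ< g (suc n)) ∣ ℚ.≤ u 0 ℚ.* (Σ< v (d ℕ.+ suc n) ℚ.- Σ< v (suc n))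
    head≤ = begin
      ℚ.∣ f 0 ℚ.* Δ ∣                                ≡⟨ ℚ.∣p*q∣≡∣p∣*∣q∣ (f 0) Δ ⟩
      ℚ.∣ f 0 ∣ ℚ.* ℚ.∣ Δ ∣                          ≤⟨ *-mono-≤-nonNeg (ℚ.0≤∣p∣ (f 0)) (ℚ.≤-trans (ℚ.0≤∣p∣ Δ) tail≤) (f≤u 0) tail≤ ⟩
      u 0 ℚ.* (Σ< v (d ℕ.+ suc n) ℚ.- Σ< v (suc n))  ∎
      where
      Δ     = Σ< g (d ℕ.+ suc n) ℚ.- Σ< g (suc n)
      tail≤ = Σ<-tail g≤v d (suc n)

  -- The square j < n, k < m lies in the triangle j + k < n + m.
  square≤triangle : ∀ {u v} → (∀ n → 0ℚ ℚ.≤ u n) → (∀ n → 0ℚ ℚ.≤ v n) → ∀ n m →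
                    Σ< u n ℚ.* Σ< v m ℚ.≤ Σ< (conv u v) (n ℕ.+ m)
  square≤triangle {u} {v} 0≤u 0≤v zero m = begin
    0ℚ ℚ.* Σ< v m      ≡⟨ ℚ.*-zeroˡ (Σ< v m) ⟩
    0ℚ                 ≤⟨ Σ<-nonNeg conv-nonNeg m ⟩
    Σ< (conv u v) m    ∎
    where
    go : ∀ u → (∀ n → 0ℚ ℚ.≤ u n) → ∀ n → 0ℚ ℚ.≤ conv u v n
    go u 0≤u zero    = 0≤* (0≤u 0) (0≤v 0)
    go u 0≤u (suc n) = ℚ.+-mono-≤ (0≤* (0≤u 0) (0≤v (suc n))) (go (u ∘ suc) (0≤u ∘ suc) n)
    conv-nonNeg = go u 0≤u
  square≤triangle {u} {v} 0≤u 0≤v (suc n) m = begin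
    Σ< u (suc n) ℚ.* Σ< v m                              ≡⟨ cong (ℚ._* Σ< v m) (Σ<-head u n) ⟩
    (u 0 ℚ.+ Σ< (u ∘ suc) n) ℚ.* Σ< v m                  ≡⟨ ℚ.*-distribʳ-+ (Σ< v m) (u 0) (Σ< (u ∘ suc) n) ⟩
    u 0 ℚ.* Σ< v m ℚ.+ Σ< (u ∘ suc) n ℚ.* Σ< v m
      ≤⟨ ℚ.+-mono-≤ (ℚ.*-monoˡ-≤-nonNeg (u 0) {{nonNegative (0≤u 0)}} (Σ<-mono 0≤v (ℕ.m≤n+m m (suc n))))
                    (square≤triangle (0≤u ∘ suc) 0≤v n m) ⟩
    u 0 ℚ.* Σ< v (suc n ℕ.+ m) ℚ.+ Σ< (conv (u ∘ suc) v) (n ℕ.+ m)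
      ≡⟨ sym (Σ<-conv-head u v (n ℕ.+ m)) ⟩
    Σ< (conv u v) (suc n ℕ.+ m)                          ∎

  -- On the diagonal j + k = n the weight `h n` may be split separately in each term. With
  -- `h = fromℕ`, where j + k = j · 1 + 1 · k, this is the Leibniz rule behind the binomial theorem;
  -- with trigonometric coefficients it turns their addition formulas into those of the series.
  conv-weighted : ∀ σ (a b a′ b′ h f g : ℕ → ℚ) →
    (∀ j k → h (j ℕ.+ k) ≡ a j ℚ.* b k ℚ.+ σ ℚ.* (a′ j ℚ.* b′ k)) → ∀ n →
    h n ℚ.* conv f g n ≡ conv (a *̇ f) (b *̇ g) n ℚ.+ σ ℚ.* conv (a′ *̇ f) (b′ *̇ g) n
  conv-weighted σ a b a′ b′ h f g p zero = trans (cong (ℚ._* (f 0 ℚ.* g 0)) (p 0 0))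
    (solve 7 (λ σ a b a′ b′ f g → (a :* b :+ σ :* (a′ :* b′)) :* (f :* g) :=
                                  (a :* f) :* (b :* g) :+ σ :* ((a′ :* f) :* (b′ :* g))) refl
      σ (a 0) (b 0) (a′ 0) (b′ 0) (f 0) (g 0))
    where open +-*-Solver
  conv-weighted σ a b a′ b′ h f g p (suc n) = trans
    (ℚ.*-distribˡ-+ (h (suc n)) (f 0 ℚ.* g (suc n)) (conv (f ∘ suc) g n))
    (trans (cong₂ ℚ._+_ (cong (ℚ._* (f 0 ℚ.* g (suc n))) (p 0 (suc n)))
                        (conv-weighted σ (a ∘ suc) b (a′ ∘ suc) b′ (h ∘ suc) (f ∘ suc) g (p ∘ suc) n))
      (solve 9 (λ σ a b a′ b′ f g c d → (a :* b :+ σ :* (a′ :* b′)) :* (f :* g) :+ (c :+ σ :* d) :=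
                                        ((a :* f) :* (b :* g) :+ c) :+ σ :* ((a′ :* f) :* (b′ :* g) :+ d)) refl
        σ (a 0) (b (suc n)) (a′ 0) (b′ (suc n)) (f 0) (g (suc n))
        (conv ((a ∘ suc) *̇ (f ∘ suc)) (b *̇ g) n) (conv ((a′ ∘ suc) *̇ (f ∘ suc)) (b′ *̇ g) n)))
    where open +-*-Solver

  conv-cong : ∀ {f f′ g g′} → (∀ n → f n ≡ f′ n) → (∀ n → g n ≡ g′ n) → ∀ n → conv f g n ≡ conv f′ g′ n
  conv-cong p q zero    = cong₂ ℚ._*_ (p 0) (q 0)
  conv-cong p q (suc n) = cong₂ ℚ._+_ (cong₂ ℚ._*_ (p 0) (q (suc n))) (conv-cong (p ∘ suc) q n)

  conv-scale : ∀ r s f g n → conv (λ j → r ℚ.* f j) (λ k → s ℚ.* g k) n ≡ (r ℚ.* s) ℚ.* conv f g n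
  conv-scale r s f g zero    = solve 4 (λ r s f g → (r :* f) :* (s :* g) := (r :* s) :* (f :* g)) refl r s (f 0) (g 0)
    where open +-*-Solver
  conv-scale r s f g (suc n) = trans (cong ((r ℚ.* f 0) ℚ.* (s ℚ.* g (suc n)) ℚ.+_) (conv-scale r s (f ∘ suc) g n))
    (solve 5 (λ r s f g c → (r :* f) :* (s :* g) :+ (r :* s) :* c := (r :* s) :* (f :* g :+ c)) refl r s (f 0) (g (suc n)) (conv (f ∘ suc) g n))
    where open +-*-Solver

  conv-sucˡ : ∀ f g → f 0 ≡ 0ℚ → ∀ n → conv f g (suc n) ≡ conv (f ∘ suc) g n
  conv-sucˡ f g f0≡0 n = trans (cong (λ p → p ℚ.* g (suc n) ℚ.+ conv (f ∘ suc) g n) f0≡0)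
    (trans (cong (ℚ._+ conv (f ∘ suc) g n) (ℚ.*-zeroˡ (g (suc n)))) (ℚ.+-identityˡ _))

  conv-sucʳ : ∀ f g → g 0 ≡ 0ℚ → ∀ n → conv f g (suc n) ≡ conv f (g ∘ suc) n
  conv-sucʳ f g g0≡0 zero    = trans (cong (λ p → f 0 ℚ.* g 1 ℚ.+ f 1 ℚ.* p) g0≡0)
    (trans (cong (f 0 ℚ.* g 1 ℚ.+_) (ℚ.*-zeroʳ (f 1))) (ℚ.+-identityʳ _))
  conv-sucʳ f g g0≡0 (suc n) = cong (f 0 ℚ.* g (suc (suc n)) ℚ.+_) (conv-sucʳ (f ∘ suc) g g0≡0 n)

  -- p ^ k / k !
  divPow : ℚ → ℕ → ℚ
  divPow p zero    = 1ℚ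
  divPow p (suc k) = divPow p k ℚ.* (p ℚ.* unitFraction k)

  suc*divPow : ∀ p k → fromℕ (suc k) ℚ.* divPow p (suc k) ≡ p ℚ.* divPow p k
  suc*divPow p k = trans
    (solve 4 (λ n d p u → n :* (d :* (p :* u)) := (n :* u) :* (p :* d)) refl (fromℕ (suc k)) (divPow p k) p (unitFraction k))
    (trans (cong (ℚ._* (p ℚ.* divPow p k)) (unitFraction-inverse k)) (ℚ.*-identityˡ _))
    where open +-*-Solver

  -- Formal differentiation replaces binomial coefficients: by the Leibniz rule the convolution D
  -- satisfies (n + 1) D (n + 1) = (p + q) D n, the recursion that defines the divided powers of p +
  -- q.
  divPow-binomial : ∀ p q n → conv (divPow p) (divPow q) n ≡ divPow (p ℚ.+ q) n
  divPow-binomial p q zero    = refl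
  divPow-binomial p q (suc n) = begin-equality
    D (suc n)                                            ≡⟨ sym (ℚ.*-identityˡ _) ⟩
    1ℚ ℚ.* D (suc n)                                     ≡⟨ cong (ℚ._* D (suc n)) (sym (unitFraction-inverse n)) ⟩
    (fromℕ (suc n) ℚ.* u) ℚ.* D (suc n)                  ≡⟨ solve 3 (λ n u d → (n :* u) :* d := u :* (n :* d)) refl (fromℕ (suc n)) u (D (suc n)) ⟩
    u ℚ.* (fromℕ (suc n) ℚ.* D (suc n))                  ≡⟨ cong (u ℚ.*_) derivation ⟩
    u ℚ.* (p ℚ.* D n ℚ.+ q ℚ.* D n)                      ≡⟨ solve 4 (λ u p q d → u :* (p :* d :+ q :* d) := d :* ((p :+ q) :* u)) refl u p q (D n) ⟩
    D n ℚ.* ((p ℚ.+ q) ℚ.* u)                            ≡⟨ cong (ℚ._* ((p ℚ.+ q) ℚ.* u)) (divPow-binomial p q n) ⟩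
    divPow (p ℚ.+ q) (suc n)                             ∎
    where
    open +-*-Solver
    u = unitFraction n
    D = conv (divPow p) (divPow q)
    one : ℕ → ℚ
    one _ = 1ℚ
    derivation : fromℕ (suc n) ℚ.* D (suc n) ≡ p ℚ.* D n ℚ.+ q ℚ.* D n
    derivation = trans
      (conv-weighted 1ℚ fromℕ one one fromℕ fromℕ (divPow p) (divPow q)
        (λ j k → trans (sym (fromℕ-+ j k)) (solve 2 (λ j k → j :+ k := j :* con 1ℚ :+ con 1ℚ :* (con 1ℚ :* k)) refl (fromℕ j) (fromℕ k)))
        (suc n))
      (cong₂ ℚ._+_
        (trans (conv-sucˡ (fromℕ *̇ divPow p) (one *̇ divPow q) (ℚ.*-zeroˡ 1ℚ) n)
          (trans (conv-cong (suc*divPow p) (λ _ → refl) n)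
            (trans (conv-scale p 1ℚ (divPow p) (divPow q) n) (cong (ℚ._* D n) (ℚ.*-identityʳ p)))))
        (trans (ℚ.*-identityˡ _)
          (trans (conv-sucʳ (one *̇ divPow p) (fromℕ *̇ divPow q) (ℚ.*-zeroˡ 1ℚ) n)
            (trans (conv-cong {g′ = λ k → q ℚ.* divPow q k} (λ _ → refl) (suc*divPow q) n)
              (trans (conv-scale 1ℚ q (divPow p) (divPow q) n) (cong (ℚ._* D n) (ℚ.*-identityˡ q)))))))

  ∣divPow∣≤ : ∀ {p B} → 0ℚ ℚ.≤ B → ℚ.∣ p ∣ ℚ.≤ B → ∀ k → ℚ.∣ divPow p k ∣ ℚ.≤ divPow B k
  0≤divPow : ∀ {B} → 0ℚ ℚ.≤ B → ∀ k → 0ℚ ℚ.≤ divPow B k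

  0≤divPow 0≤B zero    = ℚ.<⇒≤ 0<1
  0≤divPow 0≤B (suc k) = 0≤* (0≤divPow 0≤B k) (0≤* 0≤B (0≤unitFraction k))

  ∣divPow∣≤ 0≤B p≤B zero    = ℚ.≤-refl
  ∣divPow∣≤ {p} {B} 0≤B p≤B (suc k) = begin
    ℚ.∣ divPow p k ℚ.* (p ℚ.* f) ∣            ≡⟨ ℚ.∣p*q∣≡∣p∣*∣q∣ (divPow p k) _ ⟩
    ℚ.∣ divPow p k ∣ ℚ.* ℚ.∣ p ℚ.* f ∣        ≡⟨ cong (ℚ.∣ divPow p k ∣ ℚ.*_) (ℚ.∣p*q∣≡∣p∣*∣q∣ p f) ⟩
    ℚ.∣ divPow p k ∣ ℚ.* (ℚ.∣ p ∣ ℚ.* f)      ≤⟨ *-mono-≤-nonNeg (ℚ.0≤∣p∣ (divPow p k)) (0≤* 0≤B (0≤unitFraction k)) (∣divPow∣≤ 0≤B p≤B k)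
                                                   (ℚ.*-monoʳ-≤-nonNeg f p≤B) ⟩
    divPow B k ℚ.* (B ℚ.* f)                  ∎
    where f = unitFraction k

  seq-expTerm : ∀ x k n → seq (expTerm x k) n ≡ divPow (seq x n) k
  seq-expTerm x zero    n = refl
  seq-expTerm x (suc k) n = cong (ℚ._* (seq x n ℚ.* unitFraction k)) (seq-expTerm x k n)

  seq-partialSum : ∀ a x n k → seq (partialSum a x n) k ≡ Σ< (a *̇ divPow (seq x k)) n
  seq-partialSum a x zero    k = refl
  seq-partialSum a x (suc n) k = cong₂ ℚ._+_ (seq-partialSum a x n k) (cong (a n ℚ.*_) (seq-expTerm x n k))

  divPow-tail : ∀ {B} → 0ℚ ℚ.< B → ∀ ε → 0ℚ ℚ.< ε →
                Eventually λ n → Σ< (divPow B) (n ℕ.+ n) ℚ.- Σ< (divPow B) n ℚ.≤ ε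
  divPow-tail {B} 0<B ε 0<ε = let M , K₀≤M , uM≤ = u-small (0<half 0<ε) in M , λ n M≤n →
    let d = (n ℕ.+ n) ℕ.∸ M
        d+M≡ : d ℕ.+ M ≡ n ℕ.+ n
        d+M≡ = ℕ.m∸n+n≡m (ℕ.≤-trans M≤n (ℕ.m≤m+n n n))
    in begin
      T (n ℕ.+ n) ℚ.- T n                             ≤⟨ ℚ.+-monoʳ-≤ (T (n ℕ.+ n)) (ℚ.neg-antimono-≤ (Σ<-mono (0≤divPow (ℚ.<⇒≤ 0<B)) M≤n)) ⟩
      T (n ℕ.+ n) ℚ.- T M                             ≡⟨ cong₂ ℚ._-_ (trans (cong T (sym d+M≡)) (T≡U (d ℕ.+ M))) (T≡U M) ⟩
      U (d ℕ.+ M) ℚ.- U M                             ≡⟨ sym (ℚ.+-identityʳ _) ⟩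
      -- Two further terms are added because U + 2u, unlike U, is nonincreasing from `K₀` on: there
      -- each term is at most half of the previous one.
      (U (d ℕ.+ M) ℚ.- U M) ℚ.+ 0ℚ                    ≤⟨ ℚ.+-monoʳ-≤ (U (d ℕ.+ M) ℚ.- U M) (ℚ.+-mono-≤ (0≤u (d ℕ.+ M)) (0≤u (d ℕ.+ M))) ⟩
      (U (d ℕ.+ M) ℚ.- U M) ℚ.+ (u (d ℕ.+ M) ℚ.+ u (d ℕ.+ M))
                                                      ≡⟨ solve 3 (λ p q r → (p :- q) :+ r := (p :+ r) :- q) refl (U (d ℕ.+ M)) (U M) _ ⟩
      (U (d ℕ.+ M) ℚ.+ (u (d ℕ.+ M) ℚ.+ u (d ℕ.+ M))) ℚ.- U M
                                                      ≤⟨ ℚ.+-monoˡ-≤ (ℚ.- U M) (U-tail M d K₀≤M) ⟩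
      (U M ℚ.+ (u M ℚ.+ u M)) ℚ.- U M                 ≡⟨ solve 2 (λ p q → (p :+ q) :- p := q) refl (U M) (u M ℚ.+ u M) ⟩
      u M ℚ.+ u M                                     ≤⟨ ℚ.+-mono-≤ uM≤ uM≤ ⟩
      ½ ℚ.* ε ℚ.+ ½ ℚ.* ε                             ≡⟨ half+half ε ⟩
      ε                                               ∎
    where
    open +-*-Solver
    -- The majorants `u` and `U` depend on `B` alone, so any bounded coefficients and any point
    -- within `B` of 0 may instantiate the module.
    open SeriesBound cosCoefficient ∣cosCoefficient∣≤1 0ℝ B 0<B (λ _ → ℚ.<⇒≤ 0<B)
    T = Σ< (divPow B)
    divPow≡u : ∀ k → divPow B k ≡ u k
    divPow≡u zero    = refl
    divPow≡u (suc k) = cong (ℚ._* (B ℚ.* unitFraction k)) (divPow≡u k)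
    T≡U : ∀ k → T k ≡ U k
    T≡U zero    = refl
    T≡U (suc k) = cong₂ ℚ._+_ (T≡U k) (divPow≡u k)

  series-⟶ : ∀ a ∣a∣≤1 x → partialSum a x ⟶ series a ∣a∣≤1 x
  series-⟶ a ∣a∣≤1 x = lim-⟶ (partialSum a x) (partialSum-cauchy a ∣a∣≤1 x)

  ∣weighted∣≤ : ∀ {a p B} → (∀ k → ℚ.∣ a k ∣ ℚ.≤ 1ℚ) → 0ℚ ℚ.≤ B → ℚ.∣ p ∣ ℚ.≤ B →
                ∀ k → ℚ.∣ (a *̇ divPow p) k ∣ ℚ.≤ divPow B k
  ∣weighted∣≤ {a} {p} {B} ∣a∣≤1 0≤B p≤B k = begin
    ℚ.∣ a k ℚ.* divPow p k ∣          ≡⟨ ℚ.∣p*q∣≡∣p∣*∣q∣ (a k) (divPow p k) ⟩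
    ℚ.∣ a k ∣ ℚ.* ℚ.∣ divPow p k ∣    ≤⟨ *-mono-≤-nonNeg (ℚ.0≤∣p∣ (a k)) (0≤divPow 0≤B k) (∣a∣≤1 k) (∣divPow∣≤ 0≤B p≤B k) ⟩
    1ℚ ℚ.* divPow B k                 ≡⟨ ℚ.*-identityˡ _ ⟩
    divPow B k                        ∎

  -- One argument for both addition formulas: cosine is the case σ = -1, sine the case σ = 1. The
  -- hypothesis `c-+` is the same formula for the Taylor coefficients at 0.
  module _ {a b a′ b′ c : ℕ → ℚ}
           (∣a∣≤1 : ∀ k → ℚ.∣ a k ∣ ℚ.≤ 1ℚ) (∣b∣≤1 : ∀ k → ℚ.∣ b k ∣ ℚ.≤ 1ℚ)
           (∣a′∣≤1 : ∀ k → ℚ.∣ a′ k ∣ ℚ.≤ 1ℚ) (∣b′∣≤1 : ∀ k → ℚ.∣ b′ k ∣ ℚ.≤ 1ℚ)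
           (∣c∣≤1 : ∀ k → ℚ.∣ c k ∣ ℚ.≤ 1ℚ) (σ : ℚ) (∣σ∣≤1 : ℚ.∣ σ ∣ ℚ.≤ 1ℚ)
           (c-+ : ∀ j k → c (j ℕ.+ k) ≡ a j ℚ.* b k ℚ.+ σ ℚ.* (a′ j ℚ.* b′ k)) where

    -- A product of partial sums ranges over a square of indices, the partial sum at `x + y` over a
    -- triangle inside it. The terms left over are majorised by those of the exponential series at X
    -- and Y, and the square of side n fits into the triangle of size 2n, so they contribute at most
    -- `T (n + n) - T n`. As X and Y bound all entries, this is uniform in the entry k.
    partialSum-addition : ∀ x y → ∀ ε → 0ℚ ℚ.< ε → Eventually λ n →
      Within ε (partialSum a x n * partialSum b y n + fromℚ σ * (partialSum a′ x n * partialSum b′ y n))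
               (partialSum c (x + y) n)
    partialSum-addition x y ε 0<ε =
      let X , 0<X , x≤X = bounded x
          Y , 0<Y , y≤Y = bounded y
          0≤X = ℚ.<⇒≤ 0<X
          0≤Y = ℚ.<⇒≤ 0<Y
          T = Σ< (divPow (X ℚ.+ Y))
          error : ∀ {a b} → (∀ k → ℚ.∣ a k ∣ ℚ.≤ 1ℚ) → (∀ k → ℚ.∣ b k ∣ ℚ.≤ 1ℚ) → ∀ n k →
            ((Σ< (a *̇ divPow (seq x k)) n ℚ.* Σ< (b *̇ divPow (seq y k)) n)
               ⊖ Σ< (conv (a *̇ divPow (seq x k)) (b *̇ divPow (seq y k))) n) ℚ.≤ T (n ℕ.+ n) ℚ.- T n
          error {a} {b} ∣a∣≤1 ∣b∣≤1 n k = begin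
            (Σ< (a *̇ divPow (seq x k)) n ℚ.* Σ< (b *̇ divPow (seq y k)) n)
               ⊖ Σ< (conv (a *̇ divPow (seq x k)) (b *̇ divPow (seq y k))) n
              ≤⟨ cauchyProduct-error (∣weighted∣≤ ∣a∣≤1 0≤X (x≤X k)) (∣weighted∣≤ ∣b∣≤1 0≤Y (y≤Y k)) n 0 ⟩
            Σ< (divPow X) n ℚ.* Σ< (divPow Y) n ℚ.- Σ< (conv (divPow X) (divPow Y)) n
              ≤⟨ ℚ.+-monoˡ-≤ _ (square≤triangle (0≤divPow 0≤X) (0≤divPow 0≤Y) n n) ⟩
            Σ< (conv (divPow X) (divPow Y)) (n ℕ.+ n) ℚ.- Σ< (conv (divPow X) (divPow Y)) n
              ≡⟨ cong₂ ℚ._-_ (Σ<-cong (divPow-binomial X Y) (n ℕ.+ n)) (Σ<-cong (divPow-binomial X Y) n) ⟩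
            T (n ℕ.+ n) ℚ.- T n ∎
      in eventually-map
        (λ n tail≤ → always λ k →
          let p = seq x k
              q = seq y k
              F = Σ< (a *̇ divPow p) n ℚ.* Σ< (b *̇ divPow q) n
              F′ = Σ< (a′ *̇ divPow p) n ℚ.* Σ< (b′ *̇ divPow q) n
              G = Σ< (conv (a *̇ divPow p) (b *̇ divPow q)) n
              G′ = Σ< (conv (a′ *̇ divPow p) (b′ *̇ divPow q)) n
          in begin
            seq (partialSum a x n * partialSum b y n + fromℚ σ * (partialSum a′ x n * partialSum b′ y n)) k
              ⊖ seq (partialSum c (x + y) n) k
              ≡⟨ cong₂ _⊖_
                   (cong₂ (λ s t → s ℚ.+ σ ℚ.* t)
                     (cong₂ ℚ._*_ (seq-partialSum a x n k) (seq-partialSum b y n k))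
                     (cong₂ ℚ._*_ (seq-partialSum a′ x n k) (seq-partialSum b′ y n k)))
                   (trans (seq-partialSum c (x + y) n k)
                     (trans (Σ<-cong (λ m → trans (cong (c m ℚ.*_) (sym (divPow-binomial p q m)))
                                                  (conv-weighted σ a b a′ b′ c (divPow p) (divPow q) c-+ m)) n)
                       (Σ<-linear σ _ _ n))) ⟩
            (F ℚ.+ σ ℚ.* F′) ⊖ (G ℚ.+ σ ℚ.* G′)
              ≤⟨ ⊖-+ F (σ ℚ.* F′) G (σ ℚ.* G′) ⟩
            (F ⊖ G) ℚ.+ ((σ ℚ.* F′) ⊖ (σ ℚ.* G′))
              ≡⟨ cong ((F ⊖ G) ℚ.+_) (trans (cong ℚ.∣_∣ (solve 3 (λ σ f g → σ :* f :- σ :* g := σ :* (f :- g)) refl σ F′ G′))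
                                            (ℚ.∣p*q∣≡∣p∣*∣q∣ σ (F′ ℚ.- G′))) ⟩
            (F ⊖ G) ℚ.+ ℚ.∣ σ ∣ ℚ.* (F′ ⊖ G′)
              ≤⟨ ℚ.+-monoʳ-≤ (F ⊖ G) (ℚ.*-monoʳ-≤-nonNeg (F′ ⊖ G′) {{ℚ.∣-∣-nonNeg (F′ ℚ.- G′)}} ∣σ∣≤1) ⟩
            (F ⊖ G) ℚ.+ 1ℚ ℚ.* (F′ ⊖ G′)
              ≡⟨ cong ((F ⊖ G) ℚ.+_) (ℚ.*-identityˡ (F′ ⊖ G′)) ⟩
            (F ⊖ G) ℚ.+ (F′ ⊖ G′)
              ≤⟨ ℚ.+-mono-≤ (ℚ.≤-trans (error ∣a∣≤1 ∣b∣≤1 n k) tail≤) (ℚ.≤-trans (error ∣a′∣≤1 ∣b′∣≤1 n k) tail≤) ⟩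
            ½ ℚ.* ε ℚ.+ ½ ℚ.* ε
              ≡⟨ half+half ε ⟩
            ε ∎)
        (divPow-tail (ℚ.+-mono-< 0<X 0<Y) (½ ℚ.* ε) (0<half 0<ε))
      where open +-*-Solver

    series-addition : ∀ x y →
      series a ∣a∣≤1 x * series b ∣b∣≤1 y + fromℚ σ * (series a′ ∣a′∣≤1 x * series b′ ∣b′∣≤1 y)
        ≈ series c ∣c∣≤1 (x + y)
    series-addition x y = ⟶-unique
      (⟶-+ (⟶-* (series-⟶ a ∣a∣≤1 x) (series-⟶ b ∣b∣≤1 y))
           (⟶-* (⟶-const (fromℚ σ)) (⟶-* (series-⟶ a′ ∣a′∣≤1 x) (series-⟶ b′ ∣b′∣≤1 y))))
      (series-⟶ c ∣c∣≤1 (x + y))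
      (partialSum-addition x y)

  -- Square roots

  -- The start index is fixed at 0, as in `√-pos`: then `recip` does not shift the sequence and the
  -- product is 1 at every entry.
  recip-inverseˡ : ∀ x δ (0<δ : 0ℚ ℚ.< δ) h → recip x (δ , 0<δ , 0 , h) * x ≃ 1ℝ
  recip-inverseˡ x δ 0<δ h = ≗⇒≃ λ n → ℚ.*-inverseˡ (seq x n) {{_}}

  -- Rounding down gives s² ≤ n ≤ (s + u)² with s = `√-seq n k` and u = 1/(k+1), so n - s² lies
  -- between 0 and (2s + u) u ≤ (2B + 1) u.
  √-square : ∀ n → √ n * √ n ≃ fromℚ (fromℕ n)
  √-square n = wrap λ ε 0<ε →
    let B , 0<B , s≤B = bounded (√ n)
        0<2B+1        = ℚ.+-mono-< (ℚ.+-mono-< 0<B 0<B) 0<1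
        δ , 0<δ , Dδ  = shrink {B ℚ.+ B ℚ.+ 1ℚ} 0<2B+1 0<ε
        K , u≤δ       = small 0<δ
    in K , λ k K≤k →
      let a = isqrt (n ℕ.* (suc k ℕ.* suc k))
          u = unitFraction k
          s = √-seq n k
      in ∣∣≤ _
        (begin
          s ℚ.* s ℚ.- fromℕ n            ≤⟨ ℚ.+-monoˡ-≤ (ℚ.- fromℕ n) (s²≤n k) ⟩
          fromℕ n ℚ.- fromℕ n            ≡⟨ ℚ.+-inverseʳ (fromℕ n) ⟩
          0ℚ                             ≤⟨ ℚ.<⇒≤ 0<ε ⟩
          ε                              ∎)
        (begin
          ℚ.- (s ℚ.* s ℚ.- fromℕ n)                ≡⟨ solve 2 (λ s n → :- (s :* s :- n) := n :- s :* s) refl s (fromℕ n) ⟩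
          fromℕ n ℚ.- s ℚ.* s                      ≤⟨ ℚ.+-monoˡ-≤ (ℚ.- (s ℚ.* s)) (n≤[s+u]² k) ⟩
          (s ℚ.+ u) ℚ.* (s ℚ.+ u) ℚ.- s ℚ.* s      ≡⟨ solve 2 (λ s u → (s :+ u) :* (s :+ u) :- s :* s := (s :+ s :+ u) :* u) refl s u ⟩
          (s ℚ.+ s ℚ.+ u) ℚ.* u                    ≤⟨ ℚ.*-monoʳ-≤-nonNeg u {{nonNegative (0≤unitFraction k)}}
                                                        (ℚ.+-mono-≤ (ℚ.+-mono-≤ (≤B (s≤B k)) (≤B (s≤B k))) (unitFraction-antitone {0} {k} z≤n)) ⟩
          (B ℚ.+ B ℚ.+ 1ℚ) ℚ.* u                   ≤⟨ ℚ.*-monoˡ-≤-nonNeg (B ℚ.+ B ℚ.+ 1ℚ) {{nonNegative (ℚ.<⇒≤ 0<2B+1)}}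
                                                        (ℚ.≤-trans (unitFraction-antitone K≤k) u≤δ) ⟩
          (B ℚ.+ B ℚ.+ 1ℚ) ℚ.* δ                   ≡⟨ Dδ ⟩
          ε                                        ∎)
    where
    open +-*-Solver

    ≤B : ∀ {p B} → ℚ.∣ p ∣ ℚ.≤ B → p ℚ.≤ B
    ≤B {p} h with ℚ.≤-total 0ℚ p
    ... | inj₁ 0≤p = subst (ℚ._≤ _) (ℚ.0≤p⇒∣p∣≡p 0≤p) h
    ... | inj₂ p≤0 = ℚ.≤-trans p≤0 (ℚ.≤-trans (ℚ.0≤∣p∣ p) h)

    fraction : ∀ b c k → (fromℕ b ℚ.* unitFraction k) ℚ.* (fromℕ c ℚ.* unitFraction k) ≡ fromℕ (b ℕ.* c) ℚ.* (unitFraction k ℚ.* unitFraction k)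
    fraction b c k = trans
      (solve 3 (λ b c u → (b :* u) :* (c :* u) := (b :* c) :* (u :* u)) refl (fromℕ b) (fromℕ c) (unitFraction k))
      (cong (ℚ._* (unitFraction k ℚ.* unitFraction k)) (fromℕ-* b c))

    n≡ : ∀ k → fromℕ (n ℕ.* (suc k ℕ.* suc k)) ℚ.* (unitFraction k ℚ.* unitFraction k) ≡ fromℕ n
    n≡ k = trans (cong (ℚ._* (u ℚ.* u)) (sym (trans (cong (fromℕ n ℚ.*_) (fromℕ-* (suc k) (suc k))) (fromℕ-* n (suc k ℕ.* suc k)))))
      (trans (solve 3 (λ n q u → (n :* (q :* q)) :* (u :* u) := n :* ((q :* u) :* (q :* u))) refl (fromℕ n) (fromℕ (suc k)) u)
        (trans (cong (λ t → fromℕ n ℚ.* (t ℚ.* t)) (unitFraction-inverse k)) (ℚ.*-identityʳ (fromℕ n))))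
      where u = unitFraction k

    u²-mono : ∀ k {b c} → b ℕ.≤ c →
      fromℕ b ℚ.* (unitFraction k ℚ.* unitFraction k) ℚ.≤ fromℕ c ℚ.* (unitFraction k ℚ.* unitFraction k)
    u²-mono k b≤c = ℚ.*-monoʳ-≤-nonNeg (unitFraction k ℚ.* unitFraction k)
      {{nonNegative (0≤* (0≤unitFraction k) (0≤unitFraction k))}} (fromℕ-mono b≤c)

    s²≤n : ∀ k → √-seq n k ℚ.* √-seq n k ℚ.≤ fromℕ n
    s²≤n k = subst₂ ℚ._≤_ (sym (fraction a a k)) (n≡ k) (u²-mono k (isqrt-lower (n ℕ.* (suc k ℕ.* suc k))))
      where a = isqrt (n ℕ.* (suc k ℕ.* suc k))

    n≤[s+u]² : ∀ k → fromℕ n ℚ.≤ (√-seq n k ℚ.+ unitFraction k) ℚ.* (√-seq n k ℚ.+ unitFraction k)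
    n≤[s+u]² k = subst₂ ℚ._≤_ (n≡ k) (trans (sym (fraction (suc a) (suc a) k)) (cong₂ ℚ._*_ s+u s+u))
      (u²-mono k (ℕ.<⇒≤ (isqrt-upper (n ℕ.* (suc k ℕ.* suc k)))))
      where
      a = isqrt (n ℕ.* (suc k ℕ.* suc k))
      s+u : fromℕ (suc a) ℚ.* unitFraction k ≡ √-seq n k ℚ.+ unitFraction k
      s+u = trans (cong (ℚ._* unitFraction k) (sym (fromℕ-+ 1 a)))
        (solve 2 (λ a u → (con 1ℚ :+ a) :* u := a :* u :+ u) refl (fromℕ a) (unitFraction k))

  6*1/√6²≃1 : fromℚ (fromℕ 6) * (1/√6 * 1/√6) ≃ 1ℝ
  6*1/√6²≃1 = ℝ-ring.trans (ℝ-ring.*-congʳ (ℝ-ring.sym (√-square 6))) (ℝ-ring.trans (rearrange (√ 6) 1/√6)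
    (ℝ-ring.trans (ℝ-ring.*-cong inv inv) (ℝ-ring.*-identityˡ 1ℝ)))
    where
    inv : 1/√6 * √ 6 ≃ 1ℝ
    inv = recip-inverseˡ (√ 6) (proj₁ (√-pos 5)) (proj₁ (proj₂ (√-pos 5))) (proj₂ (proj₂ (proj₂ (√-pos 5))))
    rearrange : ∀ x y → (x * x) * (y * y) ≃ (y * x) * (y * x)
    rearrange = solve 2 (λ x y → (x :* x) :* (y :* y) := (y :* x) :* (y :* x)) ℝ-ring.refl
      where open ℝ-Solver

-- Trigonometric functions

-- Shifting the coefficients of a series in x^k / k! differentiates it: these are cos′ = -sin and
-- sin′ = cos.
cosCoefficient-suc : ∀ k → cosCoefficient (suc k) ≡ ℚ.- sinCoefficient k
sinCoefficient-suc : ∀ k → sinCoefficient (suc k) ≡ cosCoefficient k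

cosCoefficient-suc zero    = refl
cosCoefficient-suc (suc k) = cong ℚ.-_ (sym (sinCoefficient-suc k))
sinCoefficient-suc zero    = refl
sinCoefficient-suc (suc k) = sym (cosCoefficient-suc k)

-- The coefficients with index k are the cosine and sine of kπ/2, so they obey the addition formulas
-- themselves. The mutual induction on j differentiates one formula into the other.
cosCoefficient-+ : ∀ j k → cosCoefficient (j ℕ.+ k) ≡
  cosCoefficient j ℚ.* cosCoefficient k ℚ.+ (ℚ.- 1ℚ) ℚ.* (sinCoefficient j ℚ.* sinCoefficient k)
sinCoefficient-+ : ∀ j k → sinCoefficient (j ℕ.+ k) ≡
  sinCoefficient j ℚ.* cosCoefficient k ℚ.+ 1ℚ ℚ.* (cosCoefficient j ℚ.* sinCoefficient k)

cosCoefficient-+ zero    k =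
  solve 2 (λ c s → c := con 1ℚ :* c :+ con (ℚ.- 1ℚ) :* (con 0ℚ :* s)) refl (cosCoefficient k) (sinCoefficient k)
  where open +-*-Solver
cosCoefficient-+ (suc j) k = trans (cosCoefficient-suc (j ℕ.+ k)) (trans (cong ℚ.-_ (sinCoefficient-+ j k))
  (trans (solve 4 (λ a b c s → :- (b :* c :+ con 1ℚ :* (a :* s)) := (:- b) :* c :+ con (ℚ.- 1ℚ) :* (a :* s)) refl
      (cosCoefficient j) (sinCoefficient j) (cosCoefficient k) (sinCoefficient k))
    (cong₂ (λ a b → a ℚ.* cosCoefficient k ℚ.+ (ℚ.- 1ℚ) ℚ.* (b ℚ.* sinCoefficient k))
      (sym (cosCoefficient-suc j)) (sym (sinCoefficient-suc j)))))
  where open +-*-Solver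

sinCoefficient-+ zero    k =
  solve 2 (λ c s → s := con 0ℚ :* c :+ con 1ℚ :* (con 1ℚ :* s)) refl (cosCoefficient k) (sinCoefficient k)
  where open +-*-Solver
sinCoefficient-+ (suc j) k = trans (sinCoefficient-suc (j ℕ.+ k)) (trans (cosCoefficient-+ j k)
  (trans (solve 4 (λ a b c s → a :* c :+ con (ℚ.- 1ℚ) :* (b :* s) := a :* c :+ con 1ℚ :* ((:- b) :* s)) refl
      (cosCoefficient j) (sinCoefficient j) (cosCoefficient k) (sinCoefficient k))
    (cong₂ (λ a b → a ℚ.* cosCoefficient k ℚ.+ 1ℚ ℚ.* (b ℚ.* sinCoefficient k))
      (sym (sinCoefficient-suc j)) (sym (cosCoefficient-suc j)))))
  where open +-*-Solver

cos-+ : ∀ x y → cos (x + y) ≃ cos x * cos y + - (sin x * sin y)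
cos-+ x y = ℝ-ring.trans
  (ℝ-ring.sym (wrap (series-addition ∣cosCoefficient∣≤1 ∣cosCoefficient∣≤1 ∣sinCoefficient∣≤1 ∣sinCoefficient∣≤1
                      ∣cosCoefficient∣≤1 (ℚ.- 1ℚ) ℚ.≤-refl cosCoefficient-+ x y)))
  (rearrange (cos x) (cos y) (sin x) (sin y))
  where
  open ℝ-Solver
  rearrange : ∀ a b c d → a * b + fromℚ (ℚ.- 1ℚ) * (c * d) ≃ a * b + - (c * d)
  rearrange = solve 4 (λ a b c d → a :* b :+ con (ℚ.- 1ℚ) :* (c :* d) := a :* b :+ :- (c :* d)) ℝ-ring.refl

sin-+ : ∀ x y → sin (x + y) ≃ cos x * sin y + sin x * cos y
sin-+ x y = ℝ-ring.trans
  (ℝ-ring.sym (wrap (series-addition ∣sinCoefficient∣≤1 ∣cosCoefficient∣≤1 ∣cosCoefficient∣≤1 ∣sinCoefficient∣≤1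
                      ∣sinCoefficient∣≤1 1ℚ ℚ.≤-refl sinCoefficient-+ x y)))
  (rearrange (sin x) (cos y) (cos x) (sin y))
  where
  open ℝ-Solver
  rearrange : ∀ a b c d → a * b + fromℚ 1ℚ * (c * d) ≃ c * d + a * b
  rearrange = solve 4 (λ a b c d → a :* b :+ con 1ℚ :* (c :* d) := c :* d :+ a :* b) ℝ-ring.refl

-- Entrywise equality is enough for `x + - x` against `0ℝ` and for 3θ against 2π, and it avoids a
-- continuity estimate for the series.
series-cong-≗ : ∀ a ∣a∣≤1 {x y} → x ≗ʳ y → series a ∣a∣≤1 x ≃ series a ∣a∣≤1 y
series-cong-≗ a ∣a∣≤1 {x} {y} p = wrap (⟶-unique (series-⟶ a ∣a∣≤1 x) (series-⟶ a ∣a∣≤1 y)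
  λ ε 0<ε → always λ n → ≗⇒≈ {partialSum a x n} {partialSum a y n}
    (λ k → trans (seq-partialSum a x n k)
             (trans (cong (λ q → Σ< (a *̇ divPow q) n) (p k)) (sym (seq-partialSum a y n k)))) ε 0<ε)

series-0 : ∀ a ∣a∣≤1 → series a ∣a∣≤1 0ℝ ≃ fromℚ (a 0)
series-0 a ∣a∣≤1 = wrap (⟶-unique (series-⟶ a ∣a∣≤1 0ℝ) (⟶-const (fromℚ (a 0)))
  -- The index starts at 1 because the empty partial sum is 0, not `a 0`.
  λ ε 0<ε → 1 , λ { (suc n) _ → ≗⇒≈ {partialSum a 0ℝ (suc n)} {fromℚ (a 0)}
    (λ k → trans (seq-partialSum a 0ℝ (suc n) k) (Σ<-0 n)) ε 0<ε })
  where
  Σ<-0 : ∀ n → Σ< (a *̇ divPow 0ℚ) (suc n) ≡ a 0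
  Σ<-0 zero    = trans (ℚ.+-identityˡ _) (ℚ.*-identityʳ (a 0))
  Σ<-0 (suc n) = trans (cong₂ ℚ._+_ (Σ<-0 n)
    (solve 3 (λ a d u → a :* (d :* (con 0ℚ :* u)) := con 0ℚ) refl (a (suc n)) (divPow 0ℚ n) (unitFraction n)))
    (ℚ.+-identityʳ (a 0))
    where open +-*-Solver

series-neg : ∀ a ∣a∣≤1 σ → (∀ q k → a k ℚ.* divPow (ℚ.- q) k ≡ σ ℚ.* (a k ℚ.* divPow q k)) →
             ∀ x → series a ∣a∣≤1 (- x) ≃ fromℚ σ * series a ∣a∣≤1 x
series-neg a ∣a∣≤1 σ term-neg x = wrap (⟶-unique
  (series-⟶ a ∣a∣≤1 (- x)) (⟶-* (⟶-const (fromℚ σ)) (series-⟶ a ∣a∣≤1 x))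
  λ ε 0<ε → always λ n → ≗⇒≈ {partialSum a (- x) n} {fromℚ σ * partialSum a x n}
    (λ k → trans (seq-partialSum a (- x) n k)
             (trans (Σ<-neg (seq x k) n) (cong (σ ℚ.*_) (sym (seq-partialSum a x n k))))) ε 0<ε)
  where
  Σ<-neg : ∀ q n → Σ< (a *̇ divPow (ℚ.- q)) n ≡ σ ℚ.* Σ< (a *̇ divPow q) n
  Σ<-neg q zero    = sym (ℚ.*-zeroʳ σ)
  Σ<-neg q (suc n) = trans (cong₂ ℚ._+_ (Σ<-neg q n) (term-neg q n)) (sym (ℚ.*-distribˡ-+ σ _ _))

-- Passing from k to k + 1 exchanges the coefficients and brings in one factor -q, which flips the
-- sign. The mutual induction thus never has to split on the parity of k.
cosTerm-even : ∀ q k → cosCoefficient k ℚ.* divPow (ℚ.- q) k ≡ cosCoefficient k ℚ.* divPow q k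
sinTerm-odd  : ∀ q k → sinCoefficient k ℚ.* divPow (ℚ.- q) k ≡ ℚ.- (sinCoefficient k ℚ.* divPow q k)

cosTerm-even q zero    = refl
cosTerm-even q (suc k) = trans (cong (ℚ._* divPow (ℚ.- q) (suc k)) (cosCoefficient-suc k))
  (trans (solve 4 (λ s d q u → (:- s) :* (d :* ((:- q) :* u)) := (s :* d) :* (q :* u)) refl
           (sinCoefficient k) (divPow (ℚ.- q) k) q (unitFraction k))
    (trans (cong (ℚ._* (q ℚ.* unitFraction k)) (sinTerm-odd q k))
      (trans (solve 4 (λ s d q u → (:- (s :* d)) :* (q :* u) := (:- s) :* (d :* (q :* u))) refl
               (sinCoefficient k) (divPow q k) q (unitFraction k))
        (cong (ℚ._* divPow q (suc k)) (sym (cosCoefficient-suc k))))))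
  where open +-*-Solver

sinTerm-odd q zero    = refl
sinTerm-odd q (suc k) = trans (cong (ℚ._* divPow (ℚ.- q) (suc k)) (sinCoefficient-suc k))
  (trans (solve 4 (λ c d q u → c :* (d :* ((:- q) :* u)) := :- ((c :* d) :* (q :* u))) refl
           (cosCoefficient k) (divPow (ℚ.- q) k) q (unitFraction k))
    (trans (cong (λ t → ℚ.- (t ℚ.* (q ℚ.* unitFraction k))) (cosTerm-even q k))
      (trans (solve 4 (λ c d q u → :- ((c :* d) :* (q :* u)) := :- (c :* (d :* (q :* u)))) refl
               (cosCoefficient k) (divPow q k) q (unitFraction k))
        (cong (λ c → ℚ.- (c ℚ.* divPow q (suc k))) (sym (sinCoefficient-suc k))))))
  where open +-*-Solver

cos-neg : ∀ x → cos (- x) ≃ cos x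
cos-neg x = ℝ-ring.trans
  (series-neg cosCoefficient ∣cosCoefficient∣≤1 1ℚ (λ q k → trans (cosTerm-even q k) (sym (ℚ.*-identityˡ _))) x)
  (ℝ-ring.*-identityˡ (cos x))

sin-neg : ∀ x → sin (- x) ≃ - sin x
sin-neg x = ℝ-ring.trans
  (series-neg sinCoefficient ∣sinCoefficient∣≤1 (ℚ.- 1ℚ) (λ q k → trans (sinTerm-odd q k) (-≡-1* _)) x)
  (-1*≃- (sin x))
  where
  -≡-1* : ∀ p → ℚ.- p ≡ (ℚ.- 1ℚ) ℚ.* p
  -≡-1* = solve 1 (λ p → :- p := con (ℚ.- 1ℚ) :* p) refl
    where open +-*-Solver
  -1*≃- : ∀ s → fromℚ (ℚ.- 1ℚ) * s ≃ - s
  -1*≃- = solve 1 (λ s → con (ℚ.- 1ℚ) :* s := :- s) ℝ-ring.refl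
    where open ℝ-Solver

cos²+sin²≃1 : ∀ x → cos x * cos x + sin x * sin x ≃ 1ℝ
cos²+sin²≃1 x = ℝ-ring.trans (ℝ-ring.sym cos[x-x]) (ℝ-ring.trans
  (series-cong-≗ cosCoefficient ∣cosCoefficient∣≤1 {x + - x} {0ℝ} λ n → ℚ.+-inverseʳ (seq x n))
  (series-0 cosCoefficient ∣cosCoefficient∣≤1))
  where
  open ℝ-Solver
  rearrange : ∀ c s → c * c + - (s * - s) ≃ c * c + s * s
  rearrange = solve 2 (λ c s → c :* c :+ :- (s :* (:- s)) := c :* c :+ s :* s) ℝ-ring.refl
  cos[x-x] : cos (x + - x) ≃ cos x * cos x + sin x * sin x
  cos[x-x] = ℝ-ring.trans (cos-+ x (- x)) (ℝ-ring.trans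
    (ℝ-ring.+-cong (ℝ-ring.*-congˡ (cos-neg x)) (ℝ-ring.-‿cong (ℝ-ring.*-congˡ (sin-neg x))))
    (rearrange (cos x) (sin x)))

2ℚ 3ℚ 4ℚ : ℚ
2ℚ = 1ℚ ℚ.+ 1ℚ
3ℚ = 2ℚ ℚ.+ 1ℚ
4ℚ = 3ℚ ℚ.+ 1ℚ

-- Substituting s² = 1 − c², the real and imaginary parts of (c + is)³ = (C + iS)²
-- are c (4c² − 3) = 1 and s (4c² − 1) = 0.
module CubeRoot (c s C S : ℝ) (c²+s²≃1 : c * c + s * s ≃ 1ℝ) (C²+S²≃1 : C * C + S * S ≃ 1ℝ) (S≃0 : S ≃ 0ℝ)
  (re-cube : c * (c * c + - (s * s)) + - (s * (c * s + s * c)) ≃ C * C + - (S * S))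
  (im-cube : c * (c * s + s * c) + s * (c * c + - (s * s)) ≃ C * S + S * C)
  (s≄0 : ¬ s ≃ 0ℝ) where

  open SetoidReasoning ℝ-ring.setoid
  open ℝ-Solver

  c[4c²-3]≃1 : c * (fromℚ 4ℚ * c * c + - fromℚ 3ℚ) ≃ 1ℝ
  c[4c²-3]≃1 = begin
    -- Writing 3 as 3 (c² + s²) yields a homogeneous cubic, which is identically the real part of (c
    -- + is)³.
    c * (fromℚ 4ℚ * c * c + - fromℚ 3ℚ)                        ≈⟨ ℝ-ring.*-congˡ (ℝ-ring.+-congˡ (ℝ-ring.-‿cong
                                                                    (ℝ-ring.trans (ℝ-ring.*-congˡ c²+s²≃1) (ℝ-ring.*-identityʳ _)))) ⟨
    c * (fromℚ 4ℚ * c * c + - (fromℚ 3ℚ * (c * c + s * s)))    ≈⟨ solve 2 (λ c s → c :* (con 4ℚ :* c :* c :+ :- (con 3ℚ :* (c :* c :+ s :* s))) :=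
                                                                    c :* (c :* c :+ :- (s :* s)) :+ :- (s :* (c :* s :+ s :* c))) ℝ-ring.refl c s ⟩
    c * (c * c + - (s * s)) + - (s * (c * s + s * c))          ≈⟨ re-cube ⟩
    C * C + - (S * S)                                          ≈⟨ solve 2 (λ C S → C :* C :+ :- (S :* S) := (C :* C :+ S :* S) :+ :- (con 2ℚ :* S :* S)) ℝ-ring.refl C S ⟩
    (C * C + S * S) + - (fromℚ 2ℚ * S * S)                     ≈⟨ ℝ-ring.+-cong C²+S²≃1 (ℝ-ring.-‿cong (ℝ-ring.trans (ℝ-ring.*-congˡ S≃0) (ℝ-ring.zeroʳ _))) ⟩
    1ℝ + - 0ℝ                                                  ≈⟨ ≗⇒≃ (λ _ → refl) ⟩
    1ℝ                                                         ∎

  s[4c²-1]≃0 : s * (fromℚ 4ℚ * c * c + - 1ℝ) ≃ 0ℝ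
  s[4c²-1]≃0 = begin
    s * (fromℚ 4ℚ * c * c + - 1ℝ)                     ≈⟨ ℝ-ring.*-congˡ (ℝ-ring.+-congˡ (ℝ-ring.-‿cong c²+s²≃1)) ⟨
    s * (fromℚ 4ℚ * c * c + - (c * c + s * s))        ≈⟨ solve 2 (λ c s → s :* (con 4ℚ :* c :* c :+ :- (c :* c :+ s :* s)) :=
                                                           c :* (c :* s :+ s :* c) :+ s :* (c :* c :+ :- (s :* s))) ℝ-ring.refl c s ⟩
    c * (c * s + s * c) + s * (c * c + - (s * s))     ≈⟨ im-cube ⟩
    C * S + S * C                                     ≈⟨ ℝ-ring.+-cong (ℝ-ring.*-congˡ S≃0) (ℝ-ring.*-congʳ S≃0) ⟩
    C * 0ℝ + 0ℝ * C                                   ≈⟨ solve 1 (λ C → C :* con 0ℚ :+ con 0ℚ :* C := con 0ℚ) ℝ-ring.refl C ⟩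
    0ℝ                                                ∎

  4c²≃1 : fromℚ 4ℚ * c * c + - 1ℝ ≃ 0ℝ
  4c²≃1 = wrap (*≈0⇒≈0 s (fromℚ 4ℚ * c * c + - 1ℝ) (unwrap s[4c²-1]≃0) λ s≈0 → s≄0 (wrap s≈0))

  -- In -½ · c (4c² - 3) + ½ c · (4c² - 1) the cubic terms cancel and c remains. This selects -½
  -- among the two roots of 4c² = 1 without deciding a sign.
  c≃-½ : c ≃ fromℚ (ℚ.- ½)
  c≃-½ = begin
    c                                            ≈⟨ solve 1 (λ c → c := con (ℚ.- ½) :* (c :* (con 4ℚ :* c :* c :+ :- con 3ℚ)) :+
                                                      (con ½ :* c) :* (con 4ℚ :* c :* c :+ :- con 1ℚ)) ℝ-ring.refl c ⟩
    fromℚ (ℚ.- ½) * (c * (fromℚ 4ℚ * c * c + - fromℚ 3ℚ)) + (fromℚ ½ * c) * (fromℚ 4ℚ * c * c + - 1ℝ)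
                                                 ≈⟨ ℝ-ring.+-cong (ℝ-ring.*-congˡ c[4c²-3]≃1) (ℝ-ring.*-congˡ 4c²≃1) ⟩
    fromℚ (ℚ.- ½) * 1ℝ + (fromℚ ½ * c) * 0ℝ      ≈⟨ solve 1 (λ c → con (ℚ.- ½) :* con 1ℚ :+ (con ½ :* c) :* con 0ℚ := con (ℚ.- ½)) ℝ-ring.refl c ⟩
    fromℚ (ℚ.- ½)                                ∎

  s²≃¾ : s * s ≃ fromℚ (½ ℚ.+ ½ ℚ.* ½)
  s²≃¾ = begin
    s * s                                         ≈⟨ solve 2 (λ c s → s :* s := (c :* c :+ s :* s) :+ :- (c :* c)) ℝ-ring.refl c s ⟩
    (c * c + s * s) + - (c * c)                   ≈⟨ ℝ-ring.+-cong c²+s²≃1 (ℝ-ring.-‿cong (ℝ-ring.*-cong c≃-½ c≃-½)) ⟩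
    1ℝ + - (fromℚ (ℚ.- ½) * fromℚ (ℚ.- ½))        ≈⟨ ≗⇒≃ (λ _ → refl) ⟩
    fromℚ (½ ℚ.+ ½ ℚ.* ½)                         ∎

-- Complex numbers

infix 4 _≃ᶜ_

record _≃ᶜ_ (z w : ℂ) : Set where
  constructor _,_
  field
    re-≃ : re z ≃ re w
    im-≃ : im z ≃ im w

open _≃ᶜ_

≃ᶜ⇒≈ᶜ : ∀ {z w} → z ≃ᶜ w → z ≈ᶜ w
≃ᶜ⇒≈ᶜ (p , q) = unwrap p , unwrap q

≈ᶜ⇒≃ᶜ : ∀ {z w} → z ≈ᶜ w → z ≃ᶜ w
≈ᶜ⇒≃ᶜ (p , q) = wrap p , wrap q

-ᶜ_ : ℂ → ℂ
-ᶜ z = - re z +i - im z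

ℂ-commutativeRing : CommutativeRing 0ℓ 0ℓ
ℂ-commutativeRing = record
  { Carrier = ℂ ; _≈_ = _≃ᶜ_ ; _+_ = _+ᶜ_ ; _*_ = _*ᶜ_ ; -_ = -ᶜ_ ; 0# = 0ᶜ ; 1# = 1ᶜ
  ; isCommutativeRing = record
    { isRing = record
      { +-isAbelianGroup = record
        { isGroup = record
          { isMonoid = record
            { isSemigroup = record
              { isMagma = record
                { isEquivalence = record
                  { refl  = ℝ-ring.refl , ℝ-ring.refl
                  ; sym   = λ (p , q) → ℝ-ring.sym p , ℝ-ring.sym q
                  ; trans = λ (p , q) (p′ , q′) → ℝ-ring.trans p p′ , ℝ-ring.trans q q′
                  }
                ; ∙-cong = λ (p , q) (p′ , q′) → ℝ-ring.+-cong p p′ , ℝ-ring.+-cong q q′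
                }
              ; assoc = λ x y z → ℝ-ring.+-assoc (re x) (re y) (re z) , ℝ-ring.+-assoc (im x) (im y) (im z)
              }
            ; identity = (λ x → ℝ-ring.+-identityˡ (re x) , ℝ-ring.+-identityˡ (im x)) , (λ x → ℝ-ring.+-identityʳ (re x) , ℝ-ring.+-identityʳ (im x))
            }
          ; inverse = (λ x → ℝ-ring.-‿inverseˡ (re x) , ℝ-ring.-‿inverseˡ (im x)) , (λ x → ℝ-ring.-‿inverseʳ (re x) , ℝ-ring.-‿inverseʳ (im x))
          ; ⁻¹-cong = λ (p , q) → ℝ-ring.-‿cong p , ℝ-ring.-‿cong q
          }
        ; comm = λ x y → ℝ-ring.+-comm (re x) (re y) , ℝ-ring.+-comm (im x) (im y)
        }
      ; *-cong = λ (p , q) (p′ , q′) → ℝ-ring.+-cong (ℝ-ring.*-cong p p′) (ℝ-ring.-‿cong (ℝ-ring.*-cong q q′)) , ℝ-ring.+-cong (ℝ-ring.*-cong p q′) (ℝ-ring.*-cong q p′)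
      ; *-assoc = λ (a +i b) (c +i d) (e +i f) →
          S.solve 6 (λ a b c d e f → (a S.:* c S.:+ S.:- (b S.:* d)) S.:* e S.:+ S.:- ((a S.:* d S.:+ b S.:* c) S.:* f) S.:=
                                     a S.:* (c S.:* e S.:+ S.:- (d S.:* f)) S.:+ S.:- (b S.:* (c S.:* f S.:+ d S.:* e))) ℝ-ring.refl a b c d e f ,
          S.solve 6 (λ a b c d e f → (a S.:* c S.:+ S.:- (b S.:* d)) S.:* f S.:+ (a S.:* d S.:+ b S.:* c) S.:* e S.:=
                                     a S.:* (c S.:* f S.:+ d S.:* e) S.:+ b S.:* (c S.:* e S.:+ S.:- (d S.:* f))) ℝ-ring.refl a b c d e f
      ; *-identity = identityˡ , λ z → ≃ᶜ-trans (*ᶜ-comm z 1ᶜ) (identityˡ z)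
      ; distrib = distribˡ , λ x y z → ≃ᶜ-trans (*ᶜ-comm (y +ᶜ z) x) (≃ᶜ-trans (distribˡ x y z)
                    (ℝ-ring.+-cong (re-≃ (*ᶜ-comm x y)) (re-≃ (*ᶜ-comm x z)) , ℝ-ring.+-cong (im-≃ (*ᶜ-comm x y)) (im-≃ (*ᶜ-comm x z))))
      }
    ; *-comm = *ᶜ-comm
    }
  }
  where
  module S = ℝ-Solver
  ≃ᶜ-trans : ∀ {x y z} → x ≃ᶜ y → y ≃ᶜ z → x ≃ᶜ z
  ≃ᶜ-trans (p , q) (p′ , q′) = ℝ-ring.trans p p′ , ℝ-ring.trans q q′
  *ᶜ-comm : ∀ z w → z *ᶜ w ≃ᶜ w *ᶜ z
  *ᶜ-comm (a +i b) (c +i d) =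
    S.solve 4 (λ a b c d → a S.:* c S.:+ S.:- (b S.:* d) S.:= c S.:* a S.:+ S.:- (d S.:* b)) ℝ-ring.refl a b c d ,
    S.solve 4 (λ a b c d → a S.:* d S.:+ b S.:* c S.:= c S.:* b S.:+ d S.:* a) ℝ-ring.refl a b c d
  identityˡ : ∀ z → 1ᶜ *ᶜ z ≃ᶜ z
  identityˡ (a +i b) =
    S.solve 2 (λ a b → S.con 1ℚ S.:* a S.:+ S.:- (S.con 0ℚ S.:* b) S.:= a) ℝ-ring.refl a b ,
    S.solve 2 (λ a b → S.con 1ℚ S.:* b S.:+ S.con 0ℚ S.:* a S.:= b) ℝ-ring.refl a b
  distribˡ : ∀ x y z → x *ᶜ (y +ᶜ z) ≃ᶜ x *ᶜ y +ᶜ x *ᶜ z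
  distribˡ (a +i b) (c +i d) (e +i f) =
    S.solve 6 (λ a b c d e f → a S.:* (c S.:+ e) S.:+ S.:- (b S.:* (d S.:+ f)) S.:=
                               (a S.:* c S.:+ S.:- (b S.:* d)) S.:+ (a S.:* e S.:+ S.:- (b S.:* f))) ℝ-ring.refl a b c d e f ,
    S.solve 6 (λ a b c d e f → a S.:* (d S.:+ f) S.:+ b S.:* (c S.:+ e) S.:=
                               (a S.:* d S.:+ b S.:* c) S.:+ (a S.:* f S.:+ b S.:* e)) ℝ-ring.refl a b c d e f

module ℂ-ring = CommutativeRing ℂ-commutativeRing
open Mult ℂ-ring.+-commutativeMonoid using (×-distrib-+; ×-congʳ) renaming (_×_ to _×ᶜ_)
open CommutativeSemigroup ℂ-ring.*-commutativeSemigroup using (interchange; x∙yz≈y∙xz; x∙yz≈z∙xy)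
open Sum ℂ-ring.semiring using (sum-cong-≋; ∑-comm; *-distribˡ-sum; sum-replicate; sum-replicate-zero)
open SetoidReasoning ℂ-ring.setoid

module ℂ-Solver = NaturalSolver ℂ-ring.commutativeSemiring

conj-cong : ∀ {z w} → z ≃ᶜ w → conj z ≃ᶜ conj w
conj-cong (p , q) = p , ℝ-ring.-‿cong q

conj-* : ∀ z w → conj (z *ᶜ w) ≃ᶜ conj z *ᶜ conj w
conj-* (a +i b) (c +i d) =
  solve 4 (λ a b c d → a :* c :+ :- (b :* d) := a :* c :+ :- ((:- b) :* (:- d))) ℝ-ring.refl a b c d ,
  solve 4 (λ a b c d → :- (a :* d :+ b :* c) := a :* (:- d) :+ (:- b) :* c) ℝ-ring.refl a b c d
  where open ℝ-Solver

conj-fromℝ : ∀ x → conj (fromℝ x) ≃ᶜ fromℝ x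
conj-fromℝ x = ℝ-ring.refl , ≗⇒≃ λ _ → refl

^ᶜ-+ : ∀ z m n → z ^ᶜ m *ᶜ z ^ᶜ n ≃ᶜ z ^ᶜ (m ℕ.+ n)
^ᶜ-+ z zero    n = ℂ-ring.*-identityˡ _
^ᶜ-+ z (suc m) n = ℂ-ring.trans (ℂ-ring.*-assoc z (z ^ᶜ m) (z ^ᶜ n)) (ℂ-ring.*-congˡ (^ᶜ-+ z m n))

-- Finite sums and orthonormal bases

δ : ∀ {n} → Fin n → Fin n → ℂ
δ zero    zero    = 1ᶜ
δ zero    (suc j) = 0ᶜ
δ (suc i) zero    = 0ᶜ
δ (suc i) (suc j) = δ i j

δ-diagonal : ∀ {n} (i : Fin n) → δ i i ≡ 1ᶜ
δ-diagonal zero    = refl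
δ-diagonal (suc i) = δ-diagonal i

δ-off : ∀ {n} (i j : Fin n) → i ≢ j → δ i j ≡ 0ᶜ
δ-off zero    zero    i≢j = contradiction refl i≢j
δ-off zero    (suc j) i≢j = refl
δ-off (suc i) zero    i≢j = refl
δ-off (suc i) (suc j) i≢j = δ-off i j λ { refl → i≢j refl }

δ-elim : ∀ {n} {M : Fin n → Fin n → ℂ} → (∀ i → M i i ≃ᶜ 1ᶜ) → (∀ i j → i ≢ j → M i j ≃ᶜ 0ᶜ) → ∀ i j → M i j ≃ᶜ δ i j
δ-elim p q zero    zero    = p zero
δ-elim p q zero    (suc j) = q zero (suc j) λ ()
δ-elim p q (suc i) zero    = q (suc i) zero λ ()
δ-elim p q (suc i) (suc j) = δ-elim (λ i → p (suc i)) (λ i j i≢j → q (suc i) (suc j) λ { refl → i≢j refl }) i j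

∑-*0 : ∀ {n} (c : Fin n → ℂ) → ∑ (λ j → c j *ᶜ 0ᶜ) ≃ᶜ 0ᶜ
∑-*0 {n} c = ℂ-ring.trans (sum-cong-≋ λ j → ℂ-ring.zeroʳ (c j)) (sum-replicate-zero n)

∑-δ : ∀ {n} (c : Fin n → ℂ) i → ∑ (λ j → c j *ᶜ δ i j) ≃ᶜ c i
∑-δ c zero    = ℂ-ring.trans (ℂ-ring.+-cong (ℂ-ring.*-identityʳ (c zero)) (∑-*0 (c ∘ suc))) (ℂ-ring.+-identityʳ (c zero))
∑-δ c (suc i) = ℂ-ring.trans (ℂ-ring.+-cong (ℂ-ring.zeroʳ (c zero)) (∑-δ (c ∘ suc) i)) (ℂ-ring.+-identityˡ (c (suc i)))

-- Associativity x (M y) = (x M) y of matrix products, arranged so that the inner sum on the right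
-- becomes a Gram entry.
∑-swap : ∀ {m n} (x : Fin m → ℂ) (M : Fin m → Fin n → ℂ) (y : Fin n → ℂ) →
         ∑ (λ i → x i *ᶜ ∑ (λ j → M i j *ᶜ y j)) ≃ᶜ ∑ (λ j → y j *ᶜ ∑ (λ i → x i *ᶜ M i j))
∑-swap x M y = begin
  ∑ (λ i → x i *ᶜ ∑ (λ j → M i j *ᶜ y j))       ≈⟨ sum-cong-≋ (λ i → *-distribˡ-sum (x i) (λ j → M i j *ᶜ y j)) ⟩
  ∑ (λ i → ∑ (λ j → x i *ᶜ (M i j *ᶜ y j)))     ≈⟨ ∑-comm (λ i j → x i *ᶜ (M i j *ᶜ y j)) ⟩
  ∑ (λ j → ∑ (λ i → x i *ᶜ (M i j *ᶜ y j)))     ≈⟨ sum-cong-≋ (λ j → sum-cong-≋ λ i → x∙yz≈z∙xy (x i) (M i j) (y j)) ⟩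
  ∑ (λ j → ∑ (λ i → y j *ᶜ (x i *ᶜ M i j)))     ≈⟨ sum-cong-≋ (λ j → ℂ-ring.sym (*-distribˡ-sum (y j) (λ i → x i *ᶜ M i j))) ⟩
  ∑ (λ j → y j *ᶜ ∑ (λ i → x i *ᶜ M i j))       ∎

-- The two hypotheses say F*F = I and FF* = I for the matrix F with columns `f i`. The first gives
-- independence, since pairing a combination with `f i` returns its coefficient; the second gives
-- spanning, with the coefficients ⟨f i, v⟩.
orthonormalBasis : ∀ {n} (f : Fin n → ℂ^ n) → (∀ i j → ⟨ f i , f j ⟩ ≃ᶜ δ i j) →
                   (∀ r t → ∑ (λ i → f i r *ᶜ conj (f i t)) ≃ᶜ δ r t) → IsOrthonormalBasis f
orthonormalBasis f orthonormal complete = record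
  { unit        = λ i → ≃ᶜ⇒≈ᶜ (ℂ-ring.trans (orthonormal i i) (ℂ-ring.reflexive (δ-diagonal i)))
  ; orthogonal  = λ i j i≢j → ≃ᶜ⇒≈ᶜ (ℂ-ring.trans (orthonormal i j) (ℂ-ring.reflexive (δ-off i j i≢j)))
  ; independent = λ c cf≈0 i → ≃ᶜ⇒≈ᶜ (begin
      c i                                                  ≈⟨ ∑-δ c i ⟨
      ∑ (λ j → c j *ᶜ δ i j)                               ≈⟨ sum-cong-≋ (λ j → ℂ-ring.*-congˡ {c j} (orthonormal i j)) ⟨
      ∑ (λ j → c j *ᶜ ∑ (λ r → conj (f i r) *ᶜ f j r))     ≈⟨ ∑-swap (λ r → conj (f i r)) (λ r j → f j r) c ⟨
      ∑ (λ r → conj (f i r) *ᶜ ∑ (λ j → f j r *ᶜ c j))     ≈⟨ sum-cong-≋ (λ r → ℂ-ring.*-congˡ {conj (f i r)} (sum-cong-≋ λ j → ℂ-ring.*-comm (f j r) (c j))) ⟩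
      ∑ (λ r → conj (f i r) *ᶜ combination c f r)          ≈⟨ sum-cong-≋ (λ r → ℂ-ring.*-congˡ {conj (f i r)} (≈ᶜ⇒≃ᶜ (cf≈0 r))) ⟩
      ∑ (λ r → conj (f i r) *ᶜ 0ᶜ)                         ≈⟨ ∑-*0 (λ r → conj (f i r)) ⟩
      0ᶜ                                                   ∎)
  ; spanning    = λ v → (λ i → ⟨ f i , v ⟩) , λ r → ≃ᶜ⇒≈ᶜ (begin
      ∑ (λ i → ⟨ f i , v ⟩ *ᶜ f i r)                       ≈⟨ sum-cong-≋ (λ i → ℂ-ring.*-comm ⟨ f i , v ⟩ (f i r)) ⟩
      ∑ (λ i → f i r *ᶜ ∑ (λ t → conj (f i t) *ᶜ v t))     ≈⟨ ∑-swap (λ i → f i r) (λ i t → conj (f i t)) v ⟩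
      ∑ (λ t → v t *ᶜ ∑ (λ i → f i r *ᶜ conj (f i t)))     ≈⟨ sum-cong-≋ (λ t → ℂ-ring.*-congˡ {v t} (complete r t)) ⟩
      ∑ (λ t → v t *ᶜ δ r t)                               ≈⟨ ∑-δ v r ⟩
      v r                                                  ∎)
  }

-- The exponent matrix

residue : ℕ → Fin 3
residue 0                   = 0F
residue 1                   = 1F
residue 2                   = 2F
residue (suc (suc (suc n))) = residue n

indicator : Fin 3 → Fin 3 → ℕ
indicator a b = if does (a ≟ b) then 1 else 0

multiplicity : ∀ {n} → (Fin n → Fin 3) → Fin 3 → ℕ
multiplicity {zero}  e a = 0
multiplicity {suc n} e a = indicator a (e zero) ℕ.+ multiplicity (e ∘ suc) a

exponent : Fin 6 → Fin 6 → ℕ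
exponent r s = toℕ (Vec.lookup (Vec.lookup A r) s)

exponent-symmetric : ∀ r s → exponent r s ≡ exponent s r
exponent-symmetric = from-yes (all? λ r → all? λ s → exponent r s ℕ.≟ exponent s r)

-- Conjugating a cube root of unity negates its exponent, and -1 is 2 modulo 3; hence the exponent
-- of column j is doubled.
difference : Fin 6 → Fin 6 → Fin 6 → Fin 3
difference j k r = residue ((exponent r j ℕ.+ exponent r j) ℕ.+ exponent r k)

difference-diagonal : ∀ j →
  multiplicity (difference j j) 0F ≡ 6 × multiplicity (difference j j) 1F ≡ 0 × multiplicity (difference j j) 2F ≡ 0
difference-diagonal = from-yes (all? λ j →
  (multiplicity (difference j j) 0F ℕ.≟ 6) ×-dec (multiplicity (difference j j) 1F ℕ.≟ 0) ×-dec (multiplicity (difference j j) 2F ℕ.≟ 0))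

difference-balanced : ∀ j k → j ≢ k →
  multiplicity (difference j k) 1F ≡ multiplicity (difference j k) 0F × multiplicity (difference j k) 2F ≡ multiplicity (difference j k) 0F
difference-balanced = from-yes (all? λ j → all? λ k → ¬? (j ≟ k) →-dec
  ((multiplicity (difference j k) 1F ℕ.≟ multiplicity (difference j k) 0F) ×-dec
   (multiplicity (difference j k) 2F ℕ.≟ multiplicity (difference j k) 0F)))

-- With coordinate 0 normalised by `code-0F`, these exponents turn out to be a complete invariant of
-- an entry up to phase.
code : Fin 6 → Fin 6 → Fin 6 → Fin 3
code i j r = residue (exponent r i ℕ.+ exponent r j)

code-0F : ∀ i j → code i j 0F ≡ 0F
code-0F = from-yes (all? λ i → all? λ j → code i j 0F ≟ 0F)

-- The position of the unordered pair {i, j} in the triangular enumeration.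
class : Fin 6 × Fin 6 → Fin 21
class (i , j) = (ℕ.⌊ m ℕ.* suc m /2⌋ ℕ.+ (toℕ i ℕ.⊓ toℕ j)) mod 21
  where m = toℕ i ℕ.⊔ toℕ j

-- Here the entries of `A` enter the count: the check over all quadruples shows that distinct
-- unordered pairs have distinct exponent vectors.
code⇒class : ∀ i j k l → (∀ r → code i j r ≡ code k l r) → class (i , j) ≡ class (k , l)
code⇒class = from-yes (all? λ i → all? λ j → all? λ k → all? λ l →
  all? (λ r → code i j r ≟ code k l r) →-dec class (i , j) ≟ class (k , l))

-- The reduction modulo 21 in `class` merges nothing, since the largest value before it is 15 + 5 =
-- 20.
class-injective : ∀ i j k l → class (i , j) ≡ class (k , l) → (i ≡ k × j ≡ l) ⊎ (i ≡ l × j ≡ k)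
class-injective = from-yes (all? λ i → all? λ j → all? λ k → all? λ l →
  class (i , j) ≟ class (k , l) →-dec ((i ≟ k ×-dec j ≟ l) ⊎-dec (i ≟ l ×-dec j ≟ k)))

class-surjective : ∀ y → ∃ λ i → ∃ λ j → class (i , j) ≡ y
class-surjective = from-yes (all? λ y → any? λ i → any? λ j → class (i , j) ≟ y)

1ᶜ+1ᶜ+1ᶜ≄0 : ¬ (1ᶜ +ᶜ 1ᶜ) +ᶜ 1ᶜ ≃ᶜ 0ᶜ
1ᶜ+1ᶜ+1ᶜ≄0 (p , _) with unwrap p 1ℚ 0<1
-- At tolerance 1 the assumption amounts to 3 ≤ 1.
... | N , q with ℚ.*≤* (ℤ.+≤+ (ℕ.s≤s ())) ← q N ℕ.≤-refl

-- Roots of unity and the array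

module CubeRootOfUnity (ω : ℂ) (1+ω+ω²≃0 : (1ᶜ +ᶜ ω) +ᶜ ω *ᶜ ω ≃ᶜ 0ᶜ) (conj-ω : conj ω ≃ᶜ ω *ᶜ ω) where

  open ℂ-Solver

  -- A form of ω³ - 1 = (ω - 1)(1 + ω + ω²) without subtraction, suited to a solver over a semiring:
  -- the vanishing sum is added to ω³ and split off again with the factor ω.
  ω³≃1 : ω *ᶜ (ω *ᶜ ω) ≃ᶜ 1ᶜ
  ω³≃1 = begin
    ω *ᶜ (ω *ᶜ ω)                                  ≈⟨ ℂ-ring.+-identityʳ _ ⟨
    ω *ᶜ (ω *ᶜ ω) +ᶜ 0ᶜ                            ≈⟨ ℂ-ring.+-congˡ 1+ω+ω²≃0 ⟨
    ω *ᶜ (ω *ᶜ ω) +ᶜ ((1ᶜ +ᶜ ω) +ᶜ ω *ᶜ ω)         ≈⟨ solve 1 (λ w → w :* (w :* w) :+ ((con 1 :+ w) :+ w :* w) :=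
                                                        con 1 :+ w :* ((con 1 :+ w) :+ w :* w)) ℂ-ring.refl ω ⟩
    1ᶜ +ᶜ ω *ᶜ ((1ᶜ +ᶜ ω) +ᶜ ω *ᶜ ω)               ≈⟨ ℂ-ring.+-congˡ (ℂ-ring.*-congˡ 1+ω+ω²≃0) ⟩
    1ᶜ +ᶜ ω *ᶜ 0ᶜ                                  ≈⟨ ℂ-ring.+-congˡ (ℂ-ring.zeroʳ ω) ⟩
    1ᶜ +ᶜ 0ᶜ                                       ≈⟨ ℂ-ring.+-identityʳ 1ᶜ ⟩
    1ᶜ                                             ∎

  ζ : Fin 3 → ℂ
  ζ a = ω ^ᶜ toℕ a

  ^ᶜ-residue : ∀ n → ω ^ᶜ n ≃ᶜ ζ (residue n)
  ^ᶜ-residue 0                   = ℂ-ring.refl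
  ^ᶜ-residue 1                   = ℂ-ring.refl
  ^ᶜ-residue 2                   = ℂ-ring.refl
  ^ᶜ-residue (suc (suc (suc n))) = begin
    ω *ᶜ (ω *ᶜ (ω *ᶜ ω ^ᶜ n))    ≈⟨ solve 2 (λ w z → w :* (w :* (w :* z)) := (w :* (w :* w)) :* z) ℂ-ring.refl ω (ω ^ᶜ n) ⟩
    ω *ᶜ (ω *ᶜ ω) *ᶜ ω ^ᶜ n      ≈⟨ ℂ-ring.*-congʳ ω³≃1 ⟩
    1ᶜ *ᶜ ω ^ᶜ n                 ≈⟨ ℂ-ring.*-identityˡ _ ⟩
    ω ^ᶜ n                       ≈⟨ ^ᶜ-residue n ⟩
    ζ (residue n)                ∎

  conj-^ᶜ : ∀ n → conj (ω ^ᶜ n) ≃ᶜ ω ^ᶜ (n ℕ.+ n)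
  conj-^ᶜ zero    = conj-fromℝ 1ℝ
  conj-^ᶜ (suc n) = begin
    conj (ω *ᶜ ω ^ᶜ n)             ≈⟨ conj-* ω (ω ^ᶜ n) ⟩
    conj ω *ᶜ conj (ω ^ᶜ n)        ≈⟨ ℂ-ring.*-cong conj-ω (conj-^ᶜ n) ⟩
    ω *ᶜ ω *ᶜ ω ^ᶜ (n ℕ.+ n)       ≈⟨ ℂ-ring.*-assoc ω ω (ω ^ᶜ (n ℕ.+ n)) ⟩
    ω ^ᶜ suc (suc (n ℕ.+ n))       ≡⟨ cong (λ m → ω ^ᶜ suc m) (sym (ℕ.+-suc n n)) ⟩
    ω ^ᶜ (suc n ℕ.+ suc n)         ∎

  conj*^ᶜ : ∀ m n → conj (ω ^ᶜ m) *ᶜ ω ^ᶜ n ≃ᶜ ζ (residue ((m ℕ.+ m) ℕ.+ n))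
  conj*^ᶜ m n = begin
    conj (ω ^ᶜ m) *ᶜ ω ^ᶜ n            ≈⟨ ℂ-ring.*-congʳ (conj-^ᶜ m) ⟩
    ω ^ᶜ (m ℕ.+ m) *ᶜ ω ^ᶜ n           ≈⟨ ^ᶜ-+ ω (m ℕ.+ m) n ⟩
    ω ^ᶜ ((m ℕ.+ m) ℕ.+ n)             ≈⟨ ^ᶜ-residue ((m ℕ.+ m) ℕ.+ n) ⟩
    ζ (residue ((m ℕ.+ m) ℕ.+ n))      ∎

  ∣^ᶜ∣²≃1 : ∀ n → conj (ω ^ᶜ n) *ᶜ ω ^ᶜ n ≃ᶜ 1ᶜ
  ∣^ᶜ∣²≃1 n = ℂ-ring.trans (conj*^ᶜ n n) (ℂ-ring.reflexive (cong ζ (residue-3n n)))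
    where
    residue-3n : ∀ n → residue ((n ℕ.+ n) ℕ.+ n) ≡ 0F
    residue-3n zero    = refl
    residue-3n (suc n) = trans (cong residue (trans (cong (ℕ._+ suc n) (ℕ.+-suc (suc n) n)) (ℕ.+-suc (suc (suc (n ℕ.+ n))) n))) (residue-3n n)

  ω≄1 : ¬ ω ≃ᶜ 1ᶜ
  ω≄1 ω≃1 = 1ᶜ+1ᶜ+1ᶜ≄0 (begin
    (1ᶜ +ᶜ 1ᶜ) +ᶜ 1ᶜ           ≈⟨ ℂ-ring.+-congˡ (ℂ-ring.*-identityˡ 1ᶜ) ⟨
    (1ᶜ +ᶜ 1ᶜ) +ᶜ 1ᶜ *ᶜ 1ᶜ     ≈⟨ ℂ-ring.+-cong (ℂ-ring.+-congˡ ω≃1) (ℂ-ring.*-cong ω≃1 ω≃1) ⟨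
    (1ᶜ +ᶜ ω) +ᶜ ω *ᶜ ω        ≈⟨ 1+ω+ω²≃0 ⟩
    0ᶜ                         ∎)

  ω²≄1 : ¬ ω *ᶜ ω ≃ᶜ 1ᶜ
  ω²≄1 ω²≃1 = ω≄1 (begin
    ω                    ≈⟨ ℂ-ring.*-identityʳ ω ⟨
    ω *ᶜ 1ᶜ              ≈⟨ ℂ-ring.*-congˡ ω²≃1 ⟨
    ω *ᶜ (ω *ᶜ ω)        ≈⟨ ω³≃1 ⟩
    1ᶜ                   ∎)

  ω²≄ω : ¬ ω *ᶜ ω ≃ᶜ ω
  ω²≄ω ω²≃ω = ω²≄1 (begin
    ω *ᶜ ω               ≈⟨ ℂ-ring.*-congˡ ω²≃ω ⟨
    ω *ᶜ (ω *ᶜ ω)        ≈⟨ ω³≃1 ⟩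
    1ᶜ                   ∎)

  ζ1≃ω : ζ 1F ≃ᶜ ω
  ζ1≃ω = ℂ-ring.*-identityʳ ω

  ζ2≃ω² : ζ 2F ≃ᶜ ω *ᶜ ω
  ζ2≃ω² = ℂ-ring.*-congˡ ζ1≃ω

  ζ-injective : ∀ {a b} → ζ a ≃ᶜ ζ b → a ≡ b
  ζ-injective {0F} {0F} _ = refl
  ζ-injective {1F} {1F} _ = refl
  ζ-injective {2F} {2F} _ = refl
  ζ-injective {0F} {1F} p = contradiction (ℂ-ring.trans (ℂ-ring.sym ζ1≃ω) (ℂ-ring.sym p)) ω≄1
  ζ-injective {1F} {0F} p = contradiction (ℂ-ring.trans (ℂ-ring.sym ζ1≃ω) p) ω≄1
  ζ-injective {0F} {2F} p = contradiction (ℂ-ring.trans (ℂ-ring.sym ζ2≃ω²) (ℂ-ring.sym p)) ω²≄1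
  ζ-injective {2F} {0F} p = contradiction (ℂ-ring.trans (ℂ-ring.sym ζ2≃ω²) p) ω²≄1
  ζ-injective {1F} {2F} p = contradiction (ℂ-ring.trans (ℂ-ring.sym ζ2≃ω²) (ℂ-ring.trans (ℂ-ring.sym p) ζ1≃ω)) ω²≄ω
  ζ-injective {2F} {1F} p = contradiction (ℂ-ring.trans (ℂ-ring.sym ζ2≃ω²) (ℂ-ring.trans p ζ1≃ω)) ω²≄ω

  ζ-combination : (Fin 3 → ℕ) → ℂ
  ζ-combination m = (m 0F ×ᶜ ζ 0F +ᶜ m 1F ×ᶜ ζ 1F) +ᶜ m 2F ×ᶜ ζ 2F

  ∑ζ : ∀ {n} (e : Fin n → Fin 3) → ∑ (ζ ∘ e) ≃ᶜ ζ-combination (multiplicity e)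
  ∑ζ {zero}  e = ℂ-ring.sym (ℂ-ring.trans (ℂ-ring.+-identityʳ _) (ℂ-ring.+-identityʳ _))
  ∑ζ {suc n} e = ℂ-ring.trans (ℂ-ring.+-congˡ (∑ζ (e ∘ suc))) (insert (e zero) (multiplicity (e ∘ suc)))
    where
    insert : ∀ a m → ζ a +ᶜ ζ-combination m ≃ᶜ ζ-combination (λ b → indicator b a ℕ.+ m b)
    insert 0F m = solve 4 (λ z a b c → z :+ ((a :+ b) :+ c) := ((z :+ a) :+ b) :+ c) ℂ-ring.refl
      (ζ 0F) (m 0F ×ᶜ ζ 0F) (m 1F ×ᶜ ζ 1F) (m 2F ×ᶜ ζ 2F)
    insert 1F m = solve 4 (λ z a b c → z :+ ((a :+ b) :+ c) := (a :+ (z :+ b)) :+ c) ℂ-ring.refl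
      (ζ 1F) (m 0F ×ᶜ ζ 0F) (m 1F ×ᶜ ζ 1F) (m 2F ×ᶜ ζ 2F)
    insert 2F m = solve 4 (λ z a b c → z :+ ((a :+ b) :+ c) := (a :+ b) :+ (z :+ c)) ℂ-ring.refl
      (ζ 2F) (m 0F ×ᶜ ζ 0F) (m 1F ×ᶜ ζ 1F) (m 2F ×ᶜ ζ 2F)

  ∑ζ-balanced : ∀ {n} (e : Fin n → Fin 3) → multiplicity e 1F ≡ multiplicity e 0F → multiplicity e 2F ≡ multiplicity e 0F →
                ∑ (ζ ∘ e) ≃ᶜ 0ᶜ
  ∑ζ-balanced e p q = begin
    ∑ (ζ ∘ e)                                                    ≈⟨ ∑ζ e ⟩
    ζ-combination (multiplicity e)                               ≡⟨ cong₂ (λ l m → (k ×ᶜ 1ᶜ +ᶜ l ×ᶜ ζ 1F) +ᶜ m ×ᶜ ζ 2F) p q ⟩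
    (k ×ᶜ 1ᶜ +ᶜ k ×ᶜ ζ 1F) +ᶜ k ×ᶜ ζ 2F                          ≈⟨ ℂ-ring.+-cong (ℂ-ring.+-congˡ (×-congʳ k ζ1≃ω)) (×-congʳ k ζ2≃ω²) ⟩
    (k ×ᶜ 1ᶜ +ᶜ k ×ᶜ ω) +ᶜ k ×ᶜ (ω *ᶜ ω)                         ≈⟨ ℂ-ring.+-congʳ (×-distrib-+ 1ᶜ ω k) ⟨
    k ×ᶜ (1ᶜ +ᶜ ω) +ᶜ k ×ᶜ (ω *ᶜ ω)                              ≈⟨ ×-distrib-+ (1ᶜ +ᶜ ω) (ω *ᶜ ω) k ⟨
    k ×ᶜ ((1ᶜ +ᶜ ω) +ᶜ ω *ᶜ ω)                                   ≈⟨ ×-congʳ k 1+ω+ω²≃0 ⟩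
    k ×ᶜ 0ᶜ                                                      ≈⟨ sum-replicate k ⟨
    ∑ {k} (λ _ → 0ᶜ)                                             ≈⟨ sum-replicate-zero k ⟩
    0ᶜ                                                           ∎
    where k = multiplicity e 0F

-- Spelled out as a sum, the factor 6 is a polynomial for the semiring solver.
6× : ℂ → ℂ
6× z = z +ᶜ (z +ᶜ (z +ᶜ (z +ᶜ (z +ᶜ z))))

6×-*ʳ : ∀ q d → q *ᶜ 6× d ≃ᶜ 6× q *ᶜ d
6×-*ʳ = solve 2 (λ q d → q :* (d :+ (d :+ (d :+ (d :+ (d :+ d))))) := (q :+ (q :+ (q :+ (q :+ (q :+ q))))) :* d) ℂ-ring.refl
  where open ℂ-Solver

6×-*ˡ : ∀ q d → q *ᶜ 6× d ≃ᶜ 6× (q *ᶜ d)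
6×-*ˡ = solve 2 (λ q d → q :* (d :+ (d :+ (d :+ (d :+ (d :+ d))))) := q :* d :+ (q :* d :+ (q :* d :+ (q :* d :+ (q :* d :+ q :* d))))) ℂ-ring.refl
  where open ℂ-Solver

6×-× : ∀ z → (6 ×ᶜ z +ᶜ 0ᶜ) +ᶜ 0ᶜ ≃ᶜ 6× z
6×-× = solve 1 (λ z → ((z :+ (z :+ (z :+ (z :+ (z :+ (z :+ con 0)))))) :+ con 0) :+ con 0 :=
                       z :+ (z :+ (z :+ (z :+ (z :+ z))))) ℂ-ring.refl
  where open ℂ-Solver

regroup : ∀ κ x y z w → κ *ᶜ (x *ᶜ y) *ᶜ (κ *ᶜ (z *ᶜ w)) ≃ᶜ κ *ᶜ κ *ᶜ ((x *ᶜ z) *ᶜ (y *ᶜ w))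
regroup κ x y z w = ℂ-ring.trans (interchange κ (x *ᶜ y) κ (z *ᶜ w)) (ℂ-ring.*-congˡ (interchange x y z w))

expi-0 : expi 0ℝ ≃ᶜ 1ᶜ
expi-0 = series-0 cosCoefficient ∣cosCoefficient∣≤1 , series-0 sinCoefficient ∣sinCoefficient∣≤1

-- α is kept variable: for the closed phase 0ℝ the type checker would evaluate the
-- power series of expi.
∼-trivialPhase : ∀ {n} α → expi α ≃ᶜ 1ᶜ → {u v : ℂ^ n} → (∀ r → u r ≃ᶜ v r) → u ∼ v
∼-trivialPhase α e^iα≃1 {u} {v} p = α , λ r → ≃ᶜ⇒≈ᶜ (begin
  u r                    ≈⟨ p r ⟩
  v r                    ≈⟨ ℂ-ring.*-identityˡ (v r) ⟨
  1ᶜ *ᶜ v r              ≈⟨ ℂ-ring.*-congʳ e^iα≃1 ⟨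
  expi α *ᶜ v r          ∎)

≃⇒∼ : ∀ {n} {u v : ℂ^ n} → (∀ r → u r ≃ᶜ v r) → u ∼ v
≃⇒∼ = ∼-trivialPhase 0ℝ expi-0

-- The construction for any real k with 6k² = 1 and any primitive cube root of unity ω. Everything
-- about π, the power series and the square root is condensed into the three hypotheses.
module Array (k : ℝ) (6k²≃1 : 6× (fromℝ k *ᶜ fromℝ k) ≃ᶜ 1ᶜ)
             (ω : ℂ) (1+ω+ω²≃0 : (1ᶜ +ᶜ ω) +ᶜ ω *ᶜ ω ≃ᶜ 0ᶜ) (conj-ω : conj ω ≃ᶜ ω *ᶜ ω) where

  open CubeRootOfUnity ω 1+ω+ω²≃0 conj-ω

  κ : ℂ
  κ = fromℝ k

  H : Fin 6 → Fin 6 → ℂ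
  H r s = ω ^ᶜ exponent r s

  h : Fin 6 → ℂ^ 6
  h s r = H r s

  Φ : SquareArray 6
  Φ i j = κ · (h i ⊙ h j)

  H-symmetric : ∀ r s → H r s ≡ H s r
  H-symmetric r s = cong (ω ^ᶜ_) (exponent-symmetric r s)

  H-gram : ∀ j k → ∑ (λ r → conj (H r j) *ᶜ H r k) ≃ᶜ 6× (δ j k)
  H-gram j k = ℂ-ring.trans (sum-cong-≋ λ r → conj*^ᶜ (exponent r j) (exponent r k)) (go j k (j ≟ k))
    where
    6×0≃0 : 6× 0ᶜ ≃ᶜ 0ᶜ
    6×0≃0 = ℂ-ring.trans (ℂ-ring.sym (ℂ-ring.*-identityˡ _)) (ℂ-ring.trans (6×-*ʳ 1ᶜ 0ᶜ) (ℂ-ring.zeroʳ (6× 1ᶜ)))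
    go : ∀ j k → Dec (j ≡ k) → ∑ (ζ ∘ difference j k) ≃ᶜ 6× (δ j k)
    go j k  (no j≢k)   = let p , q = difference-balanced j k j≢k in
      ℂ-ring.trans (∑ζ-balanced (difference j k) p q)
        (ℂ-ring.trans (ℂ-ring.sym 6×0≃0) (ℂ-ring.reflexive (cong 6× (sym (δ-off j k j≢k)))))
    go j .j (yes refl) = let p , q , r = difference-diagonal j in begin
      ∑ (ζ ∘ difference j j)                             ≈⟨ ∑ζ (difference j j) ⟩
      ζ-combination (multiplicity (difference j j))      ≡⟨ cong₂ _+ᶜ_ (cong₂ (λ l m → l ×ᶜ ζ 0F +ᶜ m ×ᶜ ζ 1F) p q) (cong (_×ᶜ ζ 2F) r) ⟩
      (6 ×ᶜ 1ᶜ +ᶜ 0ᶜ) +ᶜ 0ᶜ                              ≈⟨ 6×-× 1ᶜ ⟩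
      6× 1ᶜ                                              ≡⟨ cong 6× (sym (δ-diagonal j)) ⟩
      6× (δ j j)                                         ∎

  κ²6× : ∀ z → κ *ᶜ κ *ᶜ 6× z ≃ᶜ z
  κ²6× z = begin
    κ *ᶜ κ *ᶜ 6× z       ≈⟨ 6×-*ʳ (κ *ᶜ κ) z ⟩
    6× (κ *ᶜ κ) *ᶜ z     ≈⟨ ℂ-ring.*-congʳ 6k²≃1 ⟩
    1ᶜ *ᶜ z              ≈⟨ ℂ-ring.*-identityˡ z ⟩
    z                    ∎

  κ²H-gram : ∀ j k → ∑ (λ r → κ *ᶜ κ *ᶜ (conj (H r j) *ᶜ H r k)) ≃ᶜ δ j k
  κ²H-gram j k = begin
    ∑ (λ r → κ *ᶜ κ *ᶜ (conj (H r j) *ᶜ H r k))               ≈⟨ *-distribˡ-sum (κ *ᶜ κ) (λ r → conj (H r j) *ᶜ H r k) ⟨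
    κ *ᶜ κ *ᶜ ∑ (λ r → conj (H r j) *ᶜ H r k)                 ≈⟨ ℂ-ring.*-congˡ (H-gram j k) ⟩
    κ *ᶜ κ *ᶜ 6× (δ j k)                                      ≈⟨ κ²6× (δ j k) ⟩
    δ j k                                                     ∎

  conj-κ** : ∀ x y → conj (κ *ᶜ (x *ᶜ y)) ≃ᶜ κ *ᶜ (conj x *ᶜ conj y)
  conj-κ** x y = ℂ-ring.trans (conj-* κ (x *ᶜ y)) (ℂ-ring.*-cong (conj-fromℝ k) (conj-* x y))

  -- Each line of the array is the unitary matrix κH with its rows multiplied by the entries of
  -- column s, which have modulus 1. The hypothesis on `f` holds only up to `≃ᶜ` so that it covers
  -- both rows and columns.
  basis : (s : Fin 6) (f : Fin 6 → ℂ^ 6) → (∀ j r → f j r ≃ᶜ κ *ᶜ (H r s *ᶜ H r j)) → IsOrthonormalBasis f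
  basis s f f≃ = orthonormalBasis f orthonormal complete
    where
    orthonormal : ∀ i j → ⟨ f i , f j ⟩ ≃ᶜ δ i j
    orthonormal i j = begin
      ∑ (λ r → conj (f i r) *ᶜ f j r)                           ≈⟨ sum-cong-≋ (λ r → term r) ⟩
      ∑ (λ r → κ *ᶜ κ *ᶜ (conj (H r i) *ᶜ H r j))               ≈⟨ κ²H-gram i j ⟩
      δ i j                                                     ∎
      where
      term : ∀ r → conj (f i r) *ᶜ f j r ≃ᶜ κ *ᶜ κ *ᶜ (conj (H r i) *ᶜ H r j)
      term r = begin
        conj (f i r) *ᶜ f j r
          ≈⟨ ℂ-ring.*-cong (ℂ-ring.trans (conj-cong (f≃ i r)) (conj-κ** (H r s) (H r i))) (f≃ j r) ⟩
        κ *ᶜ (conj (H r s) *ᶜ conj (H r i)) *ᶜ (κ *ᶜ (H r s *ᶜ H r j))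
          ≈⟨ regroup κ (conj (H r s)) (conj (H r i)) (H r s) (H r j) ⟩
        κ *ᶜ κ *ᶜ ((conj (H r s) *ᶜ H r s) *ᶜ (conj (H r i) *ᶜ H r j))
          ≈⟨ ℂ-ring.*-congˡ (ℂ-ring.trans (ℂ-ring.*-congʳ (∣^ᶜ∣²≃1 (exponent r s))) (ℂ-ring.*-identityˡ _)) ⟩
        κ *ᶜ κ *ᶜ (conj (H r i) *ᶜ H r j) ∎

    complete : ∀ r t → ∑ (λ i → f i r *ᶜ conj (f i t)) ≃ᶜ δ r t
    complete r t = begin
      ∑ (λ i → f i r *ᶜ conj (f i t))                           ≈⟨ sum-cong-≋ (λ i → term i) ⟩
      ∑ (λ i → x *ᶜ (κ *ᶜ κ *ᶜ (conj (H i t) *ᶜ H i r)))        ≈⟨ *-distribˡ-sum x (λ i → κ *ᶜ κ *ᶜ (conj (H i t) *ᶜ H i r)) ⟨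
      x *ᶜ ∑ (λ i → κ *ᶜ κ *ᶜ (conj (H i t) *ᶜ H i r))          ≈⟨ ℂ-ring.*-congˡ (κ²H-gram t r) ⟩
      x *ᶜ δ t r                                                ≈⟨ x*δ r t ⟩
      δ r t                                                     ∎
      where
      x = conj (H t s) *ᶜ H r s
      -- The phase x can differ from 1 only off the diagonal, where δ vanishes; on it, x is |H r s|²
      -- = 1.
      x*δ : ∀ r t → conj (H t s) *ᶜ H r s *ᶜ δ t r ≃ᶜ δ r t
      x*δ = δ-elim
        (λ r → ℂ-ring.trans (ℂ-ring.*-cong (∣^ᶜ∣²≃1 (exponent r s)) (ℂ-ring.reflexive (δ-diagonal r))) (ℂ-ring.*-identityˡ 1ᶜ))
        (λ r t r≢t → ℂ-ring.trans (ℂ-ring.*-congˡ (ℂ-ring.reflexive (δ-off t r (r≢t ∘ sym)))) (ℂ-ring.zeroʳ _))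
      term : ∀ i → f i r *ᶜ conj (f i t) ≃ᶜ x *ᶜ (κ *ᶜ κ *ᶜ (conj (H i t) *ᶜ H i r))
      term i = begin
        f i r *ᶜ conj (f i t)
          ≈⟨ ℂ-ring.*-comm (f i r) (conj (f i t)) ⟩
        conj (f i t) *ᶜ f i r
          ≈⟨ ℂ-ring.*-cong (ℂ-ring.trans (conj-cong (f≃ i t)) (conj-κ** (H t s) (H t i))) (f≃ i r) ⟩
        κ *ᶜ (conj (H t s) *ᶜ conj (H t i)) *ᶜ (κ *ᶜ (H r s *ᶜ H r i))
          ≈⟨ regroup κ (conj (H t s)) (conj (H t i)) (H r s) (H r i) ⟩
        κ *ᶜ κ *ᶜ (x *ᶜ (conj (H t i) *ᶜ H r i))
          ≈⟨ x∙yz≈y∙xz (κ *ᶜ κ) x (conj (H t i) *ᶜ H r i) ⟩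
        x *ᶜ (κ *ᶜ κ *ᶜ (conj (H t i) *ᶜ H r i))
          -- Completeness sums over the column index i; the symmetry of H moves i to the row
          -- position, where `κ²H-gram` applies.
          ≡⟨ cong₂ (λ y z → x *ᶜ (κ *ᶜ κ *ᶜ (conj y *ᶜ z))) (H-symmetric t i) (H-symmetric r i) ⟩
        x *ᶜ (κ *ᶜ κ *ᶜ (conj (H i t) *ᶜ H i r)) ∎

  Φ-comm : ∀ i j r → Φ i j r ≃ᶜ Φ j i r
  Φ-comm i j r = ℂ-ring.*-congˡ (ℂ-ring.*-comm (H r i) (H r j))

  rows : ∀ i → IsOrthonormalBasis (λ j → Φ i j)
  rows i = basis i (λ j → Φ i j) λ j r → ℂ-ring.refl

  columns : ∀ j → IsOrthonormalBasis (λ i → Φ i j)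
  columns j = basis j (λ i → Φ i j) λ i → Φ-comm i j

  isQLS : IsQLS Φ
  isQLS = record
    { unit    = λ i j → IsOrthonormalBasis.unit (rows i) j
    ; rows    = rows
    ; columns = columns
    }

  Φ-code : ∀ i j r → Φ i j r ≃ᶜ κ *ᶜ ζ (code i j r)
  Φ-code i j r = ℂ-ring.*-congˡ (ℂ-ring.trans (^ᶜ-+ ω (exponent r i) (exponent r j)) (^ᶜ-residue (exponent r i ℕ.+ exponent r j)))

  κ-inverse : κ *ᶜ 6× κ ≃ᶜ 1ᶜ
  κ-inverse = ℂ-ring.trans (6×-*ˡ κ κ) 6k²≃1

  κ-cancel : ∀ {z w} → κ *ᶜ z ≃ᶜ κ *ᶜ w → z ≃ᶜ w
  κ-cancel {z} {w} κz≃κw = begin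
    z                        ≈⟨ unscale z ⟨
    κ *ᶜ z *ᶜ 6× κ           ≈⟨ ℂ-ring.*-congʳ κz≃κw ⟩
    κ *ᶜ w *ᶜ 6× κ           ≈⟨ unscale w ⟩
    w                        ∎
    where
    unscale : ∀ z → κ *ᶜ z *ᶜ 6× κ ≃ᶜ z
    unscale z = begin
      κ *ᶜ z *ᶜ 6× κ         ≈⟨ ℂ-ring.*-congʳ (ℂ-ring.*-comm κ z) ⟩
      z *ᶜ κ *ᶜ 6× κ         ≈⟨ ℂ-ring.*-assoc z κ (6× κ) ⟩
      z *ᶜ (κ *ᶜ 6× κ)       ≈⟨ ℂ-ring.*-congˡ κ-inverse ⟩
      z *ᶜ 1ᶜ                ≈⟨ ℂ-ring.*-identityʳ z ⟩
      z                      ∎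

  -- The coordinate 0 of every entry is κ, so a phase relating two entries is 1.
  proportional⇒code : ∀ i j k l e → (∀ r → Φ i j r ≃ᶜ e *ᶜ Φ k l r) → ∀ r → code i j r ≡ code k l r
  proportional⇒code i j k l e p r = ζ-injective (begin
    ζ (code i j r)           ≈⟨ scaled r ⟩
    e *ᶜ ζ (code k l r)      ≈⟨ ℂ-ring.*-congʳ e≃1 ⟩
    1ᶜ *ᶜ ζ (code k l r)     ≈⟨ ℂ-ring.*-identityˡ _ ⟩
    ζ (code k l r)           ∎)
    where
    scaled : ∀ r → ζ (code i j r) ≃ᶜ e *ᶜ ζ (code k l r)
    scaled r = κ-cancel (begin
      κ *ᶜ ζ (code i j r)              ≈⟨ Φ-code i j r ⟨
      Φ i j r                          ≈⟨ p r ⟩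
      e *ᶜ Φ k l r                     ≈⟨ ℂ-ring.*-congˡ (Φ-code k l r) ⟩
      e *ᶜ (κ *ᶜ ζ (code k l r))       ≈⟨ x∙yz≈y∙xz e κ (ζ (code k l r)) ⟩
      κ *ᶜ (e *ᶜ ζ (code k l r))       ∎)
    e≃1 : e ≃ᶜ 1ᶜ
    e≃1 = begin
      e                        ≈⟨ ℂ-ring.*-identityʳ e ⟨
      e *ᶜ 1ᶜ                  ≡⟨ cong (λ a → e *ᶜ ζ a) (sym (code-0F k l)) ⟩
      e *ᶜ ζ (code k l 0F)     ≈⟨ scaled 0F ⟨
      ζ (code i j 0F)          ≡⟨ cong ζ (code-0F i j) ⟩
      1ᶜ                       ∎

  hasCardinality : HasCardinality Φ 21
  hasCardinality = class , congruent , injective , surjective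
    where
    congruent : ∀ {p q} → Φ (proj₁ p) (proj₂ p) ∼ Φ (proj₁ q) (proj₂ q) → class p ≡ class q
    congruent {i , j} {k , l} (α , p) =
      code⇒class i j k l (proportional⇒code i j k l (expi α) λ r → ≈ᶜ⇒≃ᶜ (p r))
    same-or-swapped⇒∼ : ∀ {i j k l} → (i ≡ k × j ≡ l) ⊎ (i ≡ l × j ≡ k) → Φ i j ∼ Φ k l
    same-or-swapped⇒∼ {i} {j} (inj₁ (refl , refl)) = ≃⇒∼ {u = Φ i j} {Φ i j} λ r → ℂ-ring.refl
    same-or-swapped⇒∼ {i} {j} (inj₂ (refl , refl)) = ≃⇒∼ {u = Φ i j} {Φ j i} (Φ-comm i j)
    injective : ∀ {p q} → class p ≡ class q → Φ (proj₁ p) (proj₂ p) ∼ Φ (proj₁ q) (proj₂ q)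
    injective {i , j} {k , l} p = same-or-swapped⇒∼ (class-injective i j k l p)
    surjective : ∀ y → ∃ λ p → ∀ {q} → Φ (proj₁ q) (proj₂ q) ∼ Φ (proj₁ p) (proj₂ p) → class q ≡ y
    surjective y = let i , j , class≡y = class-surjective y in
      (i , j) , λ {q} q∼p → trans (congruent {q} {i , j} q∼p) class≡y

-- The angle 2π/3 and its cube root of unity

module TwoThirdsPi (π : ℝ) (isPi : IsPi π) where

  open IsPi isPi

  θ : ℝ
  θ = fromℚ (+ 2 ℚ./ 3) * π

  0<θ : 0ℝ < θ
  0<θ = let ε , 0<ε , N , ε≤π = 0<π in
    (+ 2 ℚ./ 3) ℚ.* ε , 0<* (ℚ.positive⁻¹ (+ 2 ℚ./ 3)) 0<ε , N , λ n N≤n →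
      subst (ℚ._≤ (+ 2 ℚ./ 3) ℚ.* seq π n)
        (solve 2 (λ q ε → q :* (con 0ℚ :+ ε) := con 0ℚ :+ q :* ε) refl (+ 2 ℚ./ 3) ε)
        (ℚ.*-monoˡ-≤-nonNeg (+ 2 ℚ./ 3) (ε≤π n N≤n))
    where open +-*-Solver

  θ<π : θ < π
  θ<π = let ε , 0<ε , N , ε≤π = 0<π in
    -- The gap π - θ is π/3, which is eventually at least ε/3.
    (+ 1 ℚ./ 3) ℚ.* ε , 0<* (ℚ.positive⁻¹ (+ 1 ℚ./ 3)) 0<ε , N , λ n N≤n →
      subst ((+ 2 ℚ./ 3) ℚ.* seq π n ℚ.+ (+ 1 ℚ./ 3) ℚ.* ε ℚ.≤_)
        (solve 1 (λ p → con (+ 2 ℚ./ 3) :* p :+ con (+ 1 ℚ./ 3) :* p := p) refl (seq π n))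
        (ℚ.+-monoʳ-≤ ((+ 2 ℚ./ 3) ℚ.* seq π n) (ℚ.*-monoˡ-≤-nonNeg (+ 1 ℚ./ 3)
          (subst (ℚ._≤ seq π n) (ℚ.+-identityˡ ε) (ε≤π n N≤n))))
    where open +-*-Solver

  3θ≗2π : θ + (θ + θ) ≗ʳ π + π
  3θ≗2π n = solve 1 (λ p → con (+ 2 ℚ./ 3) :* p :+ (con (+ 2 ℚ./ 3) :* p :+ con (+ 2 ℚ./ 3) :* p) := p :+ p) refl (seq π n)
    where open +-*-Solver

  -- The addition formulas expand the cosine and sine of θ + (θ + θ) and of π + π, which agree
  -- entrywise: the cube of e^{iθ} is the square of e^{iπ}.
  open CubeRoot (cos θ) (sin θ) (cos π) (sin π) (cos²+sin²≃1 θ) (cos²+sin²≃1 π) (wrap sin[π]≈0)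
    (ℝ-ring.trans
      (ℝ-ring.sym (ℝ-ring.trans (cos-+ θ (θ + θ))
        (ℝ-ring.+-cong (ℝ-ring.*-congˡ (cos-+ θ θ)) (ℝ-ring.-‿cong (ℝ-ring.*-congˡ (sin-+ θ θ))))))
      (ℝ-ring.trans (series-cong-≗ cosCoefficient ∣cosCoefficient∣≤1 {θ + (θ + θ)} {π + π} 3θ≗2π) (cos-+ π π)))
    (ℝ-ring.trans
      (ℝ-ring.sym (ℝ-ring.trans (sin-+ θ (θ + θ))
        (ℝ-ring.+-cong (ℝ-ring.*-congˡ (sin-+ θ θ)) (ℝ-ring.*-congˡ (cos-+ θ θ)))))
      (ℝ-ring.trans (series-cong-≗ sinCoefficient ∣sinCoefficient∣≤1 {θ + (θ + θ)} {π + π} 3θ≗2π) (sin-+ π π)))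
    -- If sin θ vanished, minimality would give `π ≤ θ`, which is by definition the negation of
    -- `θ < π`.
    (λ sinθ≃0 → least θ 0<θ (unwrap sinθ≃0) θ<π)
    using () renaming (c≃-½ to cosθ≃-½; s²≃¾ to sin²θ≃¾) public

-- Knowing s² suffices: (c + is)² = (¼ - ¾) + 2cs i = -½ - si for either sign of s.
cubeRoot-conj : ∀ c s → c ≃ fromℚ (ℚ.- ½) → s * s ≃ fromℚ (½ ℚ.+ ½ ℚ.* ½) → conj (c +i s) ≃ᶜ (c +i s) *ᶜ (c +i s)
cubeRoot-conj c s c≃ s²≃ = re-≃′ , im-≃′
  where
  -s≃ : ∀ s → - s ≃ fromℚ (ℚ.- ½) * s + s * fromℚ (ℚ.- ½)
  -s≃ = solve 1 (λ s → :- s := con (ℚ.- ½) :* s :+ s :* con (ℚ.- ½)) ℝ-ring.refl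
    where open ℝ-Solver
  re-≃′ : c ≃ c * c + - (s * s)
  re-≃′ = ℝ-ring.trans c≃ (ℝ-ring.sym (ℝ-ring.trans (ℝ-ring.+-cong (ℝ-ring.*-cong c≃ c≃) (ℝ-ring.-‿cong s²≃)) (≗⇒≃ λ _ → refl)))
  im-≃′ : - s ≃ c * s + s * c
  im-≃′ = ℝ-ring.trans (-s≃ s) (ℝ-ring.+-cong (ℝ-ring.*-congʳ (ℝ-ring.sym c≃)) (ℝ-ring.*-congˡ (ℝ-ring.sym c≃)))

-- With ω² replaced by `conj ω`, the sum is 1 + 2c, and c = -½.
cubeRoot-sum : ∀ c s → c ≃ fromℚ (ℚ.- ½) → conj (c +i s) ≃ᶜ (c +i s) *ᶜ (c +i s) →
               (1ᶜ +ᶜ (c +i s)) +ᶜ (c +i s) *ᶜ (c +i s) ≃ᶜ 0ᶜ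
cubeRoot-sum c s c≃ conj≃ = ℂ-ring.trans (ℂ-ring.+-congˡ (ℂ-ring.sym conj≃))
  (ℝ-ring.trans (ℝ-ring.+-cong (ℝ-ring.+-congˡ c≃) c≃) (≗⇒≃ λ _ → refl) , cancel s)
  where
  cancel : ∀ s → 0ℝ + s + - s ≃ 0ℝ
  cancel = solve 1 (λ s → con 0ℚ :+ s :+ :- s := con 0ℚ) ℝ-ring.refl
    where open ℝ-Solver

6×-fromℝ : ∀ k → fromℚ (fromℕ 6) * (k * k) ≃ 1ℝ → 6× (fromℝ k *ᶜ fromℝ k) ≃ᶜ 1ᶜ
6×-fromℝ k 6k²≃1 = ℝ-ring.trans (re-≃′ k) 6k²≃1 , im-≃′ k
  where
  open ℝ-Solver
  re-≃′ : ∀ k → re (6× (fromℝ k *ᶜ fromℝ k)) ≃ fromℚ (fromℕ 6) * (k * k)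
  re-≃′ = solve 1 (λ k → let q = k :* k :+ :- (con 0ℚ :* con 0ℚ) in q :+ (q :+ (q :+ (q :+ (q :+ q)))) := con (fromℕ 6) :* (k :* k)) ℝ-ring.refl
  im-≃′ : ∀ k → im (6× (fromℝ k *ᶜ fromℝ k)) ≃ 0ℝ
  im-≃′ = solve 1 (λ k → let q = k :* con 0ℚ :+ con 0ℚ :* k in q :+ (q :+ (q :+ (q :+ (q :+ q)))) := con 0ℚ) ℝ-ring.refl

ω-conj : ∀ π → IsPi π → conj (Construction.ω π) ≃ᶜ Construction.ω π *ᶜ Construction.ω π
ω-conj π isPi = cubeRoot-conj (cos θ) (sin θ) cosθ≃-½ sin²θ≃¾
  where open TwoThirdsPi π isPi

ω-sum : ∀ π → IsPi π → (1ᶜ +ᶜ Construction.ω π) +ᶜ Construction.ω π *ᶜ Construction.ω π ≃ᶜ 0ᶜ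
ω-sum π isPi = cubeRoot-sum (cos θ) (sin θ) cosθ≃-½ (ω-conj π isPi)
  where open TwoThirdsPi π isPi

6×1/√6²≃1 : 6× (fromℝ 1/√6 *ᶜ fromℝ 1/√6) ≃ᶜ 1ᶜ
6×1/√6²≃1 = 6×-fromℝ 1/√6 6*1/√6²≃1

theorem2 : (π : ℝ) → IsPi π →
    IsQLS (Construction.Φ₂₁ π) × HasCardinality (Construction.Φ₂₁ π) 21
theorem2 π isPi = isQLS , hasCardinality
  where open Array 1/√6 6×1/√6²≃1 (Construction.ω π) (ω-sum π isPi) (ω-conj π isPi)
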